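{- Let $k\ge 4$ be a fixed integer. Then $$f\left(n,e,C_{2k+1}\right)=\frac{e}{2}+\frac{n}{2}\sqrt{e-\frac{n^2}{4}}+o(n^2)$$ for $\left\lfloor n^2/4 \right\rfloor+1\le e\le \binom{n}{2}$. Explicitly: for every $\varepsilon>0$ there exists $n_0$ such that for all integers $n\ge n_0$ and all integers $e$ with $\left\lfloor n^2/4 \right\rfloor+1\le e\le \binom{n}{2}$, $$\left| f\left(n,e,C_{2k+1}\right)-\frac{e}{2}-\frac{n}{2}\sqrt{e-\frac{n^2}{4}}\right|\le \varepsilon n^2.$$
   Context: All graphs are finite and simple. In an edge-coloring of a graph $G$, a subgraph $H$ of $G$ is called rainbow if all its edges receive distinct colors. For a graph $H$ and positive integers $n,e$, the maximal anti-Ramsey function $f(n,e,H)$ is the minimum integer $f$ for which there exists an $n$-vertex graph $G$ with at least $e$ edges admitting an edge-coloring with $f$ colors in which every copy of $H$ in $G$ is rainbow. $C_{2k+1}$ denotes the cycle of length $2k+1$. -}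

module Defs where

open import Data.Nat as ℕ using (ℕ; zero; suc; _<ᵇ_)
open import Data.Nat.DivMod using (_mod_)
open import Data.Bool using (Bool; true; false; if_then_else_; _∧_)
open import Data.Fin using (Fin; toℕ)
open import Data.List using (List; map; allFin)
open import Data.Nat.ListAction using (sum)
open import Data.Product using (Σ; _×_; ∃-syntax)
open import Data.Sum using (_⊎_)
open import Relation.Binary.PropositionalEquality using (_≡_)
open import Function.Definitions using (Injective)
open import Data.Integer using (+_)
open import Data.Rational as ℚ using (ℚ; _/_; 0ℚ)

record Graph (n : ℕ) : Set where
  field
    adj   : Fin n → Fin n → Bool
    sym   : ∀ i j → adj i j ≡ adj j i
    irref : ∀ i → adj i i ≡ false
open Graph public

edgeCount : ∀ {n} → Graph n → ℕ
edgeCount {n} G =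
  sum (map (λ i → sum (map (λ j → if (toℕ i <ᵇ toℕ j) ∧ adj G i j then 1 else 0)
                            (allFin n)))
           (allFin n))

-- An edge-colouring of G with (at most) f colours: a colour for every edge,
-- i.e. a symmetric function on adjacent pairs (values on non-edges are irrelevant).
record Coloring {n : ℕ} (G : Graph n) (f : ℕ) : Set where
  field
    col    : Fin n → Fin n → Fin f
    colSym : ∀ i j → adj G i j ≡ true → col i j ≡ col j i
open Coloring public

next : ∀ {m} → Fin (suc m) → Fin (suc m)
next {m} i = suc (toℕ i) mod (suc m)

CycleCopy : ∀ {n} → Graph n → ∀ k → (Fin (suc (2 ℕ.* k)) → Fin n) → Set
CycleCopy G k v = Injective _≡_ _≡_ v × (∀ i → adj G (v i) (v (next i)) ≡ true)

Rainbow : ∀ {n f} {G : Graph n} → Coloring G f → ∀ k → (Fin (suc (2 ℕ.* k)) → Fin n) → Set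
Rainbow c k v = Injective _≡_ _≡_ (λ i → col c (v i) (v (next i)))

Achievable : (n e k f : ℕ) → Set
Achievable n e k f =
  Σ (Graph n) λ G → (e ℕ.≤ edgeCount G) ×
  Σ (Coloring G f) λ c →
    ∀ (v : Fin (suc (2 ℕ.* k)) → Fin n) → CycleCopy G k v → Rainbow c k v

IsMaxAntiRamsey : (n e k m : ℕ) → Set
IsMaxAntiRamsey n e k m = Achievable n e k m × (∀ m' → Achievable n e k m' → m ℕ.≤ m')

⟦_⟧ : ℕ → ℚ
⟦ n ⟧ = + n / 1

-- Comparisons with c·√t for rationals c ≥ 0, t ≥ 0 (√ taken as the real square root),
-- spelled out literally since agda-stdlib has no reals:
--   a ≤ c·√t  ⇔  a ≤ 0  or  a² ≤ c²·t
--   c·√t ≤ b  ⇔  0 ≤ b  and c²·t ≤ b²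
_≤[_√_] : ℚ → ℚ → ℚ → Set
a ≤[ c √ t ] = (a ℚ.≤ 0ℚ) ⊎ (a ℚ.* a ℚ.≤ (c ℚ.* c) ℚ.* t)

[_√_]≤_ : ℚ → ℚ → ℚ → Set
[ c √ t ]≤ b = (0ℚ ℚ.≤ b) × ((c ℚ.* c) ℚ.* t ℚ.≤ b ℚ.* b)

-- Upper bound: take two disjoint cliques of sizes a ≥ n - a, coloured injectively with the same a(a-1)/2
-- colours, with a minimal such that there are e edges. With t = e - n²/4 this means a ≈ n/2 + √t, so that
-- a²/2 ≈ e/2 + (n/2)√t.
--
-- Lower bound: write n = m + q with 2e ≥ m² + q²; the task is to find about m²/2 colours. Two edges ab, cd of the
-- same colour lie on no common cycle of length 2k+1 ≥ 9. Suppose that a and c have many common neighbours. For all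
-- but few edges, a and c can be replaced by other neighbours of b and d, so that besides paths b-a-w-c-d there
-- are many longer ones, and only parity prevents a common cycle. (Repeated vertices are harmless, since
-- a positive proportion of many walks contains a path.) There are two cases.
--
-- Either the ends of edges of the same colour always have few common neighbours. Let S₀, Mid, S₁ be the vertices of
-- high, middle and low degree. Then the edges that meet S₀ ∪ (N(v) ∩ Mid) have different colours for most v.
-- If v has the most neighbours in Mid, at most (|S₁| + |Mid|/2)²/2 edges avoid this set. Averaging over
-- the degree thresholds gives |S₁| + |Mid|/2 ≤ q up to lower order terms, hence e - q²/2 ≥ m²/2 colours.
--
-- Or some vertices a and d are joined by few walks of length 4. Then every vertex has few neighbours in N(a) or in N(d),
-- and after the deletion of the vertices of degree below q this gives 2e ≤ m² + q² up to lower order terms.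
-- If m - q is large this is excluded by a slight decrease of m. If m - q is small, the graph is almost complete
-- bipartite, and an edge inside a side lies on a common odd cycle with almost every pair of edges.

module Submission where

open import Data.Nat as ℕ using (ℕ; zero; suc; _≤_; _<_; z≤n; s≤s; _+_; _*_; _∸_; _^_; _<ᵇ_; _⊔_; _⊓_)
open import Data.Nat.Properties
open import Data.Nat.Tactic.RingSolver using (solve-∀)
open import Data.List as List using (List; []; _∷_; _++_; length; map; [_]; cartesianProduct; allFin)
open import Data.List.Membership.Propositional using (_∈_; _∉_)
open import Data.List.Relation.Unary.Any using (here; there)
open import Data.List.Relation.Unary.All as All using (All; []; _∷_)
open import Data.List.Relation.Unary.Unique.Propositional using (Unique; []; _∷_)
open import Data.Product using (Σ; _×_; _,_; proj₁; proj₂; ∃)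
open import Data.Sum using (_⊎_; inj₁; inj₂; [_,_])
open import Data.Empty using (⊥)
open import Relation.Nullary using (¬_; Dec; yes; no; contradiction)
open import Relation.Nullary.Decidable using (_×-dec_; _⊎-dec_; ¬?; does; dec-true; dec-false)
open import Relation.Binary.PropositionalEquality hiding ([_])
open import Relation.Binary.Definitions using (DecidableEquality; tri<; tri≈; tri>)
open import Function using (_∘_; id; case_of_)
open import Defs hiding (sym)
open import Data.Nat.DivMod using (_%_; m<n⇒m%n≡m; n%n≡0; _/_; m≡m%n+[m/n]*n; m%n<n; _mod_; m*n/n≡m; /-monoˡ-≤)
open import Data.Bool using (Bool; true; false; if_then_else_; _∧_)
import Data.Bool.Properties as Bool
open import Data.Fin as Fin using (Fin; toℕ)
import Data.Fin.Properties as Fin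
open import Data.List.Properties using (length-++; length-map; ++-assoc; ++-identityʳ; length-tabulate; map-tabulate)
open import Data.List.Membership.Propositional.Properties using (∈-++⁺ˡ; ∈-++⁺ʳ; ∈-allFin; ∈-∃++)
import Data.List.Relation.Unary.All.Properties as All
open import Data.List.Relation.Unary.Linked using (Linked; []; [-]; _∷_)
open import Data.List.Relation.Unary.Unique.Propositional.Properties using (allFin⁺)
open import Data.Nat.ListAction using (sum)
open import Data.Nat.Combinatorics using (_C_; nC1≡n; nCk+nC[k+1]≡[n+1]C[k+1])
import Data.Integer as ℤ
import Data.Integer.Properties as ℤ
open import Data.Rational as ℚ using (ℚ; mkℚ; 0ℚ; 1ℚ; ½)
import Data.Rational.Properties as ℚ
open import Data.Rational.Unnormalised as ℚᵘ using (mkℚᵘ; *≡*; *≤*)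
import Data.Rational.Unnormalised.Properties as ℚᵘ
open import Data.Rational.Solver using (module +-*-Solver)

-- The bound k ≥ 4 comes from the closed route through two disjoint edges ab and cd: b, four
-- internal vertices, d, c, a common neighbour of a and c, and a are 9 vertices. The four internal
-- vertices arise from a walk a to d with three of them by one change of parity (`shift`); longer
-- cycles only need padding by two (`pad`), which costs a power of the density but no new
-- hypothesis.
--
-- Deleting vertices of low degree is harmless because the target m²/2 does not involve q: a vertex
-- of degree below q goes, q drops by one, and the inequality between m² + q² and the degree sum
-- survives. So a minimum degree comes for free, and any surplus of edges is kept as well.
--
-- All estimates live in the natural numbers: `D * x ≤ D * y + n * n` stands for x ≤ y + n²/D. Edges
-- are counted as ordered pairs, so the degree sum is twice the number of edges and f colours appear
-- as `2 * f`.

-- An inequality between polynomials follows from a hypothesis X ≤ Y once the ring solver confirms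
-- that the difference of the sides exceeds Y - X by some r with natural coefficients.
by-adding : ∀ {a b X Y} → X ≤ Y → ∀ r → a + Y + r ≡ b + X → a ≤ b
by-adding {a} {b} {X} {Y} X≤Y r eq = +-cancelʳ-≤ X a b (begin
  a + X      ≤⟨ +-monoʳ-≤ a X≤Y ⟩
  a + Y      ≤⟨ m≤m+n (a + Y) r ⟩
  a + Y + r  ≡⟨ eq ⟩
  b + X      ∎)
  where open ≤-Reasoning

≤-slack : ∀ {a b} r → a + r ≡ b → a ≤ b
≤-slack {a} r refl = m≤m+n a r

double-product : ∀ a b → 2 * (a * b) ≤ a * a + b * b
double-product a b with ≤-total a b
... | inj₁ a≤b = subst (λ b → 2 * (a * b) ≤ a * a + b * b) (m+[n∸m]≡n a≤b)
                   (≤-slack ((b ∸ a) * (b ∸ a)) (identity a (b ∸ a)))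
  where
  identity : ∀ a c → 2 * (a * (a + c)) + c * c ≡ a * a + (a + c) * (a + c)
  identity = solve-∀
... | inj₂ b≤a = subst (λ a → 2 * (a * b) ≤ a * a + b * b) (m+[n∸m]≡n b≤a)
                   (≤-slack ((a ∸ b) * (a ∸ b)) (identity b (a ∸ b)))
  where
  identity : ∀ b c → 2 * ((b + c) * b) + c * c ≡ (b + c) * (b + c) + b * b
  identity = solve-∀

sq-mono : ∀ {a b} → a ≤ b → a * a ≤ b * b
sq-mono a≤b = *-mono-≤ a≤b a≤b

-- Indicators, finite sums and averaging

𝟙 : ∀ {P : Set} → Dec P → ℕ
𝟙 (yes _) = 1
𝟙 (no _)  = 0

module _ {P : Set} where
  𝟙≤1 : (d : Dec P) → 𝟙 d ≤ 1
  𝟙≤1 (yes _) = ≤-refl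
  𝟙≤1 (no _)  = z≤n

  𝟙-yes : (d : Dec P) → P → 𝟙 d ≡ 1
  𝟙-yes (yes _) p = refl
  𝟙-yes (no ¬p) p = contradiction p ¬p

  𝟙-no : (d : Dec P) → ¬ P → 𝟙 d ≡ 0
  𝟙-no (yes p) ¬p = contradiction p ¬p
  𝟙-no (no _)  ¬p = refl

  𝟙-positive : (d : Dec P) → 0 < 𝟙 d → P
  𝟙-positive (yes p) _ = p

𝟙-mono : ∀ {P Q : Set} (d : Dec P) (e : Dec Q) → (P → Q) → 𝟙 d ≤ 𝟙 e
𝟙-mono (no _)  e P→Q = z≤n
𝟙-mono (yes p) e P→Q = ≤-reflexive (sym (𝟙-yes e (P→Q p)))

𝟙-complement : ∀ {P : Set} (d : Dec P) → 𝟙 d + 𝟙 (¬? d) ≡ 1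
𝟙-complement (yes _) = refl
𝟙-complement (no _)  = refl

𝟙-drop : ∀ {P : Set} (d : Dec P) a → 𝟙 d * a ≤ a
𝟙-drop d a = ≤-trans (*-monoˡ-≤ a (𝟙≤1 d)) (≤-reflexive (*-identityˡ a))

module _ {X : Set} where

  ∑ : List X → (X → ℕ) → ℕ
  ∑ []       f = 0
  ∑ (x ∷ xs) f = f x + ∑ xs f

  ∑-cong : ∀ xs {f g : X → ℕ} → (∀ x → f x ≡ g x) → ∑ xs f ≡ ∑ xs g
  ∑-cong []       eq = refl
  ∑-cong (x ∷ xs) eq = cong₂ _+_ (eq x) (∑-cong xs eq)

  ∑-mono∈ : ∀ xs {f g : X → ℕ} → (∀ x → x ∈ xs → f x ≤ g x) → ∑ xs f ≤ ∑ xs g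
  ∑-mono∈ []       le = z≤n
  ∑-mono∈ (x ∷ xs) le = +-mono-≤ (le x (here refl)) (∑-mono∈ xs λ y y∈ → le y (there y∈))

  ∑-mono : ∀ xs {f g : X → ℕ} → (∀ x → f x ≤ g x) → ∑ xs f ≤ ∑ xs g
  ∑-mono xs le = ∑-mono∈ xs λ x _ → le x

  ∑-zero : ∀ xs → ∑ xs (λ _ → 0) ≡ 0
  ∑-zero []       = refl
  ∑-zero (x ∷ xs) = ∑-zero xs

  ∑-+ : ∀ xs (f g : X → ℕ) → ∑ xs (λ x → f x + g x) ≡ ∑ xs f + ∑ xs g
  ∑-+ []       f g = refl
  ∑-+ (x ∷ xs) f g = trans (cong (f x + g x +_) (∑-+ xs f g)) (regroup (f x) (g x) (∑ xs f) (∑ xs g))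
    where
    regroup : ∀ a b c d → a + b + (c + d) ≡ a + c + (b + d)
    regroup = solve-∀

  ∑-*ˡ : ∀ xs c (f : X → ℕ) → ∑ xs (λ x → c * f x) ≡ c * ∑ xs f
  ∑-*ˡ []       c f = sym (*-zeroʳ c)
  ∑-*ˡ (x ∷ xs) c f = trans (cong (c * f x +_) (∑-*ˡ xs c f)) (sym (*-distribˡ-+ c (f x) (∑ xs f)))

  ∑-*ʳ : ∀ xs c (f : X → ℕ) → ∑ xs (λ x → f x * c) ≡ ∑ xs f * c
  ∑-*ʳ xs c f = trans (∑-cong xs λ x → *-comm (f x) c) (trans (∑-*ˡ xs c f) (*-comm c (∑ xs f)))

  ∑-const : ∀ xs c → ∑ xs (λ _ → c) ≡ length xs * c
  ∑-const []       c = refl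
  ∑-const (x ∷ xs) c = cong (c +_) (∑-const xs c)

  ∑-bounded : ∀ xs {f : X → ℕ} c → (∀ x → f x ≤ c) → ∑ xs f ≤ length xs * c
  ∑-bounded xs c le = ≤-trans (∑-mono xs le) (≤-reflexive (∑-const xs c))

  ∑-++ : ∀ xs ys (f : X → ℕ) → ∑ (xs ++ ys) f ≡ ∑ xs f + ∑ ys f
  ∑-++ []       ys f = refl
  ∑-++ (x ∷ xs) ys f = trans (cong (f x +_) (∑-++ xs ys f)) (sym (+-assoc (f x) (∑ xs f) (∑ ys f)))

  term≤∑ : ∀ {xs x} → x ∈ xs → (f : X → ℕ) → f x ≤ ∑ xs f
  term≤∑ (here refl)         f = m≤m+n _ _
  term≤∑ {y ∷ xs} (there x∈) f = ≤-trans (term≤∑ x∈ f) (m≤n+m _ (f y))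

  -- The first weighted average above c is witnessed by a point of positive weight.
  pigeonhole : ∀ xs (w f : X → ℕ) c → c * ∑ xs w < ∑ xs (λ x → w x * f x) →
               ∃ λ x → x ∈ xs × 0 < w x × c < f x
  pigeonhole []       w f c ()
  pigeonhole (x ∷ xs) w f c lt with 0 <? w x ×-dec c <? f x
  ... | yes (w>0 , c<f) = x , here refl , w>0 , c<f
  ... | no  none = let y , y∈ , w>0 , c<f = pigeonhole xs w f c rest in y , there y∈ , w>0 , c<f
    where
    open ≤-Reasoning
    small : w x * f x ≤ c * w x
    small with w x
    ... | zero = z≤n
    ... | suc a = ≤-trans (*-monoʳ-≤ (suc a) (≮⇒≥ λ c<f → none (s≤s z≤n , c<f)))
                          (≤-reflexive (*-comm (suc a) c))
    rest : c * ∑ xs w < ∑ xs (λ y → w y * f y)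
    rest = +-cancelˡ-< (c * w x) _ _ (begin-strict
      c * w x + c * ∑ xs w                 ≡⟨ *-distribˡ-+ c (w x) (∑ xs w) ⟨
      c * (w x + ∑ xs w)                   <⟨ lt ⟩
      w x * f x + ∑ xs (λ y → w y * f y)   ≤⟨ +-monoˡ-≤ _ small ⟩
      c * w x + ∑ xs (λ y → w y * f y)     ∎)

  -- Positivity of the total weight survives the recursion: a first value above `c` leaves a strict
  -- inequality for the rest, which is impossible when the rest has weight 0.
  pigeonhole-low : ∀ xs (w f : X → ℕ) c → 0 < ∑ xs w → ∑ xs (λ x → w x * f x) ≤ c * ∑ xs w →
                   ∃ λ x → x ∈ xs × 0 < w x × f x ≤ c
  pigeonhole-low (x ∷ xs) w f c pos le with w x in eq
  ... | zero with y , y∈ , w>0 , f≤c ← pigeonhole-low xs w f c pos le = y , there y∈ , w>0 , f≤c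
  ... | suc a with f x ≤? c
  ...   | yes f≤c = x , here refl , subst (0 <_) (sym eq) (s≤s z≤n) , f≤c
  ...   | no  f≰c = let y , y∈ , w>0 , f≤c = pigeonhole-low xs w f c positive (<⇒≤ lt) in y , there y∈ , w>0 , f≤c
    where
    open ≤-Reasoning
    lt : ∑ xs (λ y → w y * f y) < c * ∑ xs w
    lt = +-cancelˡ-< (c * suc a) _ _ (begin-strict
      c * suc a + ∑ xs (λ y → w y * f y)     <⟨ +-monoˡ-< _ (*-monoˡ-< (suc a) (≰⇒> f≰c)) ⟩
      f x * suc a + ∑ xs (λ y → w y * f y)   ≡⟨ cong (_+ ∑ xs (λ y → w y * f y)) (*-comm (f x) (suc a)) ⟩
      suc a * f x + ∑ xs (λ y → w y * f y)   ≤⟨ le ⟩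
      c * (suc a + ∑ xs w)                   ≡⟨ *-distribˡ-+ c (suc a) (∑ xs w) ⟩
      c * suc a + c * ∑ xs w                 ∎)
    positive : 0 < ∑ xs w
    positive = *-cancelˡ-< c 0 _ (≤-<-trans (≤-reflexive (*-zeroʳ c)) (≤-<-trans z≤n lt))

∑-swap : ∀ {X Y : Set} (xs : List X) (ys : List Y) (f : X → Y → ℕ) →
         ∑ xs (λ x → ∑ ys (λ y → f x y)) ≡ ∑ ys (λ y → ∑ xs (λ x → f x y))
∑-swap []       ys f = sym (∑-zero ys)
∑-swap (x ∷ xs) ys f = trans (cong (∑ ys (f x) +_) (∑-swap xs ys f)) (sym (∑-+ ys (f x) _))

∑-product : ∀ {X Y : Set} (xs : List X) (ys : List Y) (f : X → ℕ) (g : Y → ℕ) →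
            ∑ xs (λ x → ∑ ys (λ y → f x * g y)) ≡ ∑ xs f * ∑ ys g
∑-product xs ys f g = trans (∑-cong xs λ x → ∑-*ˡ ys (f x) g) (∑-*ʳ xs (∑ ys g) f)

-- Sum 2 f(x) f(y) ≤ f(x)² + f(y)² over all ordered pairs.
cauchy-schwarz : ∀ {X : Set} (xs : List X) (f : X → ℕ) →
                 ∑ xs f * ∑ xs f ≤ length xs * ∑ xs (λ x → f x * f x)
cauchy-schwarz xs f = *-cancelˡ-≤ 2 (begin
  2 * (∑ xs f * ∑ xs f)                                     ≡⟨ cong (2 *_) (∑-product xs xs f f) ⟨
  2 * ∑ xs (λ x → ∑ xs λ y → f x * f y)                     ≡⟨ ∑-*ˡ xs 2 _ ⟨
  ∑ xs (λ x → 2 * ∑ xs λ y → f x * f y)                     ≡⟨ ∑-cong xs (λ x → sym (∑-*ˡ xs 2 _)) ⟩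
  ∑ xs (λ x → ∑ xs λ y → 2 * (f x * f y))                   ≤⟨ ∑-mono xs (λ x → ∑-mono xs λ y → double-product (f x) (f y)) ⟩
  ∑ xs (λ x → ∑ xs λ y → f x * f x + f y * f y)             ≡⟨ ∑-cong xs (λ x → ∑-+ xs _ _) ⟩
  ∑ xs (λ x → ∑ xs (λ _ → f x * f x) + S)                   ≡⟨ ∑-+ xs _ _ ⟩
  ∑ xs (λ x → ∑ xs (λ _ → f x * f x)) + ∑ xs (λ _ → S)      ≡⟨ cong₂ _+_ (∑-swap xs xs _) refl ⟩
  ∑ xs (λ _ → S) + ∑ xs (λ _ → S)                           ≡⟨ cong₂ _+_ (∑-const xs S) (∑-const xs S) ⟩
  length xs * S + length xs * S                             ≡⟨ twice (length xs * S) ⟩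
  2 * (length xs * S)                                       ∎)
  where
  open ≤-Reasoning
  S = ∑ xs λ x → f x * f x
  twice : ∀ a → a + a ≡ 2 * a
  twice = solve-∀

module _ {X : Set} (_≟_ : DecidableEquality X) where
  open import Data.List.Membership.DecPropositional _≟_ using (_∈?_)

  ∑-point-absent : ∀ {xs z} → z ∉ xs → ∑ xs (λ x → 𝟙 (x ≟ z)) ≡ 0
  ∑-point-absent {[]}     z∉ = refl
  ∑-point-absent {x ∷ xs} z∉ =
    cong₂ _+_ (𝟙-no (x ≟ _) λ eq → z∉ (here (sym eq))) (∑-point-absent λ z∈ → z∉ (there z∈))

  ∑-point : ∀ {xs} → Unique xs → ∀ z (g : X → ℕ) → ∑ xs (λ x → 𝟙 (x ≟ z) * g x) ≤ g z
  ∑-point []       z g = z≤n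
  ∑-point {x ∷ xs} (x∉ ∷ u) z g with x ≟ z
  ... | no _     = ∑-point u z g
  ... | yes refl = ≤-reflexive (trans (cong (1 * g x +_) (rest xs x∉)) (identity (g x)))
    where
    rest : ∀ xs → All (x ≢_) xs → ∑ xs (λ y → 𝟙 (y ≟ x) * g y) ≡ 0
    rest []       []       = refl
    rest (y ∷ ys) (p ∷ ps) = cong₂ _+_ (cong (_* g y) (𝟙-no (y ≟ x) λ eq → p (sym eq))) (rest ys ps)
    identity : ∀ a → 1 * a + 0 ≡ a
    identity = solve-∀

  -- `F` may contain repetitions, so membership is bounded by the number of occurrences in `F`, and
  -- the two sums are exchanged.
  ∑-members : ∀ {xs} → Unique xs → ∀ F (g : X → ℕ) c → (∀ x → g x ≤ c) →
              ∑ xs (λ x → 𝟙 (x ∈? F) * g x) ≤ length F * c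
  ∑-members {xs} u F g c le = begin
    ∑ xs (λ x → 𝟙 (x ∈? F) * g x)               ≤⟨ ∑-mono xs (λ x → *-monoˡ-≤ (g x) (count F x)) ⟩
    ∑ xs (λ x → ∑ F (λ y → 𝟙 (x ≟ y)) * g x)    ≡⟨ ∑-cong xs (λ x → sym (∑-*ʳ F (g x) _)) ⟩
    ∑ xs (λ x → ∑ F (λ y → 𝟙 (x ≟ y) * g x))    ≡⟨ ∑-swap xs F _ ⟩
    ∑ F (λ y → ∑ xs (λ x → 𝟙 (x ≟ y) * g x))    ≤⟨ ∑-mono F (λ y → ∑-point u y g) ⟩
    ∑ F g                                       ≤⟨ ∑-bounded F c le ⟩
    length F * c                                ∎
    where
    open ≤-Reasoning
    count : ∀ F x → 𝟙 (x ∈? F) ≤ ∑ F (λ y → 𝟙 (x ≟ y))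
    count F x with x ∈? F
    ... | no _   = z≤n
    ... | yes x∈ = ≤-trans (≤-reflexive (sym (𝟙-yes (x ≟ x) refl))) (term≤∑ x∈ _)

∑< : ℕ → (ℕ → ℕ) → ℕ
∑< zero    f = 0
∑< (suc h) f = f h + ∑< h f

-- The smallest term is at most the average. This later fixes one degree threshold out of `h`
-- candidates.
∑<-low : ∀ h (f : ℕ → ℕ) → 0 < h → ∃ λ i → i < h × h * f i ≤ ∑< h f
∑<-low (suc zero) f _ = 0 , s≤s z≤n , ≤-refl
∑<-low (suc (suc h)) f _ with ∑<-low (suc h) f (s≤s z≤n)
... | i , i<h , le with ≤-total (f (suc h)) (f i)
...   | inj₁ f≤ = suc h , ≤-refl , +-monoʳ-≤ (f (suc h)) (≤-trans (*-monoʳ-≤ (suc h) f≤) le)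
...   | inj₂ f≥ = i , m≤n⇒m≤1+n i<h , +-mono-≤ f≥ le

-- Walks of a graph through a list V of vertices

module Walks {N : ℕ} (Γ : Graph N) (V : List (Fin N)) where

  n : ℕ
  n = length V

  Adj : Fin N → Fin N → Set
  Adj x y = adj Γ x y ≡ true

  adj? : ∀ x y → Dec (Adj x y)
  adj? x y = adj Γ x y Bool.≟ true

  Adj-sym : ∀ {x y} → Adj x y → Adj y x
  Adj-sym {x} {y} = trans (Graph.sym Γ y x)

  Adj⇒≢ : ∀ {x y} → Adj x y → x ≢ y
  Adj⇒≢ {x} xy refl with () ← trans (sym (irref Γ x)) xy

  α : Fin N → Fin N → ℕ
  α x y = 𝟙 (adj? x y)

  α-sym : ∀ x y → α x y ≡ α y x
  α-sym x y = ≤-antisym (𝟙-mono (adj? x y) (adj? y x) Adj-sym) (𝟙-mono (adj? y x) (adj? x y) Adj-sym)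

  α≤1 : ∀ x y → α x y ≤ 1
  α≤1 x y = 𝟙≤1 (adj? x y)

  α-positive : ∀ {x y} → 0 < α x y → Adj x y
  α-positive {x} {y} = 𝟙-positive (adj? x y)

  α-yes : ∀ {x y} → Adj x y → α x y ≡ 1
  α-yes {x} {y} = 𝟙-yes (adj? x y)

  α-drop : ∀ x y a → α x y * a ≤ a
  α-drop x y = 𝟙-drop (adj? x y)

  deg : Fin N → ℕ
  deg x = ∑ V (α x)

  deg≤n : ∀ x → deg x ≤ n
  deg≤n x = ≤-trans (∑-bounded V 1 (α≤1 x)) (≤-reflexive (*-identityʳ n))

  -- w l x y counts the walks from x to y with l internal vertices, all of them in V.
  w : ℕ → Fin N → Fin N → ℕ
  w zero    x y = α x y
  w (suc l) x y = ∑ V λ z → α x z * w l z y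

  w≤ : ∀ l x y → w l x y ≤ n ^ l
  w≤ zero    x y = α≤1 x y
  w≤ (suc l) x y = ∑-bounded V (n ^ l) λ z → ≤-trans (α-drop x z _) (w≤ l z y)

  w≤deg : ∀ l x y → w (suc l) x y ≤ deg x * n ^ l
  w≤deg l x y = ≤-trans (∑-mono V λ z → *-monoʳ-≤ (α x z) (w≤ l z y)) (≤-reflexive (∑-*ʳ V (n ^ l) (α x)))

  -- A walk is cut at its internal vertex number `i + 1`.
  w-compose : ∀ i j x y → w (suc (i + j)) x y ≡ ∑ V λ z → w i x z * w j z y
  w-compose zero    j x y = refl
  w-compose (suc i) j x y = begin
    ∑ V (λ u → α x u * w (suc (i + j)) u y)                ≡⟨ ∑-cong V (λ u → cong (α x u *_) (w-compose i j u y)) ⟩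
    ∑ V (λ u → α x u * ∑ V λ z → w i u z * w j z y)        ≡⟨ ∑-cong V (λ u → sym (∑-*ˡ V (α x u) _)) ⟩
    ∑ V (λ u → ∑ V λ z → α x u * (w i u z * w j z y))      ≡⟨ ∑-swap V V _ ⟩
    ∑ V (λ z → ∑ V λ u → α x u * (w i u z * w j z y))      ≡⟨ ∑-cong V (λ z → ∑-cong V λ u → sym (*-assoc (α x u) _ _)) ⟩
    ∑ V (λ z → ∑ V λ u → α x u * w i u z * w j z y)        ≡⟨ ∑-cong V (λ z → ∑-*ʳ V (w j z y) _) ⟩
    ∑ V (λ z → w (suc i) x z * w j z y)                    ∎
    where open ≡-Reasoning

  w-sym : ∀ l x y → w l x y ≡ w l y x
  w-sym zero    x y = α-sym x y
  w-sym (suc l) x y = begin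
    ∑ V (λ z → α x z * w l z y)   ≡⟨ ∑-cong V (λ z → cong₂ _*_ (α-sym x z) (w-sym l z y)) ⟩
    ∑ V (λ z → α z x * w l y z)   ≡⟨ ∑-cong V (λ z → *-comm (α z x) _) ⟩
    ∑ V (λ z → w l y z * α z x)   ≡⟨ w-compose l 0 y x ⟨
    w (suc (l + 0)) y x           ≡⟨ cong (λ i → w (suc i) y x) (+-identityʳ l) ⟩
    w (suc l) y x                 ∎
    where open ≡-Reasoning

  -- The normalisation `n ^ l` is the trivial maximum `w≤` of the walk count, so `D` is the
  -- reciprocal of a density.
  Dense : ℕ → ℕ → Fin N → Fin N → Set
  Dense D l x y = n ^ l ≤ D * w l x y

  dense? : ∀ D l x y → Dec (Dense D l x y)
  dense? D l x y = n ^ l ℕ.≤? D * w l x y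

  Dense-sym : ∀ {D} l {x y} → Dense D l x y → Dense D l y x
  Dense-sym {D} l {x} {y} = subst (λ a → n ^ l ≤ D * a) (w-sym l x y)

  -- Two applications of Cauchy-Schwarz: the walks from a to y of the shorter length are
  -- prolonged by going back and forth once at their first internal vertex.
  pad : ∀ {D} i {a y} → Dense D (2 + i) a y → Dense (D ^ 4) (4 + i) a y
  pad {D} i {a} {y} dense with n in n-eq
  ... | zero   = z≤n
  ... | suc n′ = *-cancelˡ-≤ (ν * ν * ν * ν * M * M * M) {{nonZero}} (begin
    ν * ν * ν * ν * M * M * M * (ν * (ν * (ν * (ν * M))))       ≡⟨ identity₁ ν M ⟩
    (ν * (ν * M)) * (ν * (ν * M)) * ((ν * (ν * M)) * (ν * (ν * M))) ≤⟨ sq-mono (sq-mono dense) ⟩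
    D * s * (D * s) * (D * s * (D * s))                         ≡⟨ identity₂ D s ⟩
    D ^ 4 * (s * s * (s * s))                                   ≤⟨ *-monoʳ-≤ (D ^ 4) (sq-mono step₁) ⟩
    D ^ 4 * (ν * (M * T) * (ν * (M * T)))                       ≡⟨ identity₃ (D ^ 4) ν M T ⟩
    D ^ 4 * (ν * ν * M * M * (T * T))                           ≤⟨ *-monoʳ-≤ (D ^ 4) (*-monoʳ-≤ (ν * ν * M * M) step₂) ⟩
    D ^ 4 * (ν * ν * M * M * (ν * (ν * M * W)))                 ≡⟨ identity₄ (D ^ 4) ν M W ⟩
    ν * ν * ν * ν * M * M * M * (D ^ 4 * W)                     ∎)
    where
    open ≤-Reasoning
    ν = suc n′
    M = ν ^ i
    nonZero : ℕ.NonZero (ν * ν * ν * ν * M * M * M)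
    nonZero = let instance M≢0 = m^n≢0 ν i in
      m*n≢0 (ν * ν * ν * ν * M * M) M
        {{m*n≢0 (ν * ν * ν * ν * M) M {{m*n≢0 (ν * ν * ν * ν) M}}}}
    s = w (2 + i) a y
    W = w (4 + i) a y
    ω : Fin N → ℕ
    ω t = α a t * w (suc i) t y
    T = ∑ V λ t → deg t * ω t
    h : Fin N → ℕ
    h x = ∑ V λ t → α x t * ω t
    identity₁ : ∀ ν M → ν * ν * ν * ν * M * M * M * (ν * (ν * (ν * (ν * M)))) ≡ (ν * (ν * M)) * (ν * (ν * M)) * ((ν * (ν * M)) * (ν * (ν * M)))
    identity₁ = solve-∀
    identity₂ : ∀ D s → D * s * (D * s) * (D * s * (D * s)) ≡ D * (D * (D * (D * 1))) * (s * s * (s * s))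
    identity₂ = solve-∀
    identity₃ : ∀ D ν M T → D * (ν * (M * T) * (ν * (M * T))) ≡ D * (ν * ν * M * M * (T * T))
    identity₃ = solve-∀
    identity₄ : ∀ D ν M W → D * (ν * ν * M * M * (ν * (ν * M * W))) ≡ ν * ν * ν * ν * M * M * M * (D * W)
    identity₄ = solve-∀
    ω≤ : ∀ t → ω t ≤ M * deg t
    ω≤ t = ≤-trans (α-drop a t _) (≤-trans (w≤deg i t y)
             (≤-reflexive (trans (*-comm (deg t) (n ^ i)) (cong (λ c → c ^ i * deg t) n-eq))))
    -- Since `ω t` is at most `M * deg t`, many walks from `a` to `y` remain numerous when each is
    -- weighted by the degree of its first internal vertex; `T` is this weighted count.
    step₁ : s * s ≤ ν * (M * T)
    step₁ = begin
      s * s                             ≤⟨ cauchy-schwarz V ω ⟩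
      n * ∑ V (λ t → ω t * ω t)         ≤⟨ *-monoʳ-≤ n (∑-mono V λ t → ≤-trans (*-monoˡ-≤ (ω t) (ω≤ t))
                                              (≤-reflexive (*-assoc M (deg t) (ω t)))) ⟩
      n * ∑ V (λ t → M * (deg t * ω t)) ≡⟨ cong₂ _*_ n-eq (∑-*ˡ V M _) ⟩
      ν * (M * T)                       ∎
    h-total : ∑ V h ≡ T
    h-total = trans (∑-swap V V _) (∑-cong V λ t → trans (∑-*ʳ V (ω t) _)
                (cong (_* ω t) (∑-cong V λ x → α-sym x t)))
    -- `h x` is bounded once by the walks of length 2 from `a` to `x` and once by the walks from `x`
    -- to `y`. The product of both bounds, summed over `x`, counts the prolonged walks.
    h≤₁ : ∀ x → h x ≤ ν * M * w 1 a x
    h≤₁ x = begin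
      ∑ V (λ t → α x t * (α a t * w (suc i) t y))
        ≤⟨ ∑-mono V (λ t → *-monoʳ-≤ (α x t) (*-monoʳ-≤ (α a t) (w≤ (suc i) t y))) ⟩
      ∑ V (λ t → α x t * (α a t * (n * n ^ i)))
        ≡⟨ ∑-cong V (λ t → trans (cong₂ (λ b c → b * (α a t * (c * c ^ i))) (α-sym x t) n-eq)
                                 (reorder (α t x) (α a t) (ν * M))) ⟩
      ∑ V (λ t → ν * M * (α a t * α t x))
        ≡⟨ ∑-*ˡ V (ν * M) _ ⟩
      ν * M * w 1 a x ∎
      where
      reorder : ∀ a b c → a * (b * c) ≡ c * (b * a)
      reorder = solve-∀
    h≤₂ : ∀ x → h x ≤ w (2 + i) x y
    h≤₂ x = ∑-mono V λ t → *-monoʳ-≤ (α x t) (α-drop a t _)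
    step₂ : T * T ≤ ν * (ν * M * W)
    step₂ = begin
      T * T                                                 ≡⟨ cong₂ _*_ h-total h-total ⟨
      ∑ V h * ∑ V h                                         ≤⟨ cauchy-schwarz V h ⟩
      n * ∑ V (λ x → h x * h x)                             ≤⟨ *-monoʳ-≤ n (∑-mono V λ x → *-mono-≤ (h≤₁ x) (h≤₂ x)) ⟩
      n * ∑ V (λ x → ν * M * w 1 a x * w (2 + i) x y)       ≡⟨ cong₂ _*_ n-eq (∑-cong V λ x → *-assoc (ν * M) _ _) ⟩
      ν * ∑ V (λ x → ν * M * (w 1 a x * w (2 + i) x y))     ≡⟨ cong (ν *_) (∑-*ˡ V (ν * M) _) ⟩
      ν * (ν * M * ∑ V (λ x → w 1 a x * w (2 + i) x y))     ≡⟨ cong (λ c → ν * (ν * M * c)) (w-compose 1 (2 + i) a y) ⟨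
      ν * (ν * M * W)                                       ∎

  thin : ℕ → Fin N → Fin N → ℕ
  thin G b z = 𝟙 (G * w 1 b z ℕ.<? n)

  miss : ℕ → Fin N → Fin N → ℕ
  miss G a b = ∑ V λ z → α a z * thin G b z

  -- Almost every neighbour of `a` is reached from `b` by many paths of length 2. This is what
  -- allows a walk starting at `a` to be restarted at `b` with one more vertex, hence with the other
  -- parity.
  Robust : ℕ → ℕ → Fin N → Fin N → Set
  Robust B G a b = B * miss G a b ≤ n

  robust? : ∀ B G a b → Dec (Robust B G a b)
  robust? B G a b = B * miss G a b ℕ.≤? n

  -- The first step a-z of a walk is replaced by two steps b-u-z. At most n/B neighbours z of `a`
  -- have too few such u, and because `2 * D ≤ B` they account for at most half of the walks from
  -- `a` to `y`.
  shift : ∀ {B G D} l {a b y} → Robust B G a b → 2 * D ≤ B →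
          Dense D (1 + l) a y → Dense (B * G) (2 + l) b y
  shift {B} {G} {D} l {a} {b} {y} robust 2D≤B dense = by-adding main 0 (final n (n ^ l) (B * G * W))
    where
    open ≤-Reasoning
    W = w (2 + l) b y
    pointwise : ∀ z → n * (α a z * w l z y) ≤ G * (w 1 b z * w l z y) + n * n ^ l * (α a z * thin G b z)
    pointwise z with G * w 1 b z ℕ.<? n
    ... | yes _ = ≤-trans (≤-trans (*-monoʳ-≤ n (*-monoʳ-≤ (α a z) (w≤ l z y)))
                    (≤-reflexive (reorder n (α a z) (n ^ l)))) (m≤n+m _ (G * (w 1 b z * w l z y)))
      where
      reorder : ∀ n α m → n * (α * m) ≡ n * m * (α * 1)
      reorder = solve-∀
    ... | no ¬thin = ≤-trans (*-monoʳ-≤ n (α-drop a z _)) (≤-trans (*-monoˡ-≤ (w l z y) (≮⇒≥ ¬thin))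
                       (≤-trans (≤-reflexive (*-assoc G _ _)) (m≤m+n _ _)))
    summed : n * w (1 + l) a y ≤ G * W + n * n ^ l * miss G a b
    summed = begin
      n * ∑ V (λ z → α a z * w l z y)
        ≡⟨ ∑-*ˡ V n _ ⟨
      ∑ V (λ z → n * (α a z * w l z y))
        ≤⟨ ∑-mono V pointwise ⟩
      ∑ V (λ z → G * (w 1 b z * w l z y) + n * n ^ l * (α a z * thin G b z))
        ≡⟨ ∑-+ V _ _ ⟩
      ∑ V (λ z → G * (w 1 b z * w l z y)) + ∑ V (λ z → n * n ^ l * (α a z * thin G b z))
        ≡⟨ cong₂ _+_ (∑-*ˡ V G _) (∑-*ˡ V (n * n ^ l) _) ⟩
      G * ∑ V (λ z → w 1 b z * w l z y) + n * n ^ l * miss G a b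
        ≡⟨ cong (λ c → G * c + n * n ^ l * miss G a b) (w-compose 1 l b y) ⟨
      G * W + n * n ^ l * miss G a b ∎
    main : n * (2 * (n * n ^ l)) ≤ B * G * W + n * n ^ l * n
    main = begin
      n * (2 * (n * n ^ l))                        ≤⟨ *-monoʳ-≤ n (*-monoʳ-≤ 2 dense) ⟩
      n * (2 * (D * w (1 + l) a y))                ≡⟨ cong (n *_) (*-assoc 2 D _) ⟨
      n * (2 * D * w (1 + l) a y)                  ≤⟨ *-monoʳ-≤ n (*-monoˡ-≤ (w (1 + l) a y) 2D≤B) ⟩
      n * (B * w (1 + l) a y)                      ≡⟨ reorder n B _ ⟩
      B * (n * w (1 + l) a y)                      ≤⟨ *-monoʳ-≤ B summed ⟩
      B * (G * W + n * n ^ l * miss G a b)         ≡⟨ distribute B G W (n * n ^ l) (miss G a b) ⟩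
      B * G * W + n * n ^ l * (B * miss G a b)     ≤⟨ +-monoʳ-≤ (B * G * W) (*-monoʳ-≤ (n * n ^ l) robust) ⟩
      B * G * W + n * n ^ l * n                    ∎
      where
      reorder : ∀ n B a → n * (B * a) ≡ B * (n * a)
      reorder = solve-∀
      distribute : ∀ B G W p m → B * (G * W + p * m) ≡ B * G * W + p * (B * m)
      distribute = solve-∀
    final : ∀ n m c → n * (n * m) + (c + n * m * n) + 0 ≡ c + n * (2 * (n * m))
    final = solve-∀

-- From many walks to cycles

module Routes {N : ℕ} (Γ : Graph N) (V : List (Fin N)) (unique-V : Unique V) (M : ℕ) where
  open Walks Γ V
  open import Data.List.Membership.DecPropositional (Fin._≟_ {n = N}) using (_∈?_)

  K : ℕ
  K = M * (M + M)

  -- A segment of length 0 is an edge; K n^l walks is more than can fail to be paths avoiding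
  -- a set of at most M vertices.
  Rich : ℕ → Fin N → Fin N → Set
  Rich zero    u v = Adj u v
  Rich (suc l) u v = K * n ^ l < w (suc l) u v

  -- A segment `(l , v)` has `l` internal vertices and ends in `v`. The internal vertices are no
  -- part of the data: they are chosen greedily once all the stops are known.
  data Route : Fin N → List (ℕ × Fin N) → Fin N → Set where
    []  : ∀ {u} → Route u [] u
    _∷_ : ∀ {u l v segs z} → Rich l u v → Route v segs z → Route u ((l , v) ∷ segs) z

  size : List (ℕ × Fin N) → ℕ
  size []               = 0
  size ((l , _) ∷ segs) = suc l + size segs

  stops : List (ℕ × Fin N) → List (Fin N)
  stops = map proj₂

  -- A path, listed from its last vertex to its first, that avoids the list R of reserved vertices.
  record Path (path R : List (Fin N)) : Set where
    field
      linked   : Linked Adj path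
      unique   : Unique path
      reserved : Unique R
      disjoint : ∀ {x} → x ∈ path → x ∉ R

  -- The forbidden vertices contribute at most `length F * B` to the sum, so the average over the
  -- remaining neighbours of `u` still exceeds `c`.
  fresh-neighbour : ∀ F u (f : Fin N → ℕ) B c → (∀ x → f x ≤ B) →
                    length F * B + c * n < ∑ V (λ z → α u z * f z) →
                    ∃ λ z → z ∉ F × Adj u z × c < f z
  fresh-neighbour F u f B c f≤B lt =
    let z , _ , weight>0 , c<f = pigeonhole V (λ z → 𝟙 (¬? (z ∈? F)) * α u z) f c outside
    in z , avoids (z ∈? F) (α u z) weight>0 , α-positive (positive-right (𝟙 (¬? (z ∈? F))) weight>0) , c<f
    where
    open ≤-Reasoning
    avoids : ∀ {P : Set} (d : Dec P) a → 0 < 𝟙 (¬? d) * a → ¬ P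
    avoids (no ¬p) a _ = ¬p
    positive-right : ∀ a {b} → 0 < a * b → 0 < b
    positive-right a {zero}  lt = contradiction (≤-trans lt (≤-reflexive (*-zeroʳ a))) λ ()
    positive-right a {suc b} lt = s≤s z≤n
    split : ∀ z → α u z * f z ≡ 𝟙 (z ∈? F) * (α u z * f z) + 𝟙 (¬? (z ∈? F)) * α u z * f z
    split z = trans (sym (*-identityˡ _)) (trans (cong (_* (α u z * f z)) (sym (𝟙-complement (z ∈? F))))
                (distribute (𝟙 (z ∈? F)) (𝟙 (¬? (z ∈? F))) (α u z) (f z)))
      where
      distribute : ∀ a b c d → (a + b) * (c * d) ≡ a * (c * d) + b * c * d
      distribute = solve-∀
    outside : c * ∑ V (λ z → 𝟙 (¬? (z ∈? F)) * α u z) < ∑ V (λ z → 𝟙 (¬? (z ∈? F)) * α u z * f z)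
    outside = +-cancelˡ-< (length F * B) _ _ (begin-strict
      length F * B + c * ∑ V (λ z → 𝟙 (¬? (z ∈? F)) * α u z)
        ≤⟨ +-monoʳ-≤ _ (*-monoʳ-≤ c (≤-trans (∑-bounded V 1 λ z → *-mono-≤ (𝟙≤1 (¬? (z ∈? F))) (α≤1 u z))
             (≤-reflexive (*-identityʳ n)))) ⟩
      length F * B + c * n
        <⟨ lt ⟩
      ∑ V (λ z → α u z * f z)
        ≡⟨ trans (∑-cong V split) (∑-+ V _ _) ⟩
      ∑ V (λ z → 𝟙 (z ∈? F) * (α u z * f z)) + ∑ V (λ z → 𝟙 (¬? (z ∈? F)) * α u z * f z)
        ≤⟨ +-monoˡ-≤ _ (∑-members Fin._≟_ unique-V F _ B λ z → ≤-trans (α-drop u z _) (f≤B z)) ⟩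
      length F * B + ∑ V (λ z → 𝟙 (¬? (z ∈? F)) * α u z * f z) ∎)

  push : ∀ {u path R z} → Path (u ∷ path) R → z ∉ (u ∷ path) ++ R → Adj u z → Path (z ∷ u ∷ path) R
  push {u} {path} {R} {z} p z∉ uz = record
    { linked   = Adj-sym uz ∷ linked
    ; unique   = All.tabulate (λ x∈ eq → z∉ (∈-++⁺ˡ (subst (_∈ u ∷ path) (sym eq) x∈))) ∷ unique
    ; reserved = reserved
    ; disjoint = λ { (here refl) z∈R → z∉ (∈-++⁺ʳ (u ∷ path) z∈R) ; (there x∈) → disjoint x∈ }
    }
    where open Path p

  arrive : ∀ {u path R v} → Path (u ∷ path) (v ∷ R) → Adj u v → Path (v ∷ u ∷ path) R
  arrive {u} {path} {R} {v} p uv = record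
    { linked   = Adj-sym uv ∷ linked
    ; unique   = All.tabulate (λ x∈ eq → disjoint x∈ (here (sym eq))) ∷ unique
    ; reserved = tail-unique reserved
    ; disjoint = λ { (here refl) v∈R → head-fresh reserved v∈R ; (there x∈) x∈R → disjoint x∈ (there x∈R) }
    }
    where
    open Path p
    tail-unique : Unique (v ∷ R) → Unique R
    tail-unique (_ ∷ u) = u
    head-fresh : Unique (v ∷ R) → v ∉ R
    head-fresh (v∉ ∷ _) v∈R = All.lookup v∉ v∈R refl

  -- c bounds the number of forbidden vertices met along the way.
  follow : ∀ l {u v path R} c → Path (u ∷ path) (v ∷ R) → length (u ∷ path) + length (v ∷ R) + l ≤ c →
           suc l * c * n ^ l < w (suc l) u v →
           ∃ λ pre → length pre ≡ suc (suc l) × Path (pre ++ u ∷ path) R × ∃ λ rest → pre ≡ v ∷ rest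
  follow l {u} {v} {path} {R} c p le rich with l
  ... | zero =
    let z , z∉ , uz , zv = fresh-neighbour F u (λ z → w 0 z v) 1 0 (λ z → α≤1 z v) (begin-strict
          length F * 1 + 0 * n  ≤⟨ bound₀ (length F) c n F≤c ⟩
          1 * c * 1             <⟨ rich ⟩
          w 1 u v               ∎)
    in v ∷ z ∷ [] , refl , arrive (push p z∉ uz) (α-positive zv) , _ , refl
    where
    open ≤-Reasoning
    F = (u ∷ path) ++ v ∷ R
    F≤c : length F ≤ c
    F≤c = ≤-trans (≤-reflexive (length-++ (u ∷ path))) (≤-trans (m≤m+n _ 0) le)
    bound₀ : ∀ a c n → a ≤ c → a * 1 + 0 * n ≤ 1 * c * 1
    bound₀ a c n a≤c = ≤-trans (≤-reflexive (i₁ a n)) (≤-trans a≤c (≤-reflexive (i₂ c)))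
      where
      i₁ : ∀ a n → a * 1 + 0 * n ≡ a
      i₁ = solve-∀
      i₂ : ∀ c → c ≡ 1 * c * 1
      i₂ = solve-∀
  -- Each forbidden vertex spoils at most n^(l+1) walks, so one choice costs `c` times that amount
  -- and the factor in front of `c` drops by one.
  ... | suc l =
    let z , z∉ , uz , rich′ = fresh-neighbour F u (λ z → w (suc l) z v) (n * n ^ l) (suc l * c * n ^ l)
          (λ z → w≤ (suc l) z v) (begin-strict
          length F * (n * n ^ l) + suc l * c * n ^ l * n    ≤⟨ +-monoˡ-≤ _ (*-monoˡ-≤ (n * n ^ l) F≤c) ⟩
          c * (n * n ^ l) + suc l * c * n ^ l * n           ≡⟨ identity c n (n ^ l) (suc l) ⟩
          suc (suc l) * c * (n * n ^ l)                     <⟨ rich ⟩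
          w (suc (suc l)) u v                               ∎)
        pre , len , p′ , rest , eq = follow l c (push p z∉ uz) (≤-trans (≤-reflexive (shift-suc (length (u ∷ path)) (length (v ∷ R)) l)) le) rich′
    in pre ++ z ∷ [] ,
       trans (length-++ pre) (trans (cong (_+ 1) len) (+-comm (suc (suc l)) 1)) ,
       subst (λ path → Path path R) (sym (++-assoc pre (z ∷ []) (u ∷ path))) p′ ,
       rest ++ z ∷ [] , cong (_++ z ∷ []) eq
    where
    open ≤-Reasoning
    F = (u ∷ path) ++ v ∷ R
    F≤c : length F ≤ c
    F≤c = ≤-trans (≤-reflexive (length-++ (u ∷ path))) (≤-trans (m≤m+n _ (suc l)) le)
    identity : ∀ c n m s → c * (n * m) + s * c * m * n ≡ (1 + s) * c * (n * m)
    identity = solve-∀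
    shift-suc : ∀ a b l → suc a + b + l ≡ a + b + suc l
    shift-suc = solve-∀

  -- The stops of all later segments stay in the reserved list, so the greedy choice inside a
  -- segment never uses up an endpoint that is needed later. Since the finished path has at most `M`
  -- vertices, `M + M` bounds the forbidden ones and `M` the number of choices in a segment; hence
  -- `K = M * (M + M)`.
  traverse : ∀ segs {u z path R} → Route u segs z → Path (u ∷ path) (stops segs ++ R) →
             length (u ∷ path) + size segs + length R ≤ M →
             ∃ λ pre → length pre ≡ size segs × Path (pre ++ u ∷ path) R × ∃ λ rest → pre ++ u ∷ path ≡ z ∷ rest
  traverse [] [] p le = [] , refl , p , _ , refl
  traverse ((zero , v) ∷ segs) {u} {path = path} {R} (uv ∷ route) p le =
    let pre , len , p′ , rest , eq = traverse segs {path = u ∷ path} route (arrive p uv)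
          (≤-trans (≤-reflexive (cong (_+ length R) (sym (+-suc (length (u ∷ path)) (size segs))))) le)
    in pre ++ v ∷ [] , trans (length-++ pre) (trans (cong (_+ 1) len) (+-comm (size segs) 1)) ,
       subst (λ path → Path path R) (sym (++-assoc pre (v ∷ []) (u ∷ path))) p′ ,
       rest , trans (++-assoc pre (v ∷ []) (u ∷ path)) eq
  traverse ((suc l , v) ∷ segs) {u} {path = path} {R} (rich ∷ route) p le
    with follow l (M + M) p fits (≤-<-trans (*-monoˡ-≤ (n ^ l) (*-monoˡ-≤ (M + M) l<M)) rich)
    where
    open ≤-Reasoning
    stops≤ : ∀ segs → length (stops segs) ≤ size segs
    stops≤ [] = z≤n
    stops≤ ((l , _) ∷ segs) = s≤s (≤-trans (stops≤ segs) (m≤n+m _ l))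
    l<M : suc l ≤ M
    l<M = ≤-trans (≤-slack _ (identity (length (u ∷ path)) l (size segs) (length R))) le
      where
      identity : ∀ a l s r → suc l + (1 + a + s + r) ≡ a + (suc (suc l) + s) + r
      identity = solve-∀
    fits : length (u ∷ path) + length (v ∷ stops segs ++ R) + l ≤ M + M
    fits = begin
      length (u ∷ path) + suc (length (stops segs ++ R)) + l
        ≡⟨ cong (λ c → length (u ∷ path) + suc c + l) (length-++ (stops segs)) ⟩
      length (u ∷ path) + suc (length (stops segs) + length R) + l
        ≤⟨ +-monoˡ-≤ l (+-monoʳ-≤ (length (u ∷ path)) (s≤s (+-monoˡ-≤ (length R) (stops≤ segs)))) ⟩
      length (u ∷ path) + suc (size segs + length R) + l
        ≤⟨ ≤-slack 1 (identity (length (u ∷ path)) (size segs) (length R) l) ⟩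
      length (u ∷ path) + (suc (suc l) + size segs) + length R
        ≤⟨ le ⟩
      M
        ≤⟨ m≤m+n M M ⟩
      M + M ∎
      where
      identity : ∀ a s r l → a + suc (s + r) + l + 1 ≡ a + (suc (suc l) + s) + r
      identity = solve-∀
  ... | pre , len , p′ , rest , refl =
    let pre₂ , len₂ , p₂ , rest₂ , eq₂ = traverse segs {path = rest ++ u ∷ path} route p′ (≤-trans (≤-reflexive fits′) le)
    in pre₂ ++ v ∷ rest ,
       trans (length-++ pre₂) (trans (cong₂ _+_ len₂ len) (+-comm (size segs) (suc (suc l)))) ,
       subst (λ path → Path path R) (sym (++-assoc pre₂ (v ∷ rest) (u ∷ path))) p₂ ,
       rest₂ , trans (++-assoc pre₂ (v ∷ rest) (u ∷ path)) eq₂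
    where
    fits′ : length (v ∷ rest ++ u ∷ path) + size segs + length R ≡ length (u ∷ path) + (suc (suc l) + size segs) + length R
    fits′ = trans (cong (λ c → suc c + size segs + length R) (length-++ rest {u ∷ path}))
              (trans (identity (length rest) (length (u ∷ path)) (size segs) (length R))
                     (cong (λ c → length (u ∷ path) + (c + size segs) + length R) len))
      where
      identity : ∀ a b s r → suc (a + b) + s + r ≡ b + (suc a + s) + r
      identity = solve-∀

-- Lists as indexed cycles, and the constants

entry : ∀ {X : Set} → X → List X → ℕ → X
entry x₀ []       _       = x₀
entry x₀ (x ∷ xs) zero    = x
entry x₀ (x ∷ xs) (suc i) = entry x₀ xs i

module _ {X : Set} (x₀ : X) where

  entry∈ : ∀ xs {i} → i < length xs → entry x₀ xs i ∈ xs
  entry∈ (x ∷ xs) {zero}  _         = here refl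
  entry∈ (x ∷ xs) {suc i} (s≤s i<) = there (entry∈ xs i<)

  entry-injective : ∀ {xs} → Unique xs → ∀ {i j} → i < length xs → j < length xs →
                    entry x₀ xs i ≡ entry x₀ xs j → i ≡ j
  entry-injective (x∉ ∷ u) {zero}  {zero}  _ _ _ = refl
  entry-injective {x ∷ xs} (x∉ ∷ u) {zero}  {suc j} _ (s≤s j<) eq = contradiction eq (All.lookup x∉ (entry∈ xs j<))
  entry-injective {x ∷ xs} (x∉ ∷ u) {suc i} {zero}  (s≤s i<) _ eq = contradiction (sym eq) (All.lookup x∉ (entry∈ xs i<))
  entry-injective (x∉ ∷ u) {suc i} {suc j} (s≤s i<) (s≤s j<) eq = cong suc (entry-injective u i< j< eq)

  entry-linked : ∀ {R : X → X → Set} {xs} → Linked R xs → ∀ {i} → suc i < length xs →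
                 R (entry x₀ xs i) (entry x₀ xs (suc i))
  entry-linked (r ∷ _)  {zero}  _        = r
  entry-linked (_ ∷ rs) {suc i} (s≤s i<) = entry-linked rs i<
  entry-linked [-]      {zero}  (s≤s ())

  entry-++ : ∀ xs ys i → entry x₀ (xs ++ ys) (length xs + i) ≡ entry x₀ ys i
  entry-++ []       ys i = refl
  entry-++ (x ∷ xs) ys i = entry-++ xs ys i

toℕ-next : ∀ {m} (i : Fin (suc m)) → (toℕ i < m × toℕ (next i) ≡ suc (toℕ i)) ⊎ (toℕ i ≡ m × toℕ (next i) ≡ 0)
toℕ-next {m} i with toℕ i ℕ.≟ m
... | yes eq  = inj₂ (eq , trans (Fin.toℕ-fromℕ< _) (trans (cong (λ a → suc a % suc m) eq) (n%n≡0 (suc m))))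
... | no  neq = inj₁ (i<m , trans (Fin.toℕ-fromℕ< _) (m<n⇒m%n≡m (s≤s i<m)))
  where
  i<m : toℕ i < m
  i<m = ≤∧≢⇒< (≤-pred (Fin.toℕ<n i)) neq

-- The recursion peels off two successors at a time, so that `i` applications of `pad` have the
-- right length by computation; `up≡` is used only for the final vertex count.
up : ℕ → ℕ → ℕ
up zero    l = l
up (suc i) l = suc (suc (up i l))

up≡ : ∀ i l → up i l ≡ i + i + l
up≡ zero    l = refl
up≡ (suc i) l = trans (cong (suc ∘ suc) (up≡ i l)) (identity i l)
  where
  identity : ∀ i l → 2 + (i + i + l) ≡ suc i + suc i + l
  identity = solve-∀

padded : ℕ → ℕ → ℕ
padded D zero    = D
padded D (suc i) = padded D i ^ 4

m≤m^4 : ∀ m → m ≤ m ^ 4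
m≤m^4 zero    = z≤n
m≤m^4 (suc m) = ≤-trans (≤-reflexive (sym (*-identityʳ (suc m)))) (^-monoʳ-≤ (suc m) {1} {4} (s≤s z≤n))

module Constants (j T R : ℕ) where
  -- The hierarchy of constants: R ≪ B₁ ≪ G₁ ≪ H ≪ B₂ ≪ G₂.
  B₁ G₁ H B₂ G₂ Q C₀ M₀ threshold : ℕ
  B₁ = 2 * R
  G₁ = B₁ * T
  H  = B₁ * G₁
  B₂ = 2 * padded H (suc j)
  G₂ = B₂ * T
  -- Colour classes have at most 4T² items, and two edges have four pairs of ends; the product 16T²
  -- leaves a factor T² for Markov's inequality in `violations-total`.
  Q  = 16 * T ^ 4
  C₀ = B₂ * G₂ + Q
  M₀ = suc (2 * (4 + j))
  threshold = C₀ * (M₀ * (M₀ + M₀))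

∑-map : ∀ {X Y : Set} (g : X → Y) xs (f : Y → ℕ) → ∑ (map g xs) f ≡ ∑ xs (f ∘ g)
∑-map g []       f = refl
∑-map g (x ∷ xs) f = cong (f (g x) +_) (∑-map g xs f)

∑-pairs : ∀ {X Y : Set} (xs : List X) (ys : List Y) (f : X × Y → ℕ) →
          ∑ (cartesianProduct xs ys) f ≡ ∑ xs (λ x → ∑ ys λ y → f (x , y))
∑-pairs []       ys f = refl
∑-pairs (x ∷ xs) ys f = trans (∑-++ (map (x ,_) ys) (cartesianProduct xs ys) f)
                          (cong₂ _+_ (∑-map (x ,_) ys f) (∑-pairs xs ys f))

-- A colour class of t > 2 items contains at least t (t - 2) ≥ t pairs of items that are not copies of each other.
module Counting {Y : Set} (P : List Y) {f : ℕ} (χ : Y → Fin f) {_~_ : Y → Y → Set} (_~?_ : ∀ e e′ → Dec (e ~ e′))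
  (copies : ∀ e → ∑ P (λ e′ → 𝟙 (e ~? e′)) ≤ 2) where

  private
    colours : List (Fin f)
    colours = allFin f

  -- Two items per colour are free: in the application one edge occurs in both orientations. Every
  -- further item of a class is paid for by the clashing pairs.
  items-vs-colours : (τ : Y → ℕ) → (∀ e → τ e ≤ 1) →
    ∑ P τ ≤ 2 * f + ∑ P (λ e → ∑ P λ e′ → τ e * τ e′ * (𝟙 (χ e Fin.≟ χ e′) * 𝟙 (¬? (e ~? e′))))
  items-vs-colours τ τ≤1 = begin
    ∑ P τ                                      ≤⟨ ∑-mono P coloured ⟩
    ∑ P (λ e → ∑ colours λ r → s r e)          ≡⟨ ∑-swap P colours _ ⟩
    ∑ colours t                                ≤⟨ ∑-mono colours class ⟩
    ∑ colours (λ r → 2 + clash r)              ≡⟨ ∑-+ colours _ _ ⟩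
    ∑ colours (λ _ → 2) + ∑ colours clash      ≤⟨ +-mono-≤ (≤-reflexive (trans (∑-const colours 2)
                                                    (trans (cong (_* 2) (length-tabulate (λ (i : Fin f) → i))) (*-comm f 2)))) total-clash ⟩
    2 * f + ∑ P (λ e → ∑ P λ e′ → τ e * τ e′ * (𝟙 (χ e Fin.≟ χ e′) * 𝟙 (¬? (e ~? e′)))) ∎
    where
    open ≤-Reasoning
    s : Fin f → Y → ℕ
    s r e = 𝟙 (r Fin.≟ χ e) * τ e
    t clash : Fin f → ℕ
    t r = ∑ P (s r)
    clash r = ∑ P λ e → ∑ P λ e′ → s r e * s r e′ * 𝟙 (¬? (e ~? e′))
    coloured : ∀ e → τ e ≤ ∑ colours (λ r → s r e)
    coloured e = ≤-trans (≤-reflexive (trans (sym (*-identityˡ (τ e))) (cong (_* τ e) (sym (𝟙-yes (χ e Fin.≟ χ e) refl)))))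
                   (term≤∑ (∈-allFin (χ e)) λ r → s r e)
    s≤1 : ∀ r e → s r e ≤ 1
    s≤1 r e = ≤-trans (𝟙-drop (r Fin.≟ χ e) (τ e)) (τ≤1 e)
    small : ∀ t K → t * t ≤ K + 2 * t → t ≤ 2 + K
    small zero                K le = z≤n
    small (suc zero)          K le = s≤s z≤n
    small (suc (suc zero))    K le = s≤s (s≤s z≤n)
    small t@(suc (suc (suc u))) K le = ≤-trans (by-adding le (u * u + 3 * u) (identity u K)) (m≤n+m K 2)
      where
      identity : ∀ u K → (3 + u) + (K + 2 * (3 + u)) + (u * u + 3 * u) ≡ K + (3 + u) * (3 + u)
      identity = solve-∀
    class : ∀ r → t r ≤ 2 + clash r
    class r = small (t r) (clash r) (begin
      t r * t r
        ≡⟨ ∑-product P P (s r) (s r) ⟨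
      ∑ P (λ e → ∑ P λ e′ → s r e * s r e′)
        ≤⟨ ∑-mono P (λ e → ∑-mono P λ e′ → split (e ~? e′) (s r e) (s r e′) (s≤1 r e′)) ⟩
      ∑ P (λ e → ∑ P λ e′ → s r e * s r e′ * 𝟙 (¬? (e ~? e′)) + s r e * 𝟙 (e ~? e′))
        ≡⟨ ∑-cong P (λ e → trans (∑-+ P _ _) (cong (∑ P (λ e′ → s r e * s r e′ * 𝟙 (¬? (e ~? e′))) +_) (∑-*ˡ P (s r e) _))) ⟩
      ∑ P (λ e → ∑ P (λ e′ → s r e * s r e′ * 𝟙 (¬? (e ~? e′))) + s r e * ∑ P (λ e′ → 𝟙 (e ~? e′)))
        ≡⟨ ∑-+ P _ _ ⟩
      clash r + ∑ P (λ e → s r e * ∑ P (λ e′ → 𝟙 (e ~? e′)))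
        ≤⟨ +-monoʳ-≤ (clash r) (∑-mono P λ e → ≤-trans (*-monoʳ-≤ (s r e) (copies e)) (≤-reflexive (*-comm (s r e) 2))) ⟩
      clash r + ∑ P (λ e → 2 * s r e)
        ≡⟨ cong (clash r +_) (∑-*ˡ P 2 (s r)) ⟩
      clash r + 2 * t r ∎)
      where
      split : ∀ {A : Set} (d : Dec A) a b → b ≤ 1 → a * b ≤ a * b * 𝟙 (¬? d) + a * 𝟙 d
      split (yes _) a b b≤1 = ≤-trans (*-monoʳ-≤ a b≤1) (m≤n+m _ (a * b * 0))
      split (no _)  a b b≤1 = ≤-trans (≤-reflexive (sym (*-identityʳ (a * b)))) (m≤m+n _ _)
    total-clash : ∑ colours clash ≤ ∑ P (λ e → ∑ P λ e′ → τ e * τ e′ * (𝟙 (χ e Fin.≟ χ e′) * 𝟙 (¬? (e ~? e′))))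
    total-clash = begin
      ∑ colours clash
        ≡⟨ ∑-swap colours P _ ⟩
      ∑ P (λ e → ∑ colours λ r → ∑ P λ e′ → s r e * s r e′ * 𝟙 (¬? (e ~? e′)))
        ≡⟨ ∑-cong P (λ e → ∑-swap colours P _) ⟩
      ∑ P (λ e → ∑ P λ e′ → ∑ colours λ r → s r e * s r e′ * 𝟙 (¬? (e ~? e′)))
        ≤⟨ ∑-mono P (λ e → ∑-mono P λ e′ → pair e e′) ⟩
      ∑ P (λ e → ∑ P λ e′ → τ e * τ e′ * (𝟙 (χ e Fin.≟ χ e′) * 𝟙 (¬? (e ~? e′)))) ∎
      where
      pair : ∀ e e′ → ∑ colours (λ r → s r e * s r e′ * 𝟙 (¬? (e ~? e′))) ≤ τ e * τ e′ * (𝟙 (χ e Fin.≟ χ e′) * 𝟙 (¬? (e ~? e′)))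
      pair e e′ = begin
        ∑ colours (λ r → 𝟙 (r Fin.≟ χ e) * τ e * (𝟙 (r Fin.≟ χ e′) * τ e′) * δ)
          ≡⟨ ∑-cong colours (λ r → reorder (𝟙 (r Fin.≟ χ e)) (τ e) (𝟙 (r Fin.≟ χ e′)) (τ e′) δ) ⟩
        ∑ colours (λ r → 𝟙 (r Fin.≟ χ e) * (τ e * τ e′ * (𝟙 (r Fin.≟ χ e′) * δ)))
          ≤⟨ ∑-point Fin._≟_ (allFin⁺ f) (χ e) (λ r → τ e * τ e′ * (𝟙 (r Fin.≟ χ e′) * δ)) ⟩
        τ e * τ e′ * (𝟙 (χ e Fin.≟ χ e′) * δ) ∎
        where
        δ = 𝟙 (¬? (e ~? e′))
        reorder : ∀ a b c d e → a * b * (c * d) * e ≡ a * (b * d * (c * e))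
        reorder = solve-∀

private
  -- A union bound: an edge is good or falls under one of six exceptions, each of which is counted
  -- separately.
  some-case : ∀ {P₁ P₂ P₃ P₄ P₅ P₆ : Set} x g (a : Dec P₁) (b : Dec P₂) (c : Dec P₃) (d : Dec P₄) (e : Dec P₅) (f : Dec P₆) →
              x ≤ 1 → (0 < x → ¬ P₁ → ¬ P₂ → ¬ P₃ → ¬ P₄ → ¬ P₅ → ¬ P₆ → 1 ≤ g) →
              x ≤ g + (𝟙 a * x + 𝟙 b * x) + ((x * 𝟙 c + x * 𝟙 d) + (x * 𝟙 e + x * 𝟙 f))
  some-case zero g a b c d e f _ _ = z≤n
  some-case (suc zero) g a b c d e f _ good = ≤-trans (cases a b c d e f) (≤-reflexive (rearrange g (𝟙 a) (𝟙 b) (𝟙 c) (𝟙 d) (𝟙 e) (𝟙 f)))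
    where
    rearrange : ∀ g a b c d e f → g + a + b + c + d + e + f ≡ g + (a * 1 + b * 1) + ((1 * c + 1 * d) + (1 * e + 1 * f))
    rearrange = solve-∀
    l : ∀ {a b} → 1 ≤ a → 1 ≤ a + b
    l 1≤a = ≤-trans 1≤a (m≤m+n _ _)
    r : ∀ a → 1 ≤ a + 1
    r a = m≤n+m 1 a
    cases : ∀ a b c d e f → 1 ≤ g + 𝟙 a + 𝟙 b + 𝟙 c + 𝟙 d + 𝟙 e + 𝟙 f
    cases (yes _) b c d e f = l (l (l (l (l (r g)))))
    cases (no _) (yes _) c d e f = l (l (l (l (r (g + 0)))))
    cases (no _) (no _) (yes _) d e f = l (l (l (r (g + 0 + 0))))
    cases (no _) (no _) (no _) (yes _) e f = l (l (r (g + 0 + 0 + 0)))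
    cases (no _) (no _) (no _) (no _) (yes _) f = l (r (g + 0 + 0 + 0 + 0))
    cases (no _) (no _) (no _) (no _) (no _) (yes _) = r (g + 0 + 0 + 0 + 0 + 0)
    cases (no a) (no b) (no c) (no d) (no e) (no f) = l (l (l (l (l (l (good (s≤s z≤n) a b c d e f))))))
  some-case (suc (suc x)) g a b c d e f (s≤s ()) _

-- With a constant `g` this serves as a plain decidable search for a member with property `S`.
argmax : ∀ {X : Set} (xs : List X) {S : X → Set} (S? : ∀ x → Dec (S x)) (g : X → ℕ) →
         (∀ x → x ∈ xs → ¬ S x) ⊎ ∃ λ x → x ∈ xs × S x × (∀ y → y ∈ xs → S y → g y ≤ g x)
argmax [] S? g = inj₁ λ _ ()
argmax (x ∷ xs) S? g with S? x | argmax xs S? g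
... | no ¬s | inj₁ none = inj₁ λ { y (here refl) → ¬s ; y (there y∈) → none y y∈ }
... | no ¬s | inj₂ (z , z∈ , s , best) = inj₂ (z , there z∈ , s , λ { y (here refl) t → contradiction t ¬s ; y (there y∈) t → best y y∈ t })
... | yes s | inj₁ none = inj₂ (x , here refl , s , λ { y (here refl) t → ≤-refl ; y (there y∈) t → contradiction t (none y y∈) })
... | yes s | inj₂ (z , z∈ , t , best) with ≤-total (g x) (g z)
...   | inj₁ gx≤gz = inj₂ (z , there z∈ , t , λ { y (here refl) _ → gx≤gz ; y (there y∈) u → best y y∈ u })
...   | inj₂ gz≤gx = inj₂ (x , here refl , s , λ { y (here refl) _ → ≤-refl ; y (there y∈) u → ≤-trans (best y y∈ u) gz≤gx })

∑<-swap : ∀ {X : Set} h (xs : List X) (f : ℕ → X → ℕ) → ∑< h (λ i → ∑ xs (f i)) ≡ ∑ xs (λ x → ∑< h λ i → f i x)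
∑<-swap zero    xs f = sym (∑-zero xs)
∑<-swap (suc h) xs f = trans (cong (∑ xs (f h) +_) (∑<-swap h xs f)) (sym (∑-+ xs _ _))

∑<-+ : ∀ h (f g : ℕ → ℕ) → ∑< h (λ i → f i + g i) ≡ ∑< h f + ∑< h g
∑<-+ zero    f g = refl
∑<-+ (suc h) f g = trans (cong (f h + g h +_) (∑<-+ h f g)) (regroup (f h) (g h) (∑< h f) (∑< h g))
  where
  regroup : ∀ a b c d → a + b + (c + d) ≡ a + c + (b + d)
  regroup = solve-∀

-- A vertex of degree `d` is tested against the thresholds q + i, which rise, and m + g - i, which
-- fall. If d ≥ q + h the first test always fails; if q ≤ d ≤ q + h, it succeeds at most q + h - d
-- times; if d ≤ q, both succeed at most h times and 2h ≤ m - q.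
thresholds : ∀ {m g q} h d → q + 2 * h ≤ m →
             ∑< h (λ i → 𝟙 (d ℕ.<? q + i) + 𝟙 (d + i ℕ.<? m + g)) ≤ (m ∸ d) + g
thresholds {m} {g} {q} h d fits = ≤-trans (≤-reflexive (∑<-+ h _ _)) combined
  where
  above below : ℕ → ℕ
  above h = ∑< h λ i → 𝟙 (d ℕ.<? q + i)
  below h = ∑< h λ i → 𝟙 (d + i ℕ.<? m + g)
  above≤h : ∀ h → above h ≤ h
  above≤h zero    = z≤n
  above≤h (suc h) = +-mono-≤ (𝟙≤1 (d ℕ.<? q + h)) (above≤h h)
  below≤h : ∀ h → below h ≤ h
  below≤h zero    = z≤n
  below≤h (suc h) = +-mono-≤ (𝟙≤1 (d + h ℕ.<? m + g)) (below≤h h)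
  above≤ : ∀ h → above h ≤ (q + h) ∸ d
  above≤ zero    = z≤n
  above≤ (suc h) with d ℕ.<? q + h
  ... | yes d< = ≤-trans (s≤s (above≤ h)) (≤-reflexive (sym (trans (cong (_∸ d) (+-suc q h)) (+-∸-assoc 1 (<⇒≤ d<)))))
  ... | no _   = ≤-trans (above≤ h) (∸-monoˡ-≤ d (+-monoʳ-≤ q (n≤1+n h)))
  below≤ : ∀ h → below h ≤ (m + g) ∸ d
  below≤ zero    = z≤n
  below≤ (suc h) with d + h ℕ.<? m + g
  ... | yes lt = ≤-trans (s≤s (below≤h h)) (m+n≤o⇒m≤o∸n (suc h) (≤-trans (≤-reflexive (cong suc (+-comm h d))) lt))
  ... | no _   = below≤ h
  combined : above h + below h ≤ (m ∸ d) + g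
  combined with ≤-total d (q + h)
  ... | inj₂ q+h≤d = begin
    above h + below h       ≤⟨ +-mono-≤ (≤-trans (above≤ h) (≤-reflexive (m≤n⇒m∸n≡0 q+h≤d))) (below≤ h) ⟩
    (m + g) ∸ d             ≤⟨ m+n∸o≤ ⟩
    (m ∸ d) + g             ∎
    where
    open ≤-Reasoning
    m+n∸o≤ : (m + g) ∸ d ≤ (m ∸ d) + g
    m+n∸o≤ = m≤n+o⇒m∸n≤o (m + g) d (≤-trans (+-monoˡ-≤ g (m≤n+m∸n m d)) (≤-reflexive (+-assoc d (m ∸ d) g)))
  ... | inj₁ d≤q+h with ≤-total d q
  ...   | inj₁ d≤q = begin
    above h + below h       ≤⟨ +-mono-≤ (above≤h h) (below≤h h) ⟩
    h + h                   ≤⟨ m+n≤o⇒m≤o∸n (h + h) (≤-trans (+-monoʳ-≤ (h + h) d≤q) (≤-trans (≤-reflexive (identity q h)) fits)) ⟩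
    m ∸ d                   ≤⟨ m≤m+n _ g ⟩
    (m ∸ d) + g             ∎
    where
    open ≤-Reasoning
    identity : ∀ q h → h + h + q ≡ q + 2 * h
    identity = solve-∀
  ...   | inj₂ q≤d = begin
    above h + below h       ≤⟨ +-mono-≤ (above≤ h) (below≤h h) ⟩
    (q + h) ∸ d + h         ≡⟨ +-∸-comm h d≤q+h ⟨
    (q + h + h) ∸ d         ≤⟨ ∸-monoˡ-≤ d (≤-trans (≤-reflexive (identity q h)) fits) ⟩
    m ∸ d                   ≤⟨ m≤m+n _ g ⟩
    (m ∸ d) + g             ∎
    where
    open ≤-Reasoning
    identity : ∀ q h → q + h + h ≡ q + 2 * h
    identity = solve-∀

∑-cong∈ : ∀ {X : Set} (xs : List X) {f g : X → ℕ} → (∀ x → x ∈ xs → f x ≡ g x) → ∑ xs f ≡ ∑ xs g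
∑-cong∈ []       eq = refl
∑-cong∈ (x ∷ xs) eq = cong₂ _+_ (eq x (here refl)) (∑-cong∈ xs λ y y∈ → eq y (there y∈))

-- Trims a neighbourhood to exactly `q` vertices, so that the totals in the edge count below are
-- equalities.
subset-of-size : ∀ {X : Set} (_≟_ : DecidableEquality X) {xs : List X} → Unique xs → (f : X → ℕ) → (∀ x → f x ≤ 1) →
                 ∀ q → q ≤ ∑ xs f → ∃ λ g → (∀ x → g x ≤ f x) × ∑ xs g ≡ q
subset-of-size _≟_ [] f f≤1 zero le = f , (λ _ → ≤-refl) , refl
subset-of-size _≟_ {x ∷ xs} (x∉ ∷ u) f f≤1 q le = go (q ℕ.≤? ∑ xs f)
  where
  go : Dec (q ≤ ∑ xs f) → ∃ λ g → (∀ x → g x ≤ f x) × ∑ (x ∷ xs) g ≡ q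
  go (no q≰) = f , (λ _ → ≤-refl) , ≤-antisym (≤-trans (+-monoˡ-≤ _ (f≤1 x)) (≰⇒> q≰)) le
  go (yes q≤) with g , g≤f , eq ← subset-of-size _≟_ u f f≤1 q q≤ =
    (λ z → 𝟙 (¬? (z ≟ x)) * g z) , (λ z → ≤-trans (𝟙-drop (¬? (z ≟ x)) (g z)) (g≤f z)) ,
    trans (cong (_+ ∑ xs (λ z → 𝟙 (¬? (z ≟ x)) * g z)) (cong (_* g x) (𝟙-no (¬? (x ≟ x)) λ x≢x → x≢x refl)))
      (trans (∑-cong∈ xs λ z z∈ → trans (cong (_* g z) (𝟙-yes (¬? (z ≟ x)) λ z≡x → All.lookup x∉ z∈ (sym z≡x))) (*-identityˡ (g z))) eq)

-- Two vertices joined by few walks of length 4 force few edges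

module Structure {N : ℕ} (Γ : Graph N) (V : List (Fin N)) (unique-V : Unique V) where
  open Walks Γ V

  -- If few walks of length 4 join a to d, then no vertex is joined both to N(a) and to N(d), up to few exceptions.
  -- So each vertex misses q vertices of one of these sets, where q is a lower bound for their sizes.
  few-walks⇒few-edges : ∀ {q t a d} → 0 < n → q ≤ deg a → q ≤ deg d → t * t * w 3 a d ≤ n * (n * n) →
                        t * (∑ V deg + 2 * (n * q)) ≤ t * (n * n + 2 * (q * q)) + 4 * (n * n)
  few-walks⇒few-edges {q} {t} {a} {d} 0<n q≤a q≤d few = go (subset-of-size Fin._≟_ unique-V (α a) (α≤1 a) q q≤a) (subset-of-size Fin._≟_ unique-V (α d) (α≤1 d) q q≤d)
    where
    open ≤-Reasoning
    go : (∃ λ y → (∀ x → y x ≤ α a x) × ∑ V y ≡ q) → (∃ λ z → (∀ x → z x ≤ α d x) × ∑ V z ≡ q) →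
         t * (∑ V deg + 2 * (n * q)) ≤ t * (n * n + 2 * (q * q)) + 4 * (n * n)
    go (y , y≤ , ∑y) (z , z≤ , ∑z) = begin
      t * (∑ V deg + 2 * (n * q))
        ≤⟨ *-monoʳ-≤ t summed ⟩
      t * (n * n + 2 * (q * q) + 2 * S (λ x x′ → α x x′ * P x x′))
        ≡⟨ distribute t (n * n + 2 * (q * q)) _ ⟩
      t * (n * n + 2 * (q * q)) + 2 * (t * S (λ x x′ → α x x′ * P x x′))
        ≤⟨ +-monoʳ-≤ (t * (n * n + 2 * (q * q))) (*-monoʳ-≤ 2 αP≤) ⟩
      t * (n * n + 2 * (q * q)) + 2 * (2 * (n * n))
        ≡⟨ cong (t * (n * n + 2 * (q * q)) +_) (sym (*-assoc 2 2 (n * n))) ⟩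
      t * (n * n + 2 * (q * q)) + 4 * (n * n) ∎
      where
      distribute : ∀ t a b → t * (a + 2 * b) ≡ t * a + 2 * (t * b)
      distribute = solve-∀
      S : (Fin N → Fin N → ℕ) → ℕ
      S g = ∑ V λ x → ∑ V (g x)
      S-+ : ∀ g h → S (λ x x′ → g x x′ + h x x′) ≡ S g + S h
      S-+ g h = trans (∑-cong V λ x → ∑-+ V (g x) (h x)) (∑-+ V _ _)
      S-swap : ∀ g → S (λ x x′ → g x′ x) ≡ S g
      S-swap g = ∑-swap V V (λ x x′ → g x′ x)
      φ ψ : Fin N → ℕ
      φ x = ∑ V λ x′ → α x x′ * y x′
      ψ x = ∑ V λ x′ → α x x′ * z x′
      many? : ∀ x → Dec (n ≤ t * φ x)
      many? x = n ℕ.≤? t * φ x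
      κ κ̄ : Fin N → ℕ
      κ x = 𝟙 (many? x)
      κ̄ x = 𝟙 (¬? (many? x))
      -- Row `x` of `P` is the trimmed neighbourhood, of `a` or of `d`, that `x` almost misses: that
      -- of `d` if `x` has many neighbours in that of `a`, otherwise that of `a`.
      P : Fin N → Fin N → ℕ
      P x x′ = κ̄ x * y x′ + κ x * z x′
      P≤1 : ∀ x x′ → P x x′ ≤ 1
      P≤1 x x′ = bound (many? x)
        where
        bound : (m : Dec (n ≤ t * φ x)) → 𝟙 (¬? m) * y x′ + 𝟙 m * z x′ ≤ 1
        bound (yes _) = ≤-trans (≤-reflexive (*-identityˡ (z x′))) (≤-trans (z≤ x′) (α≤1 d x′))
        bound (no _)  = ≤-trans (≤-reflexive (trans (+-identityʳ (1 * y x′)) (*-identityˡ (y x′)))) (≤-trans (y≤ x′) (α≤1 a x′))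
      -- This is 1 - α ≥ p + p′ - pp′ up to the terms αp and αp′: a pair in `P` or its transpose is
      -- a non-edge, apart from the few edges inside `P`.
      pointwise : ∀ α p p′ → α ≤ 1 → p ≤ 1 → p′ ≤ 1 → α + (p + p′) ≤ 1 + p * p′ + (α * p + α * p′)
      pointwise zero    zero    p′ _ _ p′≤1 = ≤-trans p′≤1 (m≤m+n 1 _)
      pointwise zero    (suc zero) zero _ _ _ = ≤-refl
      pointwise zero    (suc zero) (suc zero) _ _ _ = ≤-refl
      pointwise (suc zero) zero zero _ _ _ = ≤-refl
      pointwise (suc zero) zero (suc zero) _ _ _ = ≤-refl
      pointwise (suc zero) (suc zero) zero _ _ _ = ≤-refl
      pointwise (suc zero) (suc zero) (suc zero) _ _ _ = s≤s (s≤s (s≤s z≤n))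
      pointwise (suc (suc _)) _ _ (s≤s ()) _ _
      pointwise _ (suc (suc _)) _ _ (s≤s ()) _
      pointwise _ _ (suc (suc _)) _ _ (s≤s ())
      P-total : S P ≡ n * q
      P-total = trans (∑-cong V λ x → trans (∑-+ V _ _) (trans (cong₂ _+_ (∑-*ˡ V (κ̄ x) y) (∑-*ˡ V (κ x) z))
                  (trans (cong₂ (λ s s′ → κ̄ x * s + κ x * s′) ∑y ∑z) (trans (sym (*-distribʳ-+ q (κ̄ x) (κ x)))
                    (trans (cong (_* q) (trans (+-comm (κ̄ x) (κ x)) (𝟙-complement (many? x)))) (*-identityˡ q)))))) (∑-const V q)
      -- The double count is s₁² + 2 s₂ u₁ + u₂² with s₁ + s₂ = u₁ + u₂ = q; replacing 2 s₂ u₁ by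
      -- s₂² + u₁² gives at most 2q². With n = m + q, the quantity n² - 2nq + 2q² is exactly m² +
      -- q².
      PPᵀ : S (λ x x′ → P x x′ * P x′ x) ≤ 2 * (q * q)
      PPᵀ = begin
        S (λ x x′ → P x x′ * P x′ x)
          ≡⟨ ∑-cong V (λ x → ∑-cong V λ x′ → expand (κ̄ x) (κ x) (κ̄ x′) (κ x′) (y x) (z x) (y x′) (z x′)) ⟩
        S (λ x x′ → (κ̄ x * y x * (κ̄ x′ * y x′) + κ̄ x * z x * (κ x′ * y x′)) + (κ x * y x * (κ̄ x′ * z x′) + κ x * z x * (κ x′ * z x′)))
          ≡⟨ trans (S-+ (λ x x′ → κ̄ x * y x * (κ̄ x′ * y x′) + κ̄ x * z x * (κ x′ * y x′)) (λ x x′ → κ x * y x * (κ̄ x′ * z x′) + κ x * z x * (κ x′ * z x′)))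
                (cong₂ _+_ (trans (S-+ (λ x x′ → κ̄ x * y x * (κ̄ x′ * y x′)) (λ x x′ → κ̄ x * z x * (κ x′ * y x′)))
                              (cong₂ _+_ (∑-product V V (λ x → κ̄ x * y x) (λ x → κ̄ x * y x)) (∑-product V V (λ x → κ̄ x * z x) (λ x → κ x * y x))))
                           (trans (S-+ (λ x x′ → κ x * y x * (κ̄ x′ * z x′)) (λ x x′ → κ x * z x * (κ x′ * z x′)))
                              (cong₂ _+_ (∑-product V V (λ x → κ x * y x) (λ x → κ̄ x * z x)) (∑-product V V (λ x → κ x * z x) (λ x → κ x * z x))))) ⟩
        (s₁ * s₁ + u₁ * s₂) + (s₂ * u₁ + u₂ * u₂)
          ≤⟨ by-adding (double-product u₁ s₂) (2 * (s₁ * s₂) + 2 * (u₁ * u₂)) (squares s₁ s₂ u₁ u₂) ⟩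
        (s₁ + s₂) * (s₁ + s₂) + (u₁ + u₂) * (u₁ + u₂)
          ≡⟨ cong₂ (λ s u → s * s + u * u) (parts y ∑y) (parts z ∑z) ⟩
        q * q + q * q
          ≡⟨ cong (q * q +_) (+-identityʳ (q * q)) ⟨
        2 * (q * q) ∎
        where
        s₁ = ∑ V λ x → κ̄ x * y x
        s₂ = ∑ V λ x → κ x * y x
        u₁ = ∑ V λ x → κ̄ x * z x
        u₂ = ∑ V λ x → κ x * z x
        parts : ∀ g → ∑ V g ≡ q → ∑ V (λ x → κ̄ x * g x) + ∑ V (λ x → κ x * g x) ≡ q
        parts g eq = trans (sym (∑-+ V _ _)) (trans (∑-cong V λ x → trans (sym (*-distribʳ-+ (g x) (κ̄ x) (κ x)))
                       (trans (cong (_* g x) (trans (+-comm (κ̄ x) (κ x)) (𝟙-complement (many? x)))) (*-identityˡ (g x)))) eq)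
        expand : ∀ k̄ k k̄′ k′ y z y′ z′ → (k̄ * y′ + k * z′) * (k̄′ * y + k′ * z) ≡
                 (k̄ * y * (k̄′ * y′) + k̄ * z * (k′ * y′)) + (k * y * (k̄′ * z′) + k * z * (k′ * z′))
        expand = solve-∀
        squares : ∀ s₁ s₂ u₁ u₂ → (s₁ * s₁ + u₁ * s₂) + (s₂ * u₁ + u₂ * u₂) + (u₁ * u₁ + s₂ * s₂) + (2 * (s₁ * s₂) + 2 * (u₁ * u₂)) ≡
                  (s₁ + s₂) * (s₁ + s₂) + (u₁ + u₂) * (u₁ + u₂) + 2 * (u₁ * s₂)
        squares = solve-∀
      αPᵀ : S (λ x x′ → α x x′ * P x′ x) ≡ S (λ x x′ → α x x′ * P x x′)
      αPᵀ = trans (∑-cong V λ x → ∑-cong V λ x′ → cong (_* P x′ x) (α-sym x x′)) (S-swap (λ x x′ → α x x′ * P x x′))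
      summed : ∑ V deg + 2 * (n * q) ≤ n * n + 2 * (q * q) + 2 * S (λ x x′ → α x x′ * P x x′)
      summed = begin
        S α + 2 * (n * q)
          ≡⟨ cong (S α +_) (trans (cong (n * q +_) (+-identityʳ (n * q))) (cong₂ _+_ (sym P-total) (sym (trans (S-swap P) P-total)))) ⟩
        S α + (S P + S (λ x x′ → P x′ x))
          ≡⟨ trans (S-+ α (λ x x′ → P x x′ + P x′ x)) (cong (S α +_) (S-+ P (λ x x′ → P x′ x))) ⟨
        S (λ x x′ → α x x′ + (P x x′ + P x′ x))
          ≤⟨ ∑-mono V (λ x → ∑-mono V λ x′ → pointwise (α x x′) (P x x′) (P x′ x) (α≤1 x x′) (P≤1 x x′) (P≤1 x′ x)) ⟩
        S (λ x x′ → 1 + P x x′ * P x′ x + (α x x′ * P x x′ + α x x′ * P x′ x))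
          ≡⟨ trans (S-+ (λ x x′ → 1 + P x x′ * P x′ x) (λ x x′ → α x x′ * P x x′ + α x x′ * P x′ x))
               (cong₂ _+_ (S-+ (λ _ _ → 1) (λ x x′ → P x x′ * P x′ x)) (S-+ (λ x x′ → α x x′ * P x x′) (λ x x′ → α x x′ * P x′ x))) ⟩
        S (λ _ _ → 1) + S (λ x x′ → P x x′ * P x′ x) + (S (λ x x′ → α x x′ * P x x′) + S (λ x x′ → α x x′ * P x′ x))
          ≤⟨ +-mono-≤ (+-mono-≤ (≤-reflexive (trans (∑-cong V λ _ → trans (∑-const V 1) (*-identityʳ n)) (∑-const V n))) PPᵀ)
               (≤-reflexive (cong (S (λ x x′ → α x x′ * P x x′) +_) (trans αPᵀ (sym (+-identityʳ _))))) ⟩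
        n * n + 2 * (q * q) + 2 * S (λ x x′ → α x x′ * P x x′) ∎
      φ≤ : ∀ x → φ x ≤ w 1 a x
      φ≤ x = ∑-mono V λ x′ → ≤-trans (*-mono-≤ (≤-reflexive (α-sym x x′)) (y≤ x′)) (≤-reflexive (*-comm (α x′ x) (α a x′)))
      ψ≤ : ∀ x → ψ x ≤ w 1 x d
      ψ≤ x = ∑-mono V λ x′ → *-monoʳ-≤ (α x x′) (≤-trans (z≤ x′) (≤-reflexive (α-sym d x′)))
      -- If row `x` belongs to `a`, it contains fewer than n/t edges by choice. If it belongs to
      -- `d`, then `x` has at least n/t neighbours near `a`, so every edge towards `d` yields n/t
      -- walks of length 4 from `a` to `d`, and these are few.
      αP≤ : t * S (λ x x′ → α x x′ * P x x′) ≤ 2 * (n * n)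
      αP≤ = begin
        t * S (λ x x′ → α x x′ * P x x′)
          ≡⟨ cong (t *_) (trans (∑-cong V λ x → trans (∑-cong V λ x′ → expand (α x x′) (κ̄ x) (κ x) (y x′) (z x′))
               (trans (∑-+ V _ _) (cong₂ _+_ (∑-*ˡ V (κ̄ x) _) (∑-*ˡ V (κ x) _)))) (∑-+ V _ _)) ⟩
        t * (∑ V (λ x → κ̄ x * φ x) + ∑ V (λ x → κ x * ψ x))
          ≡⟨ *-distribˡ-+ t _ _ ⟩
        t * ∑ V (λ x → κ̄ x * φ x) + t * ∑ V (λ x → κ x * ψ x)
          ≤⟨ +-mono-≤ (≤-trans (≤-reflexive (sym (∑-*ˡ V t _))) (∑-bounded V n below)) above ⟩
        n * n + n * n
          ≡⟨ cong (n * n +_) (+-identityʳ (n * n)) ⟨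
        2 * (n * n) ∎
        where
        expand : ∀ a k̄ k y z → a * (k̄ * y + k * z) ≡ k̄ * (a * y) + k * (a * z)
        expand = solve-∀
        below : ∀ x → t * (κ̄ x * φ x) ≤ n
        below x = bound (many? x)
          where
          bound : (m : Dec (n ≤ t * φ x)) → t * (𝟙 (¬? m) * φ x) ≤ n
          bound (yes _) = ≤-trans (≤-reflexive (*-zeroʳ t)) z≤n
          bound (no m)  = ≤-trans (≤-reflexive (cong (t *_) (*-identityˡ (φ x)))) (<⇒≤ (≰⇒> m))
        each : ∀ x → n * (κ x * ψ x) ≤ t * (w 1 a x * w 1 x d)
        each x = bound (many? x)
          where
          bound : (m : Dec (n ≤ t * φ x)) → n * (𝟙 m * ψ x) ≤ t * (w 1 a x * w 1 x d)
          bound (no _)  = ≤-trans (≤-reflexive (*-zeroʳ n)) z≤n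
          bound (yes m) = ≤-trans (*-mono-≤ m (≤-trans (≤-reflexive (*-identityˡ (ψ x))) (ψ≤ x)))
                            (≤-trans (≤-reflexive (*-assoc t (φ x) _)) (*-monoʳ-≤ t (*-monoˡ-≤ (w 1 x d) (φ≤ x))))
        above : t * ∑ V (λ x → κ x * ψ x) ≤ n * n
        above = *-cancelˡ-≤ n {{ℕ.>-nonZero 0<n}} (begin
          n * (t * ∑ V (λ x → κ x * ψ x))             ≡⟨ swap n t _ ⟩
          t * (n * ∑ V (λ x → κ x * ψ x))             ≡⟨ cong (t *_) (∑-*ˡ V n _) ⟨
          t * ∑ V (λ x → n * (κ x * ψ x))             ≤⟨ *-monoʳ-≤ t (∑-mono V each) ⟩
          t * ∑ V (λ x → t * (w 1 a x * w 1 x d))     ≡⟨ cong (t *_) (trans (∑-*ˡ V t _) (cong (t *_) (sym (w-compose 1 1 a d)))) ⟩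
          t * (t * w 3 a d)                           ≡⟨ *-assoc t t _ ⟨
          t * t * w 3 a d                             ≤⟨ few ⟩
          n * (n * n)                                 ∎)
          where
          swap : ∀ a b c → a * (b * c) ≡ b * (a * c)
          swap = solve-∀

-- The power κ^(2i+1): the reciprocal density after `i` rounds of two extensions, each of which
-- costs a factor κ.
ladder : ℕ → ℕ → ℕ
ladder κ zero    = κ
ladder κ (suc i) = κ * (κ * ladder κ i)

module LadderBounds (κ : ℕ) (1≤κ : 1 ≤ κ) where
  grow : ∀ m → m ≤ κ * m
  grow m = m≤n*m m κ {{ℕ.>-nonZero 1≤κ}}

  base≤ladder : ∀ i → κ ≤ ladder κ i
  base≤ladder zero    = ≤-refl
  base≤ladder (suc i) = ≤-trans (base≤ladder i) (≤-trans (grow (ladder κ i)) (grow (κ * ladder κ i)))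

-- Edges on a common closed route have different colours

-- `V` lists the vertices that survive deletions, while `Γ` and its colouring stay fixed; all walk
-- counts and degrees are relative to `V`. Writing the half length as `4 + j` builds in k ≥ 4.
record Setting : Set where
  field
    {N f}    : ℕ
    {Γ}      : Graph N
    c        : Coloring Γ f
    j        : ℕ
    rainbow  : ∀ v → CycleCopy Γ (4 + j) v → Rainbow c (4 + j) v
    V        : List (Fin N)
    unique-V : Unique V
    T R      : ℕ
    2≤T      : 2 ≤ T
    large    : Constants.threshold j T R < length V

  1≤T : 1 ≤ T
  1≤T = ≤-trans (s≤s z≤n) 2≤T

module SameColour (𝒮 : Setting) where
  open Setting 𝒮
  open Walks Γ V
  open Routes Γ V unique-V (suc (2 * (4 + j)))
  open import Data.List.Membership.DecPropositional (Fin._≟_ {n = N}) using (_∈?_)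

  k : ℕ
  k = 4 + j

  colour : Fin N → Fin N → Fin f
  colour = col c

  -- Paths are listed backwards, so the list runs from `a` to `b`. The edge vu sits at position
  -- `length pre₂`, and ba is the wrap-around edge at position 2k. In a rainbow cycle equal colours
  -- would make these positions equal.
  closed-path : ∀ {a b u v rest₁ rest₂} pre₁ pre₂ → Path (pre₂ ++ v ∷ u ∷ rest₁) [] → pre₁ ++ b ∷ [] ≡ u ∷ rest₁ →
                pre₂ ++ v ∷ u ∷ rest₁ ≡ a ∷ rest₂ → length (pre₂ ++ v ∷ pre₁) ≡ 2 * k → Adj a b → colour b a ≢ colour v u
  closed-path {a} {b} {u} {v} {rest₁} {rest₂} pre₁ pre₂ p₂ eq₁ eq₂ length-init ab = λ same → <-irrefl (same-position same) p<2k
    where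
    Z = pre₂ ++ v ∷ u ∷ rest₁
    init = pre₂ ++ v ∷ pre₁
    Z≡ : Z ≡ init ++ b ∷ []
    Z≡ = trans (cong (λ path → pre₂ ++ v ∷ path) (sym eq₁)) (sym (++-assoc pre₂ (v ∷ pre₁) (b ∷ [])))
    length-Z : length Z ≡ suc (2 * k)
    length-Z = trans (cong length Z≡) (trans (length-++ init) (trans (+-comm (length init) 1) (cong suc length-init)))
    vertex : Fin (suc (2 * k)) → Fin N
    vertex i = entry b Z (toℕ i)
    in-range : ∀ (i : Fin (suc (2 * k))) → toℕ i < length Z
    in-range i = ≤-trans (Fin.toℕ<n i) (≤-reflexive (sym length-Z))
    entry-first : entry b Z 0 ≡ a
    entry-first = cong (λ path → entry b path 0) eq₂
    entry-last : entry b Z (2 * k) ≡ b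
    entry-last = trans (cong₂ (entry b) Z≡ (trans (sym length-init) (sym (+-identityʳ _)))) (entry-++ b init (b ∷ []) 0)
    open Path p₂
    step : ∀ i → Adj (vertex i) (vertex (next i))
    step i = go (toℕ-next i)
      where
      go : (toℕ i < 2 * k × toℕ (next i) ≡ suc (toℕ i)) ⊎ (toℕ i ≡ 2 * k × toℕ (next i) ≡ 0) → Adj (vertex i) (vertex (next i))
      go (inj₁ (i< , eq)) = subst (λ l → Adj (vertex i) (entry b Z l)) (sym eq)
        (entry-linked b linked (≤-trans (s≤s i<) (≤-reflexive (sym length-Z))))
      go (inj₂ (i≡ , eq)) = subst₂ Adj (sym (trans (cong (entry b Z) i≡) entry-last))
        (sym (trans (cong (entry b Z) eq) entry-first)) (Adj-sym ab)
    p : ℕ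
    p = length pre₂
    p<2k : p < 2 * k
    p<2k = ≤-trans (m<m+n p (s≤s z≤n)) (≤-reflexive (trans (sym (length-++ pre₂)) length-init))
    i₁ i₂ : Fin (suc (2 * k))
    i₁ = Fin.fromℕ< {p} (m≤n⇒m≤1+n p<2k)
    i₂ = Fin.fromℕ< {2 * k} ≤-refl
    toℕ-i₁ : toℕ i₁ ≡ p
    toℕ-i₁ = Fin.toℕ-fromℕ< _
    toℕ-i₂ : toℕ i₂ ≡ 2 * k
    toℕ-i₂ = Fin.toℕ-fromℕ< (≤-refl {suc (2 * k)})
    next-i₁ : toℕ (next i₁) ≡ p + 1
    next-i₁ = go (toℕ-next i₁)
      where
      go : (toℕ i₁ < 2 * k × toℕ (next i₁) ≡ suc (toℕ i₁)) ⊎ (toℕ i₁ ≡ 2 * k × toℕ (next i₁) ≡ 0) → toℕ (next i₁) ≡ p + 1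
      go (inj₁ (_ , eq)) = trans eq (trans (cong suc toℕ-i₁) (+-comm 1 p))
      go (inj₂ (eq , _)) = contradiction (trans (sym toℕ-i₁) eq) (<⇒≢ p<2k)
    next-i₂ : toℕ (next i₂) ≡ 0
    next-i₂ = go (toℕ-next i₂)
      where
      go : (toℕ i₂ < 2 * k × toℕ (next i₂) ≡ suc (toℕ i₂)) ⊎ (toℕ i₂ ≡ 2 * k × toℕ (next i₂) ≡ 0) → toℕ (next i₂) ≡ 0
      go (inj₁ (lt , _)) = contradiction toℕ-i₂ (<⇒≢ lt)
      go (inj₂ (_ , eq)) = eq
    colour-i₁ : colour (vertex i₁) (vertex (next i₁)) ≡ colour v u
    colour-i₁ = cong₂ colour
      (trans (cong (entry b Z) (trans toℕ-i₁ (sym (+-identityʳ p)))) (entry-++ b pre₂ _ 0))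
      (trans (cong (entry b Z) next-i₁) (entry-++ b pre₂ _ 1))
    colour-i₂ : colour (vertex i₂) (vertex (next i₂)) ≡ colour b a
    colour-i₂ = cong₂ colour (trans (cong (entry b Z) toℕ-i₂) entry-last) (trans (cong (entry b Z) next-i₂) entry-first)
    same-position : colour b a ≡ colour v u → p ≡ 2 * k
    same-position same = trans (sym toℕ-i₁) (trans (cong toℕ (rainbow vertex
      ((λ {i} {j} eq → Fin.toℕ-injective (entry-injective b unique (in-range i) (in-range j) eq)) , step)
      {i₁} {i₂} (trans colour-i₁ (trans (sym same) (sym colour-i₂))))) toℕ-i₂)

  -- The closed route is b ⇝ u - v ⇝ a - b. The uniqueness hypothesis reserves all stops before any
  -- internal vertex is chosen, and the last equation counts vertices: b, those after b up to u,
  -- then v, and those after v up to a.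
  conflict : ∀ {a b u v segs₁ segs₂} → Route b segs₁ u → Adj u v → Route v segs₂ a → Adj a b →
             Unique (b ∷ stops segs₁ ++ v ∷ stops segs₂) →
             suc (size segs₁ + suc (size segs₂)) ≡ suc (2 * k) →
             colour b a ≢ colour v u
  conflict {a} {b} {u} {v} {segs₁} {segs₂} route₁ uv route₂ ab (b∉ ∷ unique-stops) total =
    case traverse segs₁ {path = []} {R = v ∷ stops segs₂} route₁ start
           (≤-trans (≤-reflexive (cong (suc (size segs₁) +_) (cong suc (length-map proj₂ segs₂))))
             (≤-trans (+-monoʳ-≤ (suc (size segs₁)) (s≤s (segs≤ segs₂))) (≤-reflexive total)))
    of λ { (pre₁ , len₁ , p₁ , rest₁ , eq₁) →
    case traverse segs₂ {path = u ∷ rest₁} {R = []} route₂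
           (subst (Path _) (sym (++-identityʳ (stops segs₂))) (arrive (subst (λ path → Path path _) eq₁ p₁) uv))
           (≤-trans (≤-reflexive (trans (+-identityʳ _) (lengths pre₁ len₁ eq₁))) (≤-reflexive total))
    of λ { (pre₂ , len₂ , p₂ , rest₂ , eq₂) →
    closed-path pre₁ pre₂ p₂ eq₁ eq₂ (length-init pre₁ pre₂ len₁ len₂) ab }}
    where
    start : Path (b ∷ []) (stops segs₁ ++ v ∷ stops segs₂)
    start = record
      { linked = [-] ; unique = [] ∷ [] ; reserved = unique-stops
      ; disjoint = λ { (here refl) b∈ → All.lookup b∉ b∈ refl } }
    segs≤ : ∀ segs → length segs ≤ size segs
    segs≤ [] = z≤n
    segs≤ ((l , _) ∷ segs) = s≤s (≤-trans (segs≤ segs) (m≤n+m _ l))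
    lengths : ∀ pre₁ {rest₁} → length pre₁ ≡ size segs₁ → pre₁ ++ b ∷ [] ≡ u ∷ rest₁ →
              suc (length (u ∷ rest₁)) + size segs₂ ≡ suc (size segs₁ + suc (size segs₂))
    lengths pre₁ len₁ eq₁ = trans (cong (λ path → suc (length path) + size segs₂) (sym eq₁))
                (trans (cong (λ c → suc c + size segs₂) (trans (length-++ pre₁) (cong (_+ 1) len₁)))
                       (identity (size segs₁) (size segs₂)))
      where
      identity : ∀ s t → suc (s + 1) + t ≡ suc (s + suc t)
      identity = solve-∀
    length-init : ∀ pre₁ pre₂ → length pre₁ ≡ size segs₁ → length pre₂ ≡ size segs₂ → length (pre₂ ++ v ∷ pre₁) ≡ 2 * k
    length-init pre₁ pre₂ len₁ len₂ = trans (length-++ pre₂) (suc-injective (trans (cong₂ (λ s t → suc (s + suc t)) len₂ len₁)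
                    (trans (identity (size segs₁) (size segs₂)) total)))
      where
      identity : ∀ s t → suc (t + suc s) ≡ suc (s + suc t)
      identity = solve-∀

  pads : ∀ {D} i l {a y} → Dense D (2 + l) a y → Dense (padded D i) (2 + up i l) a y
  pads zero    l dense = dense
  pads {D} (suc i) l {a} {y} dense = pad {padded D i} (up i l) {a} {y} (pads {D} i l {a} {y} dense)

  dense⇒rich : ∀ {D} l {x y} → D * K < n → Dense D (suc l) x y → Rich (suc l) x y
  dense⇒rich {D} l {x} {y} DK<n dense = *-cancelˡ-< D _ _ (begin-strict
    D * (K * n ^ l)     ≡⟨ *-assoc D K (n ^ l) ⟨
    D * K * n ^ l       <⟨ *-monoˡ-< (n ^ l) {{m^n≢0 n l {{ℕ.>-nonZero (≤-<-trans z≤n DK<n)}}}} DK<n ⟩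
    n * n ^ l           ≤⟨ dense ⟩
    D * w (suc l) x y   ∎)
    where open ≤-Reasoning

  E : ℕ
  E = ∑ V deg

  degrees-common : ∀ x y → deg x + deg y ≤ n + w 1 x y
  degrees-common x y = begin
    deg x + deg y                             ≡⟨ ∑-+ V _ _ ⟨
    ∑ V (λ z → α x z + α y z)                 ≤⟨ ∑-mono V each ⟩
    ∑ V (λ z → 1 + α x z * α z y)             ≡⟨ trans (∑-+ V _ _) (cong (_+ w 1 x y) (trans (∑-const V 1) (*-identityʳ n))) ⟩
    n + w 1 x y                               ∎
    where
    open ≤-Reasoning
    each : ∀ z → α x z + α y z ≤ 1 + α x z * α z y
    each z = subst (λ a → α x z + α y z ≤ 1 + α x z * a) (α-sym y z) (go (adj? x z))
      where
      go : (d : Dec (Adj x z)) → 𝟙 d + α y z ≤ 1 + 𝟙 d * α y z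
      go (yes _) = s≤s (m≤m+n (α y z) 0)
      go (no _)  = α≤1 y z

  Pair : Set
  Pair = Fin N × Fin N

  P : List Pair
  P = cartesianProduct V V

  _~_ : Pair → Pair → Set
  (a , b) ~ (c , d) = (a ≡ c × b ≡ d) ⊎ (a ≡ d × b ≡ c)

  _~?_ : ∀ e e′ → Dec (e ~ e′)
  (a , b) ~? (c , d) = (a Fin.≟ c ×-dec b Fin.≟ d) ⊎-dec (a Fin.≟ d ×-dec b Fin.≟ c)

  χ : Pair → Fin f
  χ (a , b) = colour a b

  copies : ∀ e → ∑ P (λ e′ → 𝟙 (e ~? e′)) ≤ 2
  copies (a , b) = begin
    ∑ P (λ e′ → 𝟙 ((a , b) ~? e′))
      ≡⟨ ∑-pairs V V _ ⟩
    ∑ V (λ x → ∑ V λ y → 𝟙 ((a , b) ~? (x , y)))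
      ≤⟨ ∑-mono V (λ x → ∑-mono V λ y → either x y) ⟩
    ∑ V (λ x → ∑ V λ y → 𝟙 (x Fin.≟ a) * (𝟙 (y Fin.≟ b) * 1) + 𝟙 (x Fin.≟ b) * (𝟙 (y Fin.≟ a) * 1))
      ≡⟨ trans (∑-cong V λ x → trans (∑-+ V _ _) (cong₂ _+_ (∑-*ˡ V (𝟙 (x Fin.≟ a)) _) (∑-*ˡ V (𝟙 (x Fin.≟ b)) _))) (∑-+ V _ _) ⟩
    ∑ V (λ x → 𝟙 (x Fin.≟ a) * point b) + ∑ V (λ x → 𝟙 (x Fin.≟ b) * point a)
      ≤⟨ +-mono-≤ (≤-trans (∑-point Fin._≟_ unique-V a (λ _ → point b)) (∑-point Fin._≟_ unique-V b (λ _ → 1)))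
                  (≤-trans (∑-point Fin._≟_ unique-V b (λ _ → point a)) (∑-point Fin._≟_ unique-V a (λ _ → 1))) ⟩
    2 ∎
    where
    open ≤-Reasoning
    point : Fin N → ℕ
    point z = ∑ V λ y → 𝟙 (y Fin.≟ z) * 1
    both : ∀ {x y x′ y′ : Fin N} → x ≡ x′ → y ≡ y′ → 1 ≤ 𝟙 (x Fin.≟ x′) * (𝟙 (y Fin.≟ y′) * 1)
    both {x} {y} refl refl = ≤-reflexive (sym (cong₂ (λ p q → p * (q * 1)) (𝟙-yes (x Fin.≟ x) refl) (𝟙-yes (y Fin.≟ y) refl)))
    either : ∀ x y → 𝟙 ((a , b) ~? (x , y)) ≤ 𝟙 (x Fin.≟ a) * (𝟙 (y Fin.≟ b) * 1) + 𝟙 (x Fin.≟ b) * (𝟙 (y Fin.≟ a) * 1)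
    either x y = go ((a , b) ~? (x , y))
      where
      go : (d : Dec ((a , b) ~ (x , y))) → 𝟙 d ≤ 𝟙 (x Fin.≟ a) * (𝟙 (y Fin.≟ b) * 1) + 𝟙 (x Fin.≟ b) * (𝟙 (y Fin.≟ a) * 1)
      go (no _) = z≤n
      go (yes (inj₁ (a≡x , b≡y))) = ≤-trans (both (sym a≡x) (sym b≡y)) (m≤m+n _ _)
      go (yes (inj₂ (a≡y , b≡x))) = ≤-trans (both (sym b≡x) (sym a≡y)) (m≤n+m _ (𝟙 (x Fin.≟ a) * (𝟙 (y Fin.≟ b) * 1)))

  open Counting P χ _~?_ copies

  length-P : length P ≡ n * n
  length-P = trans (sym (trans (∑-const P 1) (*-identityʳ _)))
    (trans (∑-pairs V V _) (trans (∑-cong V λ _ → trans (∑-const V 1) (*-identityʳ n)) (∑-const V n)))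

  -- Nearly bipartite graphs

  -- All edges between A and B lie on common cycles with the edge xx′, if pairs of vertices of B, and pairs formed by
  -- x or x′ and a vertex of A, have many common neighbours.
  module Bipartite (κ : ℕ) (1≤κ : 1 ≤ κ) where
    open LadderBounds κ 1≤κ

    -- Walks from `u` to the neighbours of `z` in `S` are extended by one edge. As there are at
    -- least n/κ such neighbours, the density loses only a factor κ.
    propagate : ∀ {S : Fin N → Set} (S? : ∀ x → Dec (S x)) {D l u z} → (∀ s → S s → Dense D l u s) →
                n ≤ κ * ∑ V (λ s → α z s * 𝟙 (S? s)) → Dense (κ * D) (suc l) u z
    propagate {S} S? {D} {l} {u} {z} dense many = Dense-sym {κ * D} (suc l) {z} {u} (begin
      n * n ^ l                                                ≤⟨ *-monoˡ-≤ (n ^ l) many ⟩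
      κ * ∑ V (λ s → α z s * 𝟙 (S? s)) * n ^ l                ≡⟨ trans (*-assoc κ (∑ V (λ s → α z s * 𝟙 (S? s))) (n ^ l)) (cong (κ *_) (sym (∑-*ʳ V (n ^ l) (λ s → α z s * 𝟙 (S? s))))) ⟩
      κ * ∑ V (λ s → α z s * 𝟙 (S? s) * n ^ l)                ≤⟨ *-monoʳ-≤ κ (∑-mono V each) ⟩
      κ * ∑ V (λ s → D * (α z s * w l s u))                   ≡⟨ trans (cong (κ *_) (∑-*ˡ V D (λ s → α z s * w l s u))) (sym (*-assoc κ D (w (suc l) z u))) ⟩
      κ * D * w (suc l) z u                                   ∎)
      where
      open ≤-Reasoning
      each : ∀ s → α z s * 𝟙 (S? s) * n ^ l ≤ D * (α z s * w l s u)
      each s = bound (S? s)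
        where
        swap : ∀ a b c → a * (b * c) ≡ b * (a * c)
        swap = solve-∀
        bound : (d : Dec (S s)) → α z s * 𝟙 d * n ^ l ≤ D * (α z s * w l s u)
        bound (no _)  = ≤-trans (≤-reflexive (cong (_* n ^ l) (*-zeroʳ (α z s)))) z≤n
        bound (yes p) = ≤-trans (≤-reflexive (cong (_* n ^ l) (*-identityʳ (α z s))))
          (≤-trans (*-monoʳ-≤ (α z s) (Dense-sym {D} l {u} {s} (dense s p))) (≤-reflexive (swap (α z s) D (w l s u))))

    module _ {A B : Fin N → Set} (A? : ∀ x → Dec (A x)) (B? : ∀ x → Dec (B x))
      (A-to-B : ∀ a → A a → n ≤ κ * ∑ V (λ z → α a z * 𝟙 (B? z)))
      (B-to-A : ∀ b → B b → n ≤ κ * ∑ V (λ z → α b z * 𝟙 (A? z)))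
      (large : ladder κ (suc j) * K < n) where
      private
        rich : ∀ {D} l {u v} → D ≤ ladder κ (suc j) → Dense D (suc l) u v → Rich (suc l) u v
        rich {D} l {u} {v} D≤ = dense⇒rich {D} l (≤-<-trans (*-monoˡ-≤ K D≤) large)

        κ≤ : κ ≤ ladder κ (suc j)
        κ≤ = base≤ladder (suc j)

        κ²≤ : κ * κ ≤ ladder κ (suc j)
        κ²≤ = *-monoʳ-≤ κ (≤-trans (base≤ladder j) (grow (ladder κ j)))

        ladder≤ : ladder κ j ≤ ladder κ (suc j)
        ladder≤ = ≤-trans (grow (ladder κ j)) (grow (κ * ladder κ j))

        κladder≤ : κ * ladder κ j ≤ ladder κ (suc j)
        κladder≤ = grow (κ * ladder κ j)

      -- One detour through `B` lengthens the walk by two vertices and brings its end back to `A`.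
      climb-A : ∀ i {u} → (∀ a → A a → Dense κ 1 u a) → ∀ a → A a → Dense (ladder κ i) (suc (up i 0)) u a
      climb-A zero    start = start
      climb-A (suc i) {u} start a a∈ = propagate B? {κ * ladder κ i} {suc (suc (up i 0))} {u} {a}
        (λ b b∈ → propagate A? {ladder κ i} {suc (up i 0)} {u} {b} (climb-A i start) (B-to-A b b∈)) (A-to-B a a∈)

      climb-B : ∀ i {u} → (∀ b → B b → Dense κ 1 u b) → ∀ b → B b → Dense (ladder κ i) (suc (up i 0)) u b
      climb-B zero    start = start
      climb-B (suc i) {u} start b b∈ = propagate A? {κ * ladder κ i} {suc (suc (up i 0))} {u} {b}
        (λ a a∈ → propagate B? {ladder κ i} {suc (up i 0)} {u} {a} (climb-B i start) (A-to-B a a∈)) (B-to-A b b∈)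

      module _ {x x′} (xx′ : Adj x x′) (from-x : ∀ a → A a → Dense κ 1 x a) (from-x′ : ∀ a → A a → Dense κ 1 x′ a)
        (between : ∀ b b′ → B b → B b′ → Dense κ 1 b b′)
        (A≢ : ∀ a → A a → a ≢ x × a ≢ x′) (B≢ : ∀ b → B b → b ≢ x × b ≢ x′) (A≢B : ∀ a b → A a → B b → a ≢ b) where
        private
          2j : up j 0 ≡ j + j + 0
          2j = up≡ j 0

          -- The route is b ⇝ b′ - a′ - · - x - x′ - · - a - b, with 2j + 1 internal vertices
          -- between b and b′. All other steps alternate between the sides; the edge xx′ makes the
          -- length odd.
          disjoint : ∀ {a b a′ b′} → A a → B b → A a′ → B b′ → Adj a b → Adj a′ b′ → a ≢ a′ → b ≢ b′ → colour b a ≢ colour a′ b′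
          disjoint {a} {b} {a′} {b′} a∈ b∈ a′∈ b′∈ ab a′b′ a≢a′ b≢b′ =
            conflict {segs₁ = (suc (up j 0) , b′) ∷ []} {segs₂ = (1 , x) ∷ (0 , x′) ∷ (1 , a) ∷ []}
              (rich {ladder κ j} (up j 0) ladder≤ (climb-B j {b} (λ z z∈ → between b z b∈ z∈) b′ b′∈) ∷ [])
              (Adj-sym a′b′)
              (rich {κ} 0 κ≤ (Dense-sym {κ} 1 {x} {a′} (from-x a′ a′∈)) ∷ xx′ ∷ rich {κ} 0 κ≤ (from-x′ a a∈) ∷ [])
              ab
              ((b≢b′ ∷ ≢-sym (A≢B a′ b a′∈ b∈) ∷ proj₁ (B≢ b b∈) ∷ proj₂ (B≢ b b∈) ∷ ≢-sym (A≢B a b a∈ b∈) ∷ []) ∷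
               (≢-sym (A≢B a′ b′ a′∈ b′∈) ∷ proj₁ (B≢ b′ b′∈) ∷ proj₂ (B≢ b′ b′∈) ∷ ≢-sym (A≢B a b′ a∈ b′∈) ∷ []) ∷
               (proj₁ (A≢ a′ a′∈) ∷ proj₂ (A≢ a′ a′∈) ∷ ≢-sym a≢a′ ∷ []) ∷
               (Adj⇒≢ xx′ ∷ ≢-sym (proj₁ (A≢ a a∈)) ∷ []) ∷ (≢-sym (proj₂ (A≢ a a∈)) ∷ []) ∷ [] ∷ [])
              (trans (cong (λ l → 3 + (l + 0) + 6) 2j) (total j))
            where
            total : ∀ j → 3 + ((j + j + 0) + 0) + 6 ≡ suc (2 * (4 + j))
            total = solve-∀

          -- The route is b ⇝ x - x′ - · - · - b′ - a - b. The walk from b to x changes sides and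
          -- has 2j + 2 internal vertices.
          share-A : ∀ {a b b′} → A a → B b → B b′ → Adj a b → Adj a b′ → b ≢ b′ → colour b a ≢ colour a b′
          share-A {a} {b} {b′} a∈ b∈ b′∈ ab ab′ b≢b′ =
            conflict {segs₁ = (2 + up j 0 , x) ∷ (0 , x′) ∷ (2 , b′) ∷ []} {segs₂ = []}
              (rich {κ * ladder κ j} (suc (up j 0)) κladder≤ (Dense-sym {κ * ladder κ j} (2 + up j 0) {x} {b} (
                 propagate A? {ladder κ j} {suc (up j 0)} {x} {b} (climb-A j from-x) (B-to-A b b∈))) ∷
               xx′ ∷ rich {κ * κ} 1 κ²≤ (propagate A? {κ} {1} {x′} {b′} from-x′ (B-to-A b′ b′∈)) ∷ [])
              (Adj-sym ab′) [] ab
              ((proj₁ (B≢ b b∈) ∷ proj₂ (B≢ b b∈) ∷ b≢b′ ∷ ≢-sym (A≢B a b a∈ b∈) ∷ []) ∷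
               (Adj⇒≢ xx′ ∷ ≢-sym (proj₁ (B≢ b′ b′∈)) ∷ ≢-sym (proj₁ (A≢ a a∈)) ∷ []) ∷
               (≢-sym (proj₂ (B≢ b′ b′∈)) ∷ ≢-sym (proj₂ (A≢ a a∈)) ∷ []) ∷ (≢-sym (A≢B a b′ a∈ b′∈) ∷ []) ∷ [] ∷ [])
              (trans (cong (λ l → 4 + (l + 4) + 1) 2j) (total j))
            where
            total : ∀ j → 4 + ((j + j + 0) + 4) + 1 ≡ suc (2 * (4 + j))
            total = solve-∀

          -- The route is a - · - x - x′ ⇝ a′ - b - a, with 2j + 3 internal vertices between x′ and
          -- a′; it uses the longest climb and so fixes the size required of `n`.
          share-B : ∀ {a a′ b} → A a → A a′ → B b → Adj a b → Adj a′ b → a ≢ a′ → colour a b ≢ colour b a′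
          share-B {a} {a′} {b} a∈ a′∈ b∈ ab a′b a≢a′ =
            conflict {segs₁ = (1 , x) ∷ (0 , x′) ∷ (suc (up (suc j) 0) , a′) ∷ []} {segs₂ = []}
              (rich {κ} 0 κ≤ (Dense-sym {κ} 1 {x} {a} (from-x a a∈)) ∷ xx′ ∷
               rich {ladder κ (suc j)} (up (suc j) 0) ≤-refl (climb-A (suc j) from-x′ a′ a′∈) ∷ [])
              a′b [] (Adj-sym ab)
              ((proj₁ (A≢ a a∈) ∷ proj₂ (A≢ a a∈) ∷ a≢a′ ∷ A≢B a b a∈ b∈ ∷ []) ∷
               (Adj⇒≢ xx′ ∷ ≢-sym (proj₁ (A≢ a′ a′∈)) ∷ ≢-sym (proj₁ (B≢ b b∈)) ∷ []) ∷
               (≢-sym (proj₂ (A≢ a′ a′∈)) ∷ ≢-sym (proj₂ (B≢ b b∈)) ∷ []) ∷ (A≢B a′ b a′∈ b∈ ∷ []) ∷ [] ∷ [])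
              (trans (cong (λ l → 8 + (l + 0) + 1) 2j) (total j))
            where
            total : ∀ j → 8 + ((j + j + 0) + 0) + 1 ≡ suc (2 * (4 + j))
            total = solve-∀

        distinct-colours : ∀ {a b a′ b′} → A a → B b → A a′ → B b′ → Adj a b → Adj a′ b′ → ¬ (a ≡ a′ × b ≡ b′) → colour a b ≢ colour a′ b′
        distinct-colours {a} {b} {a′} {b′} a∈ b∈ a′∈ b′∈ ab a′b′ differ same = go (a Fin.≟ a′) (b Fin.≟ b′)
          where
          go : Dec (a ≡ a′) → Dec (b ≡ b′) → ⊥
          go (yes refl) (yes refl) = differ (refl , refl)
          go (yes refl) (no b≢b′)  = share-A a∈ b∈ b′∈ ab a′b′ b≢b′ (trans (sym (colSym c a b ab)) same)
          go (no a≢a′)  (yes refl) = share-B a∈ a′∈ b∈ ab a′b′ a≢a′ (trans same (colSym c a′ b a′b′))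
          go (no a≢a′)  (no b≢b′)  = disjoint a∈ b∈ a′∈ b′∈ ab a′b′ a≢a′ b≢b′ (trans (sym (colSym c a b ab)) same)

  -- Two sides S₁ and S₂ that are almost completely joined, and an edge xx′ inside S₁.
  module Cut {S₁ S₂ : Fin N → Set} (S₁? : ∀ x → Dec (S₁ x)) (S₂? : ∀ x → Dec (S₂ x)) (S₁-S₂ : ∀ {x} → S₁ x → S₂ x → ⊥) where
    -- Each vertex has n/16 neighbours on the other side. Removing the exceptional vertices and the
    -- two ends `x`, `x′` costs at most n/64 each time, so more than n/64 neighbours remain.
    open Bipartite 64 (s≤s z≤n)

    missing : Fin N → Fin N → ℕ
    missing x z = 𝟙 (¬? (adj? x z))

    to₁ to₂ miss₁ miss₂ : Fin N → ℕ
    to₁ x = ∑ V λ z → α x z * 𝟙 (S₁? z)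
    to₂ x = ∑ V λ z → α x z * 𝟙 (S₂? z)
    miss₁ x = ∑ V λ z → 𝟙 (S₁? z) * missing x z
    miss₂ x = ∑ V λ z → 𝟙 (S₂? z) * missing x z

    U e : ℕ
    U = ∑ V λ x → 𝟙 (S₁? x) * miss₂ x
    e = ∑ V λ x → 𝟙 (S₁? x) * to₂ x

    missing-sym : ∀ x z → missing x z ≡ missing z x
    missing-sym x z = ≤-antisym (𝟙-mono (¬? (adj? x z)) (¬? (adj? z x)) (λ ¬a a → ¬a (Adj-sym a)))
                                (𝟙-mono (¬? (adj? z x)) (¬? (adj? x z)) (λ ¬a a → ¬a (Adj-sym a)))

    U-sym : U ≡ ∑ V (λ z → 𝟙 (S₂? z) * miss₁ z)
    U-sym = begin
      ∑ V (λ x → 𝟙 (S₁? x) * miss₂ x)                               ≡⟨ ∑-cong V (λ x → sym (∑-*ˡ V (𝟙 (S₁? x)) _)) ⟩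
      ∑ V (λ x → ∑ V λ z → 𝟙 (S₁? x) * (𝟙 (S₂? z) * missing x z))   ≡⟨ ∑-swap V V _ ⟩
      ∑ V (λ z → ∑ V λ x → 𝟙 (S₁? x) * (𝟙 (S₂? z) * missing x z))   ≡⟨ ∑-cong V (λ z → trans (∑-cong V λ x →
                                                                        trans (swap (𝟙 (S₁? x)) (𝟙 (S₂? z)) (missing x z)) (cong (λ y → 𝟙 (S₂? z) * (𝟙 (S₁? x) * y)) (missing-sym x z)))
                                                                        (∑-*ˡ V (𝟙 (S₂? z)) _)) ⟩
      ∑ V (λ z → 𝟙 (S₂? z) * miss₁ z)                               ∎
      where
      open ≡-Reasoning
      swap : ∀ a b c → a * (b * c) ≡ b * (a * c)
      swap = solve-∀

    e-sym : e ≡ ∑ V (λ z → 𝟙 (S₂? z) * to₁ z)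
    e-sym = begin
      ∑ V (λ x → 𝟙 (S₁? x) * to₂ x)                                 ≡⟨ ∑-cong V (λ x → sym (∑-*ˡ V (𝟙 (S₁? x)) _)) ⟩
      ∑ V (λ x → ∑ V λ z → 𝟙 (S₁? x) * (α x z * 𝟙 (S₂? z)))         ≡⟨ ∑-swap V V _ ⟩
      ∑ V (λ z → ∑ V λ x → 𝟙 (S₁? x) * (α x z * 𝟙 (S₂? z)))         ≡⟨ ∑-cong V (λ z → trans (∑-cong V λ x →
                                                                        trans (cong (λ y → 𝟙 (S₁? x) * (y * 𝟙 (S₂? z))) (α-sym x z)) (swap (𝟙 (S₁? x)) (α z x) (𝟙 (S₂? z))))
                                                                        (∑-*ˡ V (𝟙 (S₂? z)) _)) ⟩
      ∑ V (λ z → 𝟙 (S₂? z) * to₁ z)                                 ∎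
      where
      open ≡-Reasoning
      swap : ∀ a b c → a * (b * c) ≡ c * (b * a)
      swap = solve-∀

    module _ {D : ℕ} (D-large : 64 * 2816 ≤ D) (128≤n : 128 ≤ n) (16D≤n : 16 * D ≤ n) (large : ladder 64 (suc j) * K < n)
      (rich₁ : ∀ x → x ∈ V → S₁ x → n ≤ 16 * to₂ x) (rich₂ : ∀ x → x ∈ V → S₂ x → n ≤ 16 * to₁ x)
      (few-missing : D * U ≤ 44 * (n * n)) (many-edges : D * (n * n) ≤ 4 * (D * e) + 175 * (n * n))
      {x x′} (x∈ : x ∈ V) (x′∈ : x′ ∈ V) (x∈S₁ : S₁ x) (x′∈S₁ : S₁ x′) (xx′ : Adj x x′) where
      private
        0<n : 0 < n
        0<n = ≤-trans (s≤s z≤n) 128≤n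

        -- The typical vertices of each side; `x` and `x′` are left out because they are stops of
        -- every route.
        A B : Fin N → Set
        A a = (a ∈ V × S₁ a) × 64 * miss₂ a ≤ n × a ≢ x × a ≢ x′
        B b = (b ∈ V × S₂ b) × 64 * miss₁ b ≤ n × b ≢ x × b ≢ x′

        A? : ∀ a → Dec (A a)
        A? a = (a ∈? V ×-dec S₁? a) ×-dec 64 * miss₂ a ℕ.≤? n ×-dec ¬? (a Fin.≟ x) ×-dec ¬? (a Fin.≟ x′)

        B? : ∀ b → Dec (B b)
        B? b = (b ∈? V ×-dec S₂? b) ×-dec 64 * miss₁ b ℕ.≤? n ×-dec ¬? (b Fin.≟ x) ×-dec ¬? (b Fin.≟ x′)

        odd₁ odd₂ special : Fin N → ℕ
        odd₁ z = 𝟙 (S₁? z) * 𝟙 (n ℕ.<? 64 * miss₂ z)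
        odd₂ z = 𝟙 (S₂? z) * 𝟙 (n ℕ.<? 64 * miss₁ z)
        special z = 𝟙 (z Fin.≟ x) * 1 + 𝟙 (z Fin.≟ x′) * 1

        special-total : ∑ V special ≤ 2
        special-total = ≤-trans (≤-reflexive (∑-+ V _ _))
          (+-mono-≤ (∑-point Fin._≟_ unique-V x (λ _ → 1)) (∑-point Fin._≟_ unique-V x′ (λ _ → 1)))

        -- Markov's inequality: an exceptional vertex misses more than n/64 of the other side, while
        -- at most 44n²/D pairs are missing altogether; 2816 is 64 · 44.
        odd-total : ∀ {S : Fin N → Set} (S? : ∀ z → Dec (S z)) (μ : Fin N → ℕ) → D * ∑ V (λ z → 𝟙 (S? z) * μ z) ≤ 44 * (n * n) →
                    D * ∑ V (λ z → 𝟙 (S? z) * 𝟙 (n ℕ.<? 64 * μ z)) ≤ 2816 * n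
        odd-total S? μ few = *-cancelˡ-≤ n {{ℕ.>-nonZero 0<n}} (begin
          n * (D * ∑ V (λ z → 𝟙 (S? z) * 𝟙 (n ℕ.<? 64 * μ z)))     ≡⟨ swap n D _ ⟩
          D * (n * ∑ V (λ z → 𝟙 (S? z) * 𝟙 (n ℕ.<? 64 * μ z)))     ≡⟨ cong (D *_) (∑-*ˡ V n (λ z → 𝟙 (S? z) * 𝟙 (n ℕ.<? 64 * μ z))) ⟨
          D * ∑ V (λ z → n * (𝟙 (S? z) * 𝟙 (n ℕ.<? 64 * μ z)))     ≤⟨ *-monoʳ-≤ D (∑-mono V λ z → each (S? z) (n ℕ.<? 64 * μ z)) ⟩
          D * ∑ V (λ z → 64 * (𝟙 (S? z) * μ z))                    ≡⟨ cong (D *_) (∑-*ˡ V 64 (λ z → 𝟙 (S? z) * μ z)) ⟩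
          D * (64 * ∑ V (λ z → 𝟙 (S? z) * μ z))                    ≡⟨ swap D 64 _ ⟩
          64 * (D * ∑ V (λ z → 𝟙 (S? z) * μ z))                    ≤⟨ *-monoʳ-≤ 64 few ⟩
          64 * (44 * (n * n))                                      ≡⟨ rearrange n ⟩
          n * (2816 * n)                                           ∎)
          where
          open ≤-Reasoning
          swap : ∀ a b c → a * (b * c) ≡ b * (a * c)
          swap = solve-∀
          rearrange : ∀ n → 64 * (44 * (n * n)) ≡ n * (2816 * n)
          rearrange = solve-∀
          each : ∀ {P : Set} (s : Dec P) {m} (l : Dec (n < 64 * m)) → n * (𝟙 s * 𝟙 l) ≤ 64 * (𝟙 s * m)
          each (no _)  _        = ≤-trans (≤-reflexive (*-zeroʳ n)) z≤n
          each (yes _) (no _)   = ≤-trans (≤-reflexive (*-zeroʳ n)) z≤n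
          each (yes _) {m} (yes lt) = ≤-trans (≤-reflexive (*-identityʳ n)) (≤-trans (<⇒≤ lt) (≤-reflexive (cong (64 *_) (sym (*-identityˡ m)))))

        odd₁-total : D * ∑ V odd₁ ≤ 2816 * n
        odd₁-total = odd-total S₁? miss₂ few-missing

        odd₂-total : D * ∑ V odd₂ ≤ 2816 * n
        odd₂-total = odd-total S₂? miss₁ (subst (λ u → D * u ≤ 44 * (n * n)) U-sym few-missing)

        few-odd : ∀ {o} → D * o ≤ 2816 * n → 64 * o ≤ n
        few-odd {o} le = *-cancelˡ-≤ {64 * o} {n} 2816 (≤-trans (≤-reflexive (reorder o)) (≤-trans (*-monoˡ-≤ o D-large) le))
          where
          reorder : ∀ o → 2816 * (64 * o) ≡ 64 * 2816 * o
          reorder = solve-∀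

        case-A : ∀ z → z ∈ V → 𝟙 (S₁? z) ≤ 𝟙 (A? z) + (odd₁ z + special z)
        case-A z z∈ = go (S₁? z) (n ℕ.<? 64 * miss₂ z) (z Fin.≟ x) (z Fin.≟ x′)
          where
          go : (s : Dec (S₁ z)) (l : Dec (n < 64 * miss₂ z)) (p : Dec (z ≡ x)) (p′ : Dec (z ≡ x′)) →
               𝟙 s ≤ 𝟙 (A? z) + (𝟙 s * 𝟙 l + (𝟙 p * 1 + 𝟙 p′ * 1))
          go (no _)  _       _       _        = z≤n
          go (yes _) (yes _) _       _        = ≤-trans (m≤m+n 1 _) (m≤n+m _ (𝟙 (A? z)))
          go (yes _) (no _)  (yes _) _        = ≤-trans (m≤m+n 1 _) (m≤n+m _ (𝟙 (A? z)))
          go (yes _) (no _)  (no _)  (yes _)  = m≤n+m 1 (𝟙 (A? z))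
          go (yes s) (no l)  (no p)  (no p′)  = ≤-trans (≤-reflexive (sym (𝟙-yes (A? z) ((z∈ , s) , ≮⇒≥ l , p , p′)))) (m≤m+n _ 0)

        case-B : ∀ z → z ∈ V → 𝟙 (S₂? z) ≤ 𝟙 (B? z) + (odd₂ z + special z)
        case-B z z∈ = go (S₂? z) (n ℕ.<? 64 * miss₁ z) (z Fin.≟ x) (z Fin.≟ x′)
          where
          go : (s : Dec (S₂ z)) (l : Dec (n < 64 * miss₁ z)) (p : Dec (z ≡ x)) (p′ : Dec (z ≡ x′)) →
               𝟙 s ≤ 𝟙 (B? z) + (𝟙 s * 𝟙 l + (𝟙 p * 1 + 𝟙 p′ * 1))
          go (no _)  _       _       _        = z≤n
          go (yes _) (yes _) _       _        = ≤-trans (m≤m+n 1 _) (m≤n+m _ (𝟙 (B? z)))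
          go (yes _) (no _)  (yes _) _        = ≤-trans (m≤m+n 1 _) (m≤n+m _ (𝟙 (B? z)))
          go (yes _) (no _)  (no _)  (yes _)  = m≤n+m 1 (𝟙 (B? z))
          go (yes s) (no l)  (no p)  (no p′)  = ≤-trans (≤-reflexive (sym (𝟙-yes (B? z) ((z∈ , s) , ≮⇒≥ l , p , p′)))) (m≤m+n _ 0)

        remains : ∀ {g y o} → n ≤ 16 * g → g ≤ y + (o + 2) → 64 * o ≤ n → n ≤ 64 * y
        remains {g} {y} {o} n≤ g≤ o≤ = by-adding (+-mono-≤ (+-mono-≤ (*-monoʳ-≤ 4 n≤) (*-monoʳ-≤ 64 g≤)) (+-mono-≤ o≤ 128≤n)) n (identity n g y o)
          where
          identity : ∀ n g y o → n + (4 * (16 * g) + 64 * (y + (o + 2)) + (n + n)) + n ≡ 64 * y + (4 * n + 64 * g + (64 * o + 128))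
          identity = solve-∀

        spread : ∀ a (S S′ : Fin N → ℕ) (o : Fin N → ℕ) → (∀ z → z ∈ V → S z ≤ S′ z + (o z + special z)) →
                 ∑ V (λ z → α a z * S z) ≤ ∑ V (λ z → α a z * S′ z) + (∑ V o + 2)
        spread a S S′ o le = begin
          ∑ V (λ z → α a z * S z)
            ≤⟨ ∑-mono∈ V (λ z z∈ → ≤-trans (*-monoʳ-≤ (α a z) (le z z∈)) (≤-trans (≤-reflexive (*-distribˡ-+ (α a z) (S′ z) (o z + special z)))
                 (+-monoʳ-≤ (α a z * S′ z) (α-drop a z (o z + special z))))) ⟩
          ∑ V (λ z → α a z * S′ z + (o z + special z))
            ≡⟨ trans (∑-+ V (λ z → α a z * S′ z) (λ z → o z + special z)) (cong (∑ V (λ z → α a z * S′ z) +_) (∑-+ V o special)) ⟩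
          ∑ V (λ z → α a z * S′ z) + (∑ V o + ∑ V special)
            ≤⟨ +-monoʳ-≤ (∑ V (λ z → α a z * S′ z)) (+-monoʳ-≤ (∑ V o) special-total) ⟩
          ∑ V (λ z → α a z * S′ z) + (∑ V o + 2) ∎
          where open ≤-Reasoning

        A-to-B : ∀ a → A a → n ≤ 64 * ∑ V (λ z → α a z * 𝟙 (B? z))
        A-to-B a ((a∈ , s) , _) = remains {to₂ a} {∑ V (λ z → α a z * 𝟙 (B? z))} {∑ V odd₂} (rich₁ a a∈ s)
          (spread a (λ z → 𝟙 (S₂? z)) (λ z → 𝟙 (B? z)) odd₂ case-B) (few-odd {∑ V odd₂} odd₂-total)

        B-to-A : ∀ b → B b → n ≤ 64 * ∑ V (λ z → α b z * 𝟙 (A? z))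
        B-to-A b ((b∈ , s) , _) = remains {to₁ b} {∑ V (λ z → α b z * 𝟙 (A? z))} {∑ V odd₁} (rich₂ b b∈ s)
          (spread b (λ z → 𝟙 (S₁? z)) (λ z → 𝟙 (A? z)) odd₁ case-A) (few-odd {∑ V odd₁} odd₁-total)

        -- `y` has at least n/16 neighbours on the other side, of which `a` misses at most n/64.
        from : ∀ y → y ∈ V → S₁ y → ∀ a → A a → Dense 64 1 y a
        from y y∈ s a (_ , typical , _) = by-adding (+-mono-≤ (+-mono-≤ (*-monoʳ-≤ 4 (rich₁ y y∈ s)) (*-monoʳ-≤ 64 split)) typical) (2 * n) (identity n (to₂ y) (w 1 y a) (miss₂ a))
          where
          split : to₂ y ≤ w 1 y a + miss₂ a
          split = ≤-trans (∑-mono V λ z → each z) (≤-reflexive (∑-+ V (λ z → α y z * α z a) (λ z → 𝟙 (S₂? z) * missing a z)))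
            where
            go : ∀ {P : Set} α′ (s : Dec P) {z} (d : Dec (Adj a z)) → α′ ≤ 1 → α′ * 𝟙 s ≤ α′ * 𝟙 d + 𝟙 s * 𝟙 (¬? d)
            go α′ s (yes _) _ = ≤-trans (*-monoʳ-≤ α′ (𝟙≤1 s)) (m≤m+n (α′ * 1) (𝟙 s * 0))
            go α′ s (no _) α′≤1 = ≤-trans (≤-trans (*-monoˡ-≤ (𝟙 s) α′≤1) (≤-reflexive (*-comm 1 (𝟙 s)))) (m≤n+m (𝟙 s * 1) (α′ * 0))
            each : ∀ z → α y z * 𝟙 (S₂? z) ≤ α y z * α z a + 𝟙 (S₂? z) * missing a z
            each z = ≤-trans (go (α y z) (S₂? z) {z} (adj? a z) (α≤1 y z))
              (+-monoˡ-≤ (𝟙 (S₂? z) * missing a z) (*-monoʳ-≤ (α y z) (≤-reflexive (α-sym a z))))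
          identity : ∀ n g w m → n * 1 + (4 * (16 * g) + 64 * (w + m) + n) + 2 * n ≡ 64 * w + (4 * n + 64 * g + 64 * m)
          identity = solve-∀

        between : ∀ b b′ → B b → B b′ → Dense 64 1 b b′
        between b b′ ((b∈ , s) , typical , _) (_ , typical′ , _) =
          by-adding (+-mono-≤ (+-mono-≤ (*-monoʳ-≤ 4 (rich₂ b b∈ s)) (*-monoʳ-≤ 64 split)) (+-mono-≤ typical typical′)) n
            (identity n (to₁ b) (w 1 b b′) (miss₁ b) (miss₁ b′))
          where
          split : to₁ b ≤ w 1 b b′ + (miss₁ b + miss₁ b′)
          split = ≤-trans (∑-mono V λ z → each z) (≤-reflexive (trans (∑-+ V (λ z → α b z * α z b′) (λ z → 𝟙 (S₁? z) * missing b z + 𝟙 (S₁? z) * missing b′ z))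
                    (cong (w 1 b b′ +_) (∑-+ V (λ z → 𝟙 (S₁? z) * missing b z) (λ z → 𝟙 (S₁? z) * missing b′ z)))))
            where
            go : ∀ {P : Set} α′ (s : Dec P) {z} (d : Dec (Adj b′ z)) → α′ ≤ 1 → α′ * 𝟙 s ≤ α′ * 𝟙 d + 𝟙 s * 𝟙 (¬? d)
            go α′ s (yes _) _ = ≤-trans (*-monoʳ-≤ α′ (𝟙≤1 s)) (m≤m+n (α′ * 1) (𝟙 s * 0))
            go α′ s (no _) α′≤1 = ≤-trans (≤-trans (*-monoˡ-≤ (𝟙 s) α′≤1) (≤-reflexive (*-comm 1 (𝟙 s)))) (m≤n+m (𝟙 s * 1) (α′ * 0))
            each : ∀ z → α b z * 𝟙 (S₁? z) ≤ α b z * α z b′ + (𝟙 (S₁? z) * missing b z + 𝟙 (S₁? z) * missing b′ z)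
            each z = ≤-trans (go (α b z) (S₁? z) {z} (adj? b′ z) (α≤1 b z))
              (+-mono-≤ (*-monoʳ-≤ (α b z) (≤-reflexive (α-sym b′ z))) (m≤n+m _ (𝟙 (S₁? z) * missing b z)))
          identity : ∀ n g w m m′ → n * 1 + (4 * (16 * g) + 64 * (w + (m + m′)) + (n + n)) + n ≡ 64 * w + (4 * n + 64 * g + (64 * m + 64 * m′))
          identity = solve-∀

        distinct : ∀ {a b a′ b′} → A a → B b → A a′ → B b′ → Adj a b → Adj a′ b′ → ¬ (a ≡ a′ × b ≡ b′) → colour a b ≢ colour a′ b′
        distinct = distinct-colours A? B? A-to-B B-to-A large xx′ (from x x∈ x∈S₁) (from x′ x′∈ x′∈S₁) between
          (λ a (_ , _ , a≢) → a≢) (λ b (_ , _ , b≢) → b≢) (λ { a b ((_ , s) , _) ((_ , s′) , _) refl → S₁-S₂ s s′ })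

        τ : Pair → ℕ
        τ (a , b) = α a b * (𝟙 (A? a) * 𝟙 (B? b))

        τ-total : ∑ P τ ≤ 2 * f
        τ-total = ≤-trans (items-vs-colours τ (λ (a , b) → *-mono-≤ (α≤1 a b) (*-mono-≤ (𝟙≤1 (A? a)) (𝟙≤1 (B? b)))))
          (≤-reflexive (trans (cong (2 * f +_) (trans (∑-cong P λ e → trans (∑-cong P (clash e)) (∑-zero P)) (∑-zero P))) (+-identityʳ (2 * f))))
          where
          clash : ∀ e e′ → τ e * τ e′ * (𝟙 (χ e Fin.≟ χ e′) * 𝟙 (¬? (e ~? e′))) ≡ 0
          clash (a , b) (a′ , b′) = go (adj? a b) (A? a) (B? b) (adj? a′ b′) (A? a′) (B? b′) (colour a b Fin.≟ colour a′ b′) ((a , b) ~? (a′ , b′))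
            where
            go : (p₁ : Dec (Adj a b)) (p₂ : Dec (A a)) (p₃ : Dec (B b)) (q₁ : Dec (Adj a′ b′)) (q₂ : Dec (A a′)) (q₃ : Dec (B b′))
                 (s : Dec (colour a b ≡ colour a′ b′)) (t : Dec ((a , b) ~ (a′ , b′))) →
                 𝟙 p₁ * (𝟙 p₂ * 𝟙 p₃) * (𝟙 q₁ * (𝟙 q₂ * 𝟙 q₃)) * (𝟙 s * 𝟙 (¬? t)) ≡ 0
            go (no _)  _       _       _       _       _       _       _ = refl
            go (yes _) (no _)  _       _       _       _       _       _ = refl
            go (yes _) (yes _) (no _)  _       _       _       _       _ = refl
            go (yes _) (yes _) (yes _) (no _)  _       _       _       _ = refl
            go (yes _) (yes _) (yes _) (yes _) (no _)  _       _       _ = refl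
            go (yes _) (yes _) (yes _) (yes _) (yes _) (no _)  _       _ = refl
            go (yes _) (yes _) (yes _) (yes _) (yes _) (yes _) (no _)  _ = refl
            go (yes _) (yes _) (yes _) (yes _) (yes _) (yes _) (yes _) (yes _) = refl
            go (yes ab) (yes a∈) (yes b∈) (yes ab′) (yes a′∈) (yes b′∈) (yes same) (no differ) =
              contradiction same (distinct a∈ b∈ a′∈ b′∈ ab ab′ (differ ∘ inj₁))

        e≤ : e ≤ 2 * f + (n * (∑ V odd₁ + 2) + n * (∑ V odd₂ + 2))
        e≤ = begin
          e
            ≡⟨ ∑-cong V (λ a → sym (∑-*ˡ V (𝟙 (S₁? a)) (λ z → α a z * 𝟙 (S₂? z)))) ⟩
          ∑ V (λ a → ∑ V λ b → 𝟙 (S₁? a) * (α a b * 𝟙 (S₂? b)))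
            ≤⟨ ∑-mono∈ V (λ a a∈ → ∑-mono∈ V λ b b∈ → each a b (case-A a a∈) (case-B b b∈)) ⟩
          ∑ V (λ a → ∑ V λ b → τ (a , b) + ((odd₁ a + special a) + (odd₂ b + special b)))
            ≡⟨ trans (∑-cong V λ a → trans (∑-+ V (λ b → τ (a , b)) (λ b → (odd₁ a + special a) + (odd₂ b + special b)))
                 (cong (∑ V (λ b → τ (a , b)) +_) (trans (∑-+ V (λ _ → odd₁ a + special a) (λ b → odd₂ b + special b)) (cong (_+ rest₂) (∑-const V (odd₁ a + special a))))))
                 (trans (∑-+ V (λ a → ∑ V λ b → τ (a , b)) (λ a → n * (odd₁ a + special a) + rest₂))
                   (cong (∑ V (λ a → ∑ V λ b → τ (a , b)) +_) (trans (∑-+ V (λ a → n * (odd₁ a + special a)) (λ _ → rest₂))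
                     (cong₂ _+_ (∑-*ˡ V n (λ a → odd₁ a + special a)) (∑-const V rest₂))))) ⟩
          ∑ V (λ a → ∑ V λ b → τ (a , b)) + (n * rest₁ + n * rest₂)
            ≤⟨ +-mono-≤ (≤-trans (≤-reflexive (sym (∑-pairs V V τ))) τ-total) (+-mono-≤ (*-monoʳ-≤ n (rest≤ odd₁)) (*-monoʳ-≤ n (rest≤ odd₂))) ⟩
          2 * f + (n * (∑ V odd₁ + 2) + n * (∑ V odd₂ + 2)) ∎
          where
          open ≤-Reasoning
          rest₁ = ∑ V λ a → odd₁ a + special a
          rest₂ = ∑ V λ b → odd₂ b + special b
          rest≤ : ∀ o → ∑ V (λ a → o a + special a) ≤ ∑ V o + 2
          rest≤ o = ≤-trans (≤-reflexive (∑-+ V o special)) (+-monoʳ-≤ (∑ V o) special-total)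
          combine : ∀ s α A o s′ B o′ → s ≤ A + o → s′ ≤ B + o′ → α ≤ 1 → s ≤ 1 → B ≤ 1 → s * (α * s′) ≤ α * (A * B) + (o + o′)
          combine s α A o s′ B o′ s≤ s′≤ α≤1 s≤1 B≤1 = begin
            s * (α * s′)                          ≤⟨ *-monoʳ-≤ s (*-monoʳ-≤ α s′≤) ⟩
            s * (α * (B + o′))                    ≡⟨ split s α B o′ ⟩
            s * (α * B) + s * α * o′              ≤⟨ +-mono-≤ (*-monoˡ-≤ (α * B) s≤) (*-monoˡ-≤ o′ (*-mono-≤ s≤1 α≤1)) ⟩
            (A + o) * (α * B) + 1 * o′            ≡⟨ split′ A o α B o′ ⟩
            α * (A * B) + (o * (α * B) + o′)      ≤⟨ +-monoʳ-≤ (α * (A * B)) (+-monoˡ-≤ o′ (≤-trans (*-monoʳ-≤ o (*-mono-≤ α≤1 B≤1)) (≤-reflexive (*-identityʳ o)))) ⟩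
            α * (A * B) + (o + o′)                ∎
            where
            split : ∀ s α B o → s * (α * (B + o)) ≡ s * (α * B) + s * α * o
            split = solve-∀
            split′ : ∀ A o α B o′ → (A + o) * (α * B) + 1 * o′ ≡ α * (A * B) + (o * (α * B) + o′)
            split′ = solve-∀
          each : ∀ a b → 𝟙 (S₁? a) ≤ 𝟙 (A? a) + (odd₁ a + special a) → 𝟙 (S₂? b) ≤ 𝟙 (B? b) + (odd₂ b + special b) →
                 𝟙 (S₁? a) * (α a b * 𝟙 (S₂? b)) ≤ τ (a , b) + ((odd₁ a + special a) + (odd₂ b + special b))
          each a b le le′ = combine (𝟙 (S₁? a)) (α a b) (𝟙 (A? a)) (odd₁ a + special a) (𝟙 (S₂? b)) (𝟙 (B? b)) (odd₂ b + special b)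
                              le le′ (α≤1 a b) (𝟙≤1 (S₁? a)) (𝟙≤1 (B? b))

      -- There are about n²/4 edges across the cut and only n²/8 colours are wanted, so the factor 2
      -- lost in `items-vs-colours` is affordable. The constant is 175 + 8 · 2816 + 1, the last term
      -- for the two removed vertices.
      many-colours : D * (n * n) ≤ 8 * (D * f) + 22704 * (n * n)
      many-colours = by-adding
        (+-mono-≤ (+-mono-≤ many-edges (*-monoʳ-≤ (4 * D) e≤)) (+-mono-≤ (*-monoʳ-≤ (4 * n) (+-mono-≤ odd₁-total odd₂-total)) (*-monoʳ-≤ n 16D≤n))) 0
        (identity D n e f (∑ V odd₁) (∑ V odd₂))
        where
        identity : ∀ D n e f o₁ o₂ →
          D * (n * n) + (4 * (D * e) + 175 * (n * n) + 4 * D * (2 * f + (n * (o₁ + 2) + n * (o₂ + 2))) + (4 * n * (2816 * n + 2816 * n) + n * n)) + 0 ≡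
          8 * (D * f) + 22704 * (n * n) + (D * (n * n) + 4 * D * e + (4 * n * (D * o₁ + D * o₂) + n * (16 * D)))
        identity = solve-∀

  -- If a and b have many common neighbours, all degrees are almost n/2 and there are few walks of length 3 from a to b,
  -- then N(a) is almost independent of size almost n/2, so the graph is almost complete bipartite between N(a) and the rest.
  record Twins : Set where
    field
      {D q κ} : ℕ
      {a b}   : Fin N
      D-large : 64 * 2816 ≤ D
      128≤n   : 128 ≤ n
      16D≤n   : 16 * D ≤ n
      large-n : ladder 64 (suc j) * K < n
      min     : ∀ x → x ∈ V → q ≤ deg x
      Dn≤     : D * n ≤ 2 * (D * q) + n
      many    : n * n < 2 * E
      a∈      : a ∈ V
      b∈      : b ∈ V
      1≤κ     : 1 ≤ κ
      common  : n ≤ κ * w 1 a b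
      few     : 2 * (κ * D) * w 2 a b ≤ n * n

  module _ (𝒯 : Twins) where
    open Twins 𝒯

    private
      open ≤-Reasoning

      0<n : 0 < n
      0<n = ≤-trans (s≤s z≤n) 128≤n

      instance
        n≢0 : ℕ.NonZero n
        n≢0 = ℕ.>-nonZero 0<n
        κ≢0 : ℕ.NonZero κ
        κ≢0 = ℕ.>-nonZero 1≤κ
        D≢0 : ℕ.NonZero D
        D≢0 = ℕ.>-nonZero (≤-trans (s≤s z≤n) D-large)

      D≥ : ∀ k → k ≤ 64 * 2816 → k ≤ D
      D≥ k le = ≤-trans le D-large

      y r W₂ : ℕ
      y = deg a
      r = ∑ V λ z → α a z * 𝟙 (¬? (adj? b z))
      W₂ = w 2 a a

      y≤n : y ≤ n
      y≤n = deg≤n a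

      q≤y : q ≤ y
      q≤y = min a a∈

      few-D : D * w 2 a b ≤ n * n
      few-D = ≤-trans (*-monoˡ-≤ (w 2 a b) (≤-trans (m≤n*m D κ) (m≤n*m (κ * D) 2))) few

      -- An average over the common neighbours x of `a` and `b`: a path of length 2 from x back to
      -- `a` or `b` completes a walk of length 3 between `a` and `b`, and these are few.
      witness : ∃ λ x → x ∈ V × 0 < α a x * α x b × D * (w 1 x a + w 1 x b) ≤ n
      witness = pigeonhole-low V (λ x → α a x * α x b) (λ x → D * (w 1 x a + w 1 x b)) n positive
        (*-cancelˡ-≤ κ (begin
          κ * ∑ V (λ x → α a x * α x b * (D * (w 1 x a + w 1 x b)))
            ≤⟨ *-monoʳ-≤ κ (≤-trans (∑-mono V each) (≤-reflexive (trans (∑-*ˡ V D _) (cong (D *_) (trans (∑-+ V _ _) (cong₂ _+_ (sym (w-compose 1 0 a b)) refl)))))) ⟩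
          κ * (D * (w 2 a b + w 2 a b))
            ≡⟨ reorder κ D (w 2 a b) ⟩
          2 * (κ * D) * w 2 a b
            ≤⟨ few ⟩
          n * n
            ≤⟨ *-monoʳ-≤ n common ⟩
          n * (κ * w 1 a b)
            ≡⟨ swap n κ (w 1 a b) ⟩
          κ * (n * w 1 a b) ∎))
        where
        reorder : ∀ κ D w → κ * (D * (w + w)) ≡ 2 * (κ * D) * w
        reorder = solve-∀
        swap : ∀ a b c → a * (b * c) ≡ b * (a * c)
        swap = solve-∀
        positive : 0 < w 1 a b
        positive = *-cancelˡ-< κ 0 _ (≤-<-trans (≤-reflexive (*-zeroʳ κ)) (≤-trans 0<n common))
        each : ∀ x → α a x * α x b * (D * (w 1 x a + w 1 x b)) ≤ D * (w 1 a x * α x b + α a x * w 1 x b)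
        each x = ≤-trans (≤-reflexive (trans (expand (α a x) (α x b) D (w 1 x a) (w 1 x b)) (cong (λ t → D * (α a x * (t * α x b) + α x b * (α a x * w 1 x b))) (w-sym 1 x a))))
                   (*-monoʳ-≤ D (+-mono-≤ (α-drop a x _) (α-drop x b _)))
          where
          expand : ∀ p q D s t → p * q * (D * (s + t)) ≡ D * (p * (s * q) + q * (p * t))
          expand = solve-∀

      -- For the witness x, the set N(x) is almost disjoint from N(a) ∪ N(b). As N(x) and N(b) each
      -- have almost n/2 vertices, hardly any vertex is left for N(a) outside N(b).
      Dr≤ : D * r ≤ 2 * n
      Dr≤ = go witness
        where
        go : (∃ λ x → x ∈ V × 0 < α a x * α x b × D * (w 1 x a + w 1 x b) ≤ n) → D * r ≤ 2 * n
        go (x , x∈ , _ , small) = by-adding (+-mono-≤ (+-mono-≤ (*-monoʳ-≤ D (≤-trans (+-monoˡ-≤ r (+-mono-≤ (min x x∈) (min b b∈))) union)) small) Dn≤) 0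
            (identity D q r n (w 1 x a + w 1 x b))
          where
          identity : ∀ D q r n s → D * r + (D * (n + s) + n + (2 * (D * q) + n)) + 0 ≡ 2 * n + (D * (q + q + r) + D * s + D * n)
          identity = solve-∀
          union : deg x + deg b + r ≤ n + (w 1 x a + w 1 x b)
          union = begin
            deg x + deg b + r
              ≡⟨ trans (cong (_+ r) (sym (∑-+ V (α x) (α b)))) (sym (∑-+ V (λ z → α x z + α b z) (λ z → α a z * 𝟙 (¬? (adj? b z))))) ⟩
            ∑ V (λ z → α x z + α b z + α a z * 𝟙 (¬? (adj? b z)))
              ≤⟨ ∑-mono V each ⟩
            ∑ V (λ z → 1 + (α x z * α z a + α x z * α z b))
              ≡⟨ trans (∑-+ V (λ _ → 1) _) (cong₂ _+_ (trans (∑-const V 1) (*-identityʳ n)) (∑-+ V (λ z → α x z * α z a) (λ z → α x z * α z b))) ⟩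
            n + (w 1 x a + w 1 x b) ∎
            where
            pointwise : ∀ {X Y Z : Set} (p : Dec X) (p′ : Dec Y) (p″ : Dec Z) → 𝟙 p + 𝟙 p′ + 𝟙 p″ * 𝟙 (¬? p′) ≤ 1 + (𝟙 p * 𝟙 p″ + 𝟙 p * 𝟙 p′)
            pointwise (yes _) (yes _) (yes _) = s≤s (s≤s z≤n)
            pointwise (yes _) (yes _) (no _)  = ≤-refl
            pointwise (yes _) (no _)  (yes _) = ≤-refl
            pointwise (yes _) (no _)  (no _)  = ≤-refl
            pointwise (no _)  (yes _) (yes _) = ≤-refl
            pointwise (no _)  (yes _) (no _)  = ≤-refl
            pointwise (no _)  (no _)  (yes _) = ≤-refl
            pointwise (no _)  (no _)  (no _)  = z≤n
            each : ∀ z → α x z + α b z + α a z * 𝟙 (¬? (adj? b z)) ≤ 1 + (α x z * α z a + α x z * α z b)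
            each z = ≤-trans (pointwise (adj? x z) (adj? b z) (adj? a z))
              (≤-reflexive (cong₂ (λ s t → 1 + (α x z * s + α x z * t)) (α-sym a z) (α-sym b z)))

      -- `W₂` counts the ordered edges inside N(a). Since N(a) almost lies in N(b), such an edge
      -- completes a walk of length 3 from `a` to `b`, except for at most `n * r` cases.
      DW₂≤ : D * W₂ ≤ 3 * (n * n)
      DW₂≤ = by-adding (+-mono-≤ (*-monoʳ-≤ D W₂≤) (+-mono-≤ few-D (*-monoʳ-≤ n Dr≤))) 0 (identity D W₂ (w 2 a b) n r)
        where
        identity : ∀ D W w n r → D * W + (D * (w + n * r) + (n * n + n * (2 * n))) + 0 ≡ 3 * (n * n) + (D * W + (D * w + n * (D * r)))
        identity = solve-∀
        W₂≤ : W₂ ≤ w 2 a b + n * r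
        W₂≤ = begin
          ∑ V (λ x → α a x * w 1 x a)
            ≤⟨ ∑-mono V (λ x → ≤-trans (*-monoʳ-≤ (α a x) (inner x)) (≤-trans (≤-reflexive (*-distribˡ-+ (α a x) (w 1 x b) r)) (+-monoʳ-≤ (α a x * w 1 x b) (α-drop a x r)))) ⟩
          ∑ V (λ x → α a x * w 1 x b + r)
            ≡⟨ trans (∑-+ V (λ x → α a x * w 1 x b) (λ _ → r)) (cong (w 2 a b +_) (∑-const V r)) ⟩
          w 2 a b + n * r ∎
          where
          pointwise : ∀ x {X Y : Set} (p : Dec X) (p′ : Dec Y) → x ≤ 1 → x * 𝟙 p ≤ x * 𝟙 p′ + 𝟙 p * 𝟙 (¬? p′)
          pointwise x p (yes _) _   = ≤-trans (*-monoʳ-≤ x (𝟙≤1 p)) (m≤m+n (x * 1) (𝟙 p * 0))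
          pointwise x p (no _)  x≤1 = ≤-trans (*-monoˡ-≤ (𝟙 p) x≤1) (≤-trans (≤-reflexive (*-comm 1 (𝟙 p))) (m≤n+m (𝟙 p * 1) (x * 0)))
          inner : ∀ x → w 1 x a ≤ w 1 x b + r
          inner x = ≤-trans (∑-mono V λ z → ≤-trans (≤-reflexive (cong (α x z *_) (α-sym z a)))
                       (≤-trans (pointwise (α x z) (adj? a z) (adj? b z) (α≤1 x z)) (≤-reflexive (cong (λ t → α x z * t + α a z * 𝟙 (¬? (adj? b z))) (α-sym b z)))))
                      (≤-reflexive (∑-+ V (λ z → α x z * α z b) (λ z → α a z * 𝟙 (¬? (adj? b z)))))

      -- The sides are defined by the number of neighbours in N(a): `S′` is almost N(a) and `S`
      -- almost its complement. Unlike N(a) itself, this cut gives every vertex many neighbours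
      -- across.
      S S′ : Fin N → Set
      S x = n ≤ 8 * w 1 x a
      S′ x = ¬ S x

      S? : ∀ x → Dec (S x)
      S? x = n ℕ.≤? 8 * w 1 x a

      S′? : ∀ x → Dec (S′ x)
      S′? x = ¬? (S? x)

      σ σ′ out : Fin N → ℕ
      σ x = 𝟙 (S? x)
      σ′ x = 𝟙 (S′? x)
      out x = 𝟙 (¬? (adj? a x))

      YS ZS ZS′ : ℕ
      YS = ∑ V λ x → α a x * σ x
      ZS = ∑ V λ x → out x * σ x
      ZS′ = ∑ V λ x → out x * σ′ x

      DYS≤ : D * YS ≤ 24 * n
      DYS≤ = *-cancelˡ-≤ n (begin
        n * (D * YS)                                  ≡⟨ swap n D YS ⟩
        D * (n * YS)                                  ≡⟨ cong (D *_) (∑-*ˡ V n (λ x → α a x * σ x)) ⟨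
        D * ∑ V (λ x → n * (α a x * σ x))             ≤⟨ *-monoʳ-≤ D (∑-mono V each) ⟩
        D * ∑ V (λ x → 8 * (α a x * w 1 x a))         ≡⟨ cong (D *_) (∑-*ˡ V 8 (λ x → α a x * w 1 x a)) ⟩
        D * (8 * W₂)                                  ≡⟨ swap D 8 W₂ ⟩
        8 * (D * W₂)                                  ≤⟨ *-monoʳ-≤ 8 DW₂≤ ⟩
        8 * (3 * (n * n))                             ≡⟨ rearrange n ⟩
        n * (24 * n)                                  ∎)
        where
        swap : ∀ a b c → a * (b * c) ≡ b * (a * c)
        swap = solve-∀
        rearrange : ∀ n → 8 * (3 * (n * n)) ≡ n * (24 * n)
        rearrange = solve-∀
        each : ∀ x → n * (α a x * σ x) ≤ 8 * (α a x * w 1 x a)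
        each x = go (S? x)
          where
          go : (s : Dec (S x)) → n * (α a x * 𝟙 s) ≤ 8 * (α a x * w 1 x a)
          go (no _)  = ≤-trans (≤-reflexive (trans (cong (n *_) (*-zeroʳ (α a x))) (*-zeroʳ n))) z≤n
          go (yes s) = ≤-trans (≤-reflexive (swap′ n (α a x))) (≤-trans (*-monoʳ-≤ (α a x) s) (≤-reflexive (swap (α a x) 8 (w 1 x a))))
            where
            swap′ : ∀ n α → n * (α * 1) ≡ α * n
            swap′ = solve-∀

      partition : y + (ZS + ZS′) ≡ n
      partition = trans (cong (y +_) (sym (∑-+ V (λ x → out x * σ x) (λ x → out x * σ′ x))))
        (trans (sym (∑-+ V (α a) (λ x → out x * σ x + out x * σ′ x))) (trans (∑-cong V λ x → go (adj? a x) (S? x)) (trans (∑-const V 1) (*-identityʳ n))))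
        where
        go : ∀ {X Y : Set} (p : Dec X) (s : Dec Y) → 𝟙 p + (𝟙 (¬? p) * 𝟙 s + 𝟙 (¬? p) * 𝟙 (¬? s)) ≡ 1
        go (yes _) _       = refl
        go (no _)  (yes _) = refl
        go (no _)  (no _)  = refl

      3n≤8q : 3 * n ≤ 8 * q
      3n≤8q = *-cancelˡ-≤ D (by-adding (+-mono-≤ (*-monoʳ-≤ 4 Dn≤) (*-monoˡ-≤ n (D≥ 4 (s≤s (s≤s (s≤s (s≤s z≤n))))))) 0 (identity D n q))
        where
        identity : ∀ D n q → D * (3 * n) + (4 * (2 * (D * q) + n) + D * n) + 0 ≡ D * (8 * q) + (4 * (D * n) + 4 * n)
        identity = solve-∀

      out-degrees : ∑ V (λ z → α a z * deg z) ≡ ∑ V (λ x → w 1 x a)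
      out-degrees = trans (∑-cong V λ z → trans (sym (∑-*ˡ V (α a z) (α z))) (∑-cong V λ x → trans (*-comm (α a z) (α z x)) (cong₂ _*_ (α-sym z x) (α-sym a z)))) (∑-swap V V _)

      yq≤ : y * q ≤ ∑ V (λ z → α a z * deg z)
      yq≤ = ≤-trans (≤-reflexive (sym (∑-*ʳ V q (α a)))) (∑-mono∈ V λ z z∈ → *-monoʳ-≤ (α a z) (min z z∈))

      -- Count the edges leaving N(a): y vertices of degree at least q send at least yq, while a
      -- vertex of N(a) absorbs few in total, one of `S` outside at most y, and one counted by `ZS′`
      -- fewer than n/8. As y and q are almost n/2, each of the latter leaves a deficit of about
      -- n/4.
      DZS′≤ : D * ZS′ ≤ 16 * n
      DZS′≤ = *-cancelˡ-≤ (2 * n) {{m*n≢0 2 n}} (by-adding (+-mono-≤ (+-mono-≤ (*-monoʳ-≤ D upper) (*-monoʳ-≤ 8 DW₂≤))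
                (+-mono-≤ (*-monoʳ-≤ (8 * y) (≤-trans Dn≤ (+-monoˡ-≤ n (+-mono-≤ (≤-refl {D * q}) (+-monoˡ-≤ 0 (*-monoʳ-≤ D q≤y))))))
                          (+-mono-≤ (*-monoˡ-≤ (D * ZS′) 3n≤8y) (*-monoʳ-≤ (8 * n) y≤n)))) 0
                (identity D W₂ y q ZS ZS′ n (sym partition)))
        where
        3n≤8y : 3 * n ≤ 8 * y
        3n≤8y = ≤-trans 3n≤8q (*-monoʳ-≤ 8 q≤y)
        identity : ∀ D W y q s s′ n → n ≡ y + (s + s′) →
          2 * n * (D * s′) + (D * (8 * W + 8 * y * s + n * s′) + 8 * (3 * (n * n)) + (8 * y * (D * q + (D * y + 0) + n) + (8 * y * (D * s′) + 8 * n * n))) + 0 ≡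
          2 * n * (16 * n) + (D * (8 * (y * q)) + 8 * (D * W) + (8 * y * (D * n) + (3 * n * (D * s′) + 8 * n * y)))
        identity D W y q s s′ n refl = ring D W y q s s′
          where
          ring : ∀ D W y q s s′ →
            2 * (y + (s + s′)) * (D * s′) + (D * (8 * W + 8 * y * s + (y + (s + s′)) * s′) + 8 * (3 * ((y + (s + s′)) * (y + (s + s′)))) + (8 * y * (D * q + (D * y + 0) + (y + (s + s′))) + (8 * y * (D * s′) + 8 * (y + (s + s′)) * (y + (s + s′))))) + 0 ≡
            2 * (y + (s + s′)) * (16 * (y + (s + s′))) + (D * (8 * (y * q)) + 8 * (D * W) + (8 * y * (D * (y + (s + s′))) + (3 * (y + (s + s′)) * (D * s′) + 8 * (y + (s + s′)) * y)))
          ring = solve-∀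
        upper : 8 * (y * q) ≤ 8 * W₂ + 8 * y * ZS + n * ZS′
        upper = begin
          8 * (y * q)
            ≤⟨ *-monoʳ-≤ 8 (≤-trans yq≤ (≤-reflexive out-degrees)) ⟩
          8 * ∑ V (λ x → w 1 x a)
            ≡⟨ ∑-*ˡ V 8 (λ x → w 1 x a) ⟨
          ∑ V (λ x → 8 * w 1 x a)
            ≤⟨ ∑-mono V each ⟩
          ∑ V (λ x → 8 * (α a x * w 1 x a) + 8 * y * (out x * σ x) + n * (out x * σ′ x))
            ≡⟨ trans (∑-+ V (λ x → 8 * (α a x * w 1 x a) + 8 * y * (out x * σ x)) (λ x → n * (out x * σ′ x)))
                 (cong₂ _+_ (trans (∑-+ V (λ x → 8 * (α a x * w 1 x a)) (λ x → 8 * y * (out x * σ x))) (cong₂ _+_ (∑-*ˡ V 8 (λ x → α a x * w 1 x a)) (∑-*ˡ V (8 * y) (λ x → out x * σ x))))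
                            (∑-*ˡ V n (λ x → out x * σ′ x))) ⟩
          8 * W₂ + 8 * y * ZS + n * ZS′ ∎
          where
          each : ∀ x → 8 * w 1 x a ≤ 8 * (α a x * w 1 x a) + 8 * y * (out x * σ x) + n * (out x * σ′ x)
          each x = go (adj? a x) (S? x)
            where
            w≤y : w 1 x a ≤ y
            w≤y = ∑-mono V λ z → ≤-trans (α-drop x z (α z a)) (≤-reflexive (α-sym z a))
            go : (p : Dec (Adj a x)) (s : Dec (S x)) → 8 * w 1 x a ≤ 8 * (𝟙 p * w 1 x a) + 8 * y * (𝟙 (¬? p) * 𝟙 s) + n * (𝟙 (¬? p) * 𝟙 (¬? s))
            go (yes _) s       = ≤-trans (*-monoʳ-≤ 8 (≤-reflexive (sym (*-identityˡ (w 1 x a))))) (≤-trans (m≤m+n _ (8 * y * 0)) (m≤m+n _ (n * 0)))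
            go (no _)  (yes _) = ≤-trans (*-monoʳ-≤ 8 w≤y) (≤-trans (≤-reflexive (sym (*-identityʳ (8 * y)))) (m≤m+n _ (n * 0)))
            go (no _)  (no ¬s) = ≤-trans (<⇒≤ (≰⇒> ¬s)) (≤-trans (≤-reflexive (sym (*-identityʳ n))) (m≤n+m (n * 1) (8 * y * 0)))

      module PQ = Cut S? S′? (λ s s′ → s′ s)
      module QP = Cut S′? S? (λ s′ s → s′ s)
      open PQ using (missing; to₁; to₂; U; e; U-sym; e-sym)

      rich : ∀ x → x ∈ V → S x → n ≤ 16 * to₂ x
      rich x _ s = by-adding (+-mono-≤ (+-mono-≤ (*-monoʳ-≤ 2 s) (*-monoʳ-≤ 16 split)) 16YS≤) 0 (identity n (w 1 x a) (to₂ x) YS)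
        where
        identity : ∀ n w t y → n + (2 * (8 * w) + 16 * (t + y) + n) + 0 ≡ 16 * t + (2 * n + 16 * w + 16 * y)
        identity = solve-∀
        16YS≤ : 16 * YS ≤ n
        16YS≤ = *-cancelˡ-≤ {16 * YS} {n} 24 (≤-trans (≤-reflexive (rearrange YS)) (≤-trans (*-monoˡ-≤ YS (D≥ 384 (m≤m+n 384 179840))) DYS≤))
          where
          rearrange : ∀ y → 24 * (16 * y) ≡ 384 * y
          rearrange = solve-∀
        split : w 1 x a ≤ to₂ x + YS
        split = ≤-trans (∑-mono V λ z → ≤-trans (≤-reflexive (cong (α x z *_) (α-sym z a))) (go (α x z) (adj? a z) (S? z) (α≤1 x z)))
                  (≤-reflexive (∑-+ V (λ z → α x z * σ′ z) (λ z → α a z * σ z)))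
          where
          go : ∀ t {X Y : Set} (p : Dec X) (s : Dec Y) → t ≤ 1 → t * 𝟙 p ≤ t * 𝟙 (¬? s) + 𝟙 p * 𝟙 s
          go t p (yes _) t≤1 = ≤-trans (*-monoˡ-≤ (𝟙 p) t≤1) (≤-trans (≤-reflexive (*-comm 1 (𝟙 p))) (m≤n+m (𝟙 p * 1) (t * 0)))
          go t p (no _)  _   = ≤-trans (*-monoʳ-≤ t (𝟙≤1 p)) (m≤m+n (t * 1) (𝟙 p * 0))

      -- The degree is at least 3n/8, fewer than n/8 of it goes to N(a), and what goes elsewhere
      -- ends in `S` up to `ZS′` exceptions.
      rich′ : ∀ x → x ∈ V → S′ x → n ≤ 16 * to₁ x
      rich′ x x∈ ¬s = by-adding (+-mono-≤ (+-mono-≤ 3n≤8q (*-monoʳ-≤ 8 (≤-trans (min x x∈) split))) (+-mono-≤ (<⇒≤ (≰⇒> ¬s)) 8ZS′≤)) (8 * to₁ x)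
          (identity n q (w 1 x a) (to₁ x) ZS′)
        where
        identity : ∀ n q w t z → n + (8 * q + 8 * (w + t + z) + (n + n)) + 8 * t ≡ 16 * t + (3 * n + 8 * q + (8 * w + 8 * z))
        identity = solve-∀
        8ZS′≤ : 8 * ZS′ ≤ n
        8ZS′≤ = *-cancelˡ-≤ {8 * ZS′} {n} 16 (≤-trans (≤-reflexive (rearrange ZS′)) (≤-trans (*-monoˡ-≤ ZS′ (D≥ 128 (m≤m+n 128 180096))) DZS′≤))
          where
          rearrange : ∀ y → 16 * (8 * y) ≡ 128 * y
          rearrange = solve-∀
        split : deg x ≤ w 1 x a + to₁ x + ZS′
        split = ≤-trans (∑-mono V λ z → ≤-trans (go (α x z) (adj? a z) (S? z) (α≤1 x z)) (≤-reflexive (cong (λ t → α x z * t + α x z * σ z + out z * σ′ z) (α-sym a z))))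
                  (≤-reflexive (trans (∑-+ V (λ z → α x z * α z a + α x z * σ z) (λ z → out z * σ′ z)) (cong (_+ ZS′) (∑-+ V (λ z → α x z * α z a) (λ z → α x z * σ z)))))
          where
          go : ∀ t {X Y : Set} (p : Dec X) (s : Dec Y) → t ≤ 1 → t ≤ t * 𝟙 p + t * 𝟙 s + 𝟙 (¬? p) * 𝟙 (¬? s)
          go t (yes _) s       _   = ≤-trans (≤-reflexive (sym (*-identityʳ t))) (≤-trans (m≤m+n (t * 1) (t * 𝟙 s)) (m≤m+n _ 0))
          go t (no _)  (yes _) _   = ≤-trans (≤-trans (≤-reflexive (sym (*-identityʳ t))) (m≤n+m (t * 1) (t * 0))) (m≤m+n _ 0)
          go t (no _)  (no _)  t≤1 = ≤-trans t≤1 (m≤n+m 1 (t * 0 + t * 0))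

      joined apart : Fin N → ℕ
      joined z = ∑ V λ x → out x * α x z
      apart z = ∑ V λ x → out x * missing x z

      joined-split : ∀ z → joined z + w 1 z a ≡ deg z
      joined-split z = trans (sym (∑-+ V (λ x → out x * α x z) (λ x → α z x * α x a)))
        (∑-cong V λ x → trans (cong₂ (λ s t → out x * s + α z x * t) (α-sym x z) (α-sym x a)) (go (α z x) (adj? a x)))
        where
        go : ∀ t {X : Set} (p : Dec X) → 𝟙 (¬? p) * t + t * 𝟙 p ≡ t
        go t (yes _) = *-identityʳ t
        go t (no _)  = trans (cong₂ _+_ (*-identityˡ t) (*-zeroʳ t)) (+-identityʳ t)

      apart-split : ∀ z → apart z + y + joined z ≡ n
      apart-split z = trans (cong (_+ joined z) (sym (∑-+ V (λ x → out x * missing x z) (α a))))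
        (trans (sym (∑-+ V (λ x → out x * missing x z + α a x) (λ x → out x * α x z)))
          (trans (∑-cong V λ x → go (adj? a x) (adj? x z)) (trans (∑-const V 1) (*-identityʳ n))))
        where
        go : ∀ {X Y : Set} (p : Dec X) (s : Dec Y) → 𝟙 (¬? p) * 𝟙 (¬? s) + 𝟙 p + 𝟙 (¬? p) * 𝟙 s ≡ 1
        go (yes _) _       = refl
        go (no _)  (yes _) = refl
        go (no _)  (no _)  = refl

      L M : ℕ
      L = ∑ V λ z → α a z * joined z
      M = ∑ V λ z → α a z * apart z

      yq≤L : y * q ≤ L + W₂
      yq≤L = ≤-trans yq≤ (≤-reflexive (trans (∑-cong V λ z → trans (cong (α a z *_) (sym (joined-split z))) (*-distribˡ-+ (α a z) (joined z) (w 1 z a)))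
               (∑-+ V (λ z → α a z * joined z) (λ z → α a z * w 1 z a))))

      M-split : M + y * y + L ≡ y * n
      M-split = trans (cong₂ _+_ (cong (M +_) (sym (∑-*ʳ V y (α a)))) refl)
        (trans (cong (_+ L) (sym (∑-+ V (λ z → α a z * apart z) (λ z → α a z * y)))) (trans (sym (∑-+ V (λ z → α a z * apart z + α a z * y) (λ z → α a z * joined z)))
          (trans (∑-cong V λ z → trans (collect (α a z) (apart z) y (joined z)) (cong (α a z *_) (apart-split z))) (∑-*ʳ V n (α a)))))
        where
        collect : ∀ t p y s → t * p + t * y + t * s ≡ t * (p + y + s)
        collect = solve-∀

      S₂ : (Fin N → Fin N → ℕ) → ℕ
      S₂ g = ∑ V λ x → ∑ V (g x)

      exceptions : S₂ (λ x z → α a x * σ x + out z * σ′ z) ≡ n * YS + n * ZS′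
      exceptions = trans (∑-cong V λ x → trans (∑-+ V (λ _ → α a x * σ x) (λ z → out z * σ′ z)) (cong (_+ ZS′) (∑-const V (α a x * σ x))))
        (trans (∑-+ V (λ x → n * (α a x * σ x)) (λ _ → ZS′)) (cong₂ _+_ (∑-*ˡ V n (λ x → α a x * σ x)) (∑-const V ZS′)))

      U≤ : U ≤ M + (n * YS + n * ZS′)
      U≤ = begin
        U
          ≡⟨ ∑-cong V (λ x → sym (∑-*ˡ V (σ x) (λ z → σ′ z * missing x z))) ⟩
        S₂ (λ x z → σ x * (σ′ z * missing x z))
          ≤⟨ ∑-mono V (λ x → ∑-mono V λ z → each (adj? a x) (adj? a z) (S? x) (S? z) (missing x z) (𝟙≤1 (¬? (adj? x z)))) ⟩
        S₂ (λ x z → α a z * (out x * missing x z) + (α a x * σ x + out z * σ′ z))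
          ≡⟨ trans (∑-cong V λ x → ∑-+ V (λ z → α a z * (out x * missing x z)) (λ z → α a x * σ x + out z * σ′ z))
               (∑-+ V (λ x → ∑ V λ z → α a z * (out x * missing x z)) (λ x → ∑ V λ z → α a x * σ x + out z * σ′ z)) ⟩
        S₂ (λ x z → α a z * (out x * missing x z)) + S₂ (λ x z → α a x * σ x + out z * σ′ z)
          ≡⟨ cong₂ _+_ (trans (∑-swap V V (λ x z → α a z * (out x * missing x z))) (∑-cong V λ z → ∑-*ˡ V (α a z) (λ x → out x * missing x z))) exceptions ⟩
        M + (n * YS + n * ZS′) ∎
        where
        each : ∀ {X Z Y Y′ : Set} (p : Dec X) (p′ : Dec Z) (s : Dec Y) (s′ : Dec Y′) m → m ≤ 1 →
               𝟙 s * (𝟙 (¬? s′) * m) ≤ 𝟙 p′ * (𝟙 (¬? p) * m) + (𝟙 p * 𝟙 s + 𝟙 (¬? p′) * 𝟙 (¬? s′))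
        each p p′ (no _) s′ m _ = z≤n
        each p p′ (yes _) (yes _) m _ = z≤n
        each (yes _) p′ (yes _) (no _) m m≤1 = ≤-trans (≤-reflexive (drop m)) (≤-trans m≤1 (≤-trans (m≤m+n 1 _) (m≤n+m _ (𝟙 p′ * 0))))
          where
          drop : ∀ m → 1 * (1 * m) ≡ m
          drop = solve-∀
        each (no _) (no _) (yes _) (no _) m m≤1 = ≤-trans (≤-reflexive (drop m)) m≤1
          where
          drop : ∀ m → 1 * (1 * m) ≡ m
          drop = solve-∀
        each (no _) (yes _) (yes _) (no _) m _ = m≤m+n (1 * (1 * m)) 0

      -- Non-edges between N(a) and its complement number y(n - y) - L, which is small because L is
      -- at least yq - W₂ and q is almost n/2. The terms add up to 3 + 24 + 16 + 1 = 44.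
      few-missing : D * U ≤ 44 * (n * n)
      few-missing = by-adding
        (+-mono-≤ (+-mono-≤ (*-monoʳ-≤ D (+-mono-≤ U≤ (+-mono-≤ yq≤L (≤-reflexive M-split)))) (+-mono-≤ DW₂≤ (*-monoʳ-≤ n (+-mono-≤ DYS≤ DZS′≤))))
                  (+-mono-≤ (*-monoʳ-≤ y (≤-trans Dn≤ (+-monoˡ-≤ n (+-mono-≤ (≤-refl {D * q}) (+-monoˡ-≤ 0 (*-monoʳ-≤ D q≤y)))))) (*-monoʳ-≤ n y≤n)))
        0 (identity D U M n YS ZS′ y q L W₂)
        where
        identity : ∀ D U M n s s′ y q L W →
          D * U + (D * (M + (n * s + n * s′) + (L + W + y * n)) + (3 * (n * n) + n * (24 * n + 16 * n)) + (y * (D * q + (D * y + 0) + n) + n * n)) + 0 ≡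
          44 * (n * n) + (D * (U + (y * q + (M + y * y + L))) + (D * W + n * (D * s + D * s′)) + (y * (D * n) + n * y))
        identity = solve-∀

      L≤ : L ≤ e + (n * YS + n * ZS′)
      L≤ = begin
        L
          ≡⟨ trans (∑-cong V λ z → sym (∑-*ˡ V (α a z) (λ x → out x * α x z))) (∑-swap V V (λ z x → α a z * (out x * α x z))) ⟩
        S₂ (λ x z → α a z * (out x * α x z))
          ≤⟨ ∑-mono V (λ x → ∑-mono V λ z → each (adj? a x) (adj? a z) (S? x) (S? z) (α x z) (α≤1 x z)) ⟩
        S₂ (λ x z → σ x * (α x z * σ′ z) + (out x * σ′ x + α a z * σ z))
          ≡⟨ trans (∑-cong V λ x → ∑-+ V (λ z → σ x * (α x z * σ′ z)) (λ z → out x * σ′ x + α a z * σ z))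
               (∑-+ V (λ x → ∑ V λ z → σ x * (α x z * σ′ z)) (λ x → ∑ V λ z → out x * σ′ x + α a z * σ z)) ⟩
        S₂ (λ x z → σ x * (α x z * σ′ z)) + S₂ (λ x z → out x * σ′ x + α a z * σ z)
          ≡⟨ cong₂ _+_ (∑-cong V λ x → ∑-*ˡ V (σ x) (λ z → α x z * σ′ z))
               (trans (∑-swap V V (λ x z → out x * σ′ x + α a z * σ z)) (trans (∑-cong V λ z → ∑-cong V λ x → +-comm (out x * σ′ x) (α a z * σ z)) exceptions)) ⟩
        e + (n * YS + n * ZS′) ∎
        where
        each : ∀ {X Z Y Y′ : Set} (p : Dec X) (p′ : Dec Z) (s : Dec Y) (s′ : Dec Y′) t → t ≤ 1 →
               𝟙 p′ * (𝟙 (¬? p) * t) ≤ 𝟙 s * (t * 𝟙 (¬? s′)) + (𝟙 (¬? p) * 𝟙 (¬? s) + 𝟙 p′ * 𝟙 s′)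
        each p (no _) s s′ t _ = z≤n
        each (yes _) (yes _) s s′ t _ = z≤n
        each (no _) (yes _) (no _) s′ t t≤1 = ≤-trans (≤-reflexive (drop t)) (≤-trans t≤1 (m≤m+n 1 _))
          where
          drop : ∀ t → 1 * (1 * t) ≡ t
          drop = solve-∀
        each (no _) (yes _) (yes _) (yes _) t t≤1 = ≤-trans (≤-reflexive (drop t)) (≤-trans t≤1 (m≤n+m 1 (1 * (t * 0))))
          where
          drop : ∀ t → 1 * (1 * t) ≡ t
          drop = solve-∀
        each (no _) (yes _) (yes _) (no _) t _ = ≤-trans (≤-reflexive (cong (1 *_) (*-comm 1 t))) (m≤m+n (1 * (t * 1)) 0)

      -- L is at least q² - W₂ and hence about n²/4. The loss 175 is 4 · 3 + 4 · (24 + 16) + 3,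
      -- where the last 3 comes from replacing q by n/2.
      many-edges : D * (n * n) ≤ 4 * (D * e) + 175 * (n * n)
      many-edges = by-adding
        (+-mono-≤ (+-mono-≤ (*-monoʳ-≤ (4 * D) (+-mono-≤ (≤-trans (*-monoˡ-≤ q q≤y) yq≤L) L≤)) (+-mono-≤ (*-monoʳ-≤ 4 DW₂≤) (*-monoʳ-≤ (4 * n) (+-mono-≤ DYS≤ DZS′≤))))
                  (+-mono-≤ (+-mono-≤ (*-monoʳ-≤ n Dn≤) (*-monoʳ-≤ (2 * q) Dn≤)) (*-monoʳ-≤ (2 * n) (≤-trans q≤y y≤n))))
        0 (identity D n e q L W₂ YS ZS′)
        where
        identity : ∀ D n e q L W s s′ →
          D * (n * n) + (4 * D * (L + W + (e + (n * s + n * s′))) + (4 * (3 * (n * n)) + 4 * n * (24 * n + 16 * n)) + (n * (2 * (D * q) + n) + 2 * q * (2 * (D * q) + n) + 2 * n * n)) + 0 ≡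
          4 * (D * e) + 175 * (n * n) + (4 * D * (q * q + L) + (4 * (D * W) + 4 * n * (D * s + D * s′)) + (n * (D * n) + 2 * q * (D * n) + 2 * n * q))
        identity = solve-∀

      -- There are too many edges for a bipartite graph.
      inside : Fin N → Fin N → ℕ
      inside x z = α x z * (σ x * σ z + σ′ x * σ′ z)

      inner-edge : ∃ λ x → ∃ λ z → x ∈ V × z ∈ V × 0 < inside x z
      inner-edge =
        let x , x∈ , _ , 0<x = pigeonhole V (λ _ → 1) (λ x → ∑ V (inside x)) 0 (≤-trans positive (≤-reflexive (sym (∑-cong V λ x → *-identityˡ (∑ V (inside x))))))
            z , z∈ , _ , 0<z = pigeonhole V (λ _ → 1) (inside x) 0 (≤-trans 0<x (≤-reflexive (sym (∑-cong V λ z → *-identityˡ (inside x z)))))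
        in x , z , x∈ , z∈ , 0<z
        where
        s s′ : ℕ
        s = ∑ V σ
        s′ = ∑ V σ′
        s+s′ : s + s′ ≡ n
        s+s′ = trans (sym (∑-+ V σ σ′)) (trans (∑-cong V λ x → 𝟙-complement (S? x)) (trans (∑-const V 1) (*-identityʳ n)))
        E≤ : E ≤ S₂ inside + 2 * (s * s′)
        E≤ = begin
          E
            ≤⟨ ∑-mono V (λ x → ∑-mono V λ z → each (S? x) (S? z) (α x z) (α≤1 x z)) ⟩
          S₂ (λ x z → inside x z + (σ x * σ′ z + σ′ x * σ z))
            ≡⟨ trans (∑-cong V λ x → trans (∑-+ V (inside x) (λ z → σ x * σ′ z + σ′ x * σ z)) (cong (∑ V (inside x) +_) (∑-+ V (λ z → σ x * σ′ z) (λ z → σ′ x * σ z))))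
                 (trans (∑-+ V (λ x → ∑ V (inside x)) (λ x → ∑ V (λ z → σ x * σ′ z) + ∑ V (λ z → σ′ x * σ z)))
                   (cong (S₂ inside +_) (trans (∑-+ V (λ x → ∑ V (λ z → σ x * σ′ z)) (λ x → ∑ V (λ z → σ′ x * σ z))) (cong₂ _+_ (∑-product V V σ σ′) (∑-product V V σ′ σ))))) ⟩
          S₂ inside + (s * s′ + s′ * s)
            ≡⟨ cong (S₂ inside +_) (collect s s′) ⟩
          S₂ inside + 2 * (s * s′) ∎
          where
          collect : ∀ s s′ → s * s′ + s′ * s ≡ 2 * (s * s′)
          collect = solve-∀
          each : ∀ {Y Y′ : Set} (p : Dec Y) (p′ : Dec Y′) t → t ≤ 1 →
                 t ≤ t * (𝟙 p * 𝟙 p′ + 𝟙 (¬? p) * 𝟙 (¬? p′)) + (𝟙 p * 𝟙 (¬? p′) + 𝟙 (¬? p) * 𝟙 p′)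
          each (yes _) (yes _) t _   = ≤-trans (≤-reflexive (sym (*-identityʳ t))) (m≤m+n (t * 1) 0)
          each (no _)  (no _)  t _   = ≤-trans (≤-reflexive (sym (*-identityʳ t))) (m≤m+n (t * 1) 0)
          each (yes _) (no _)  t t≤1 = ≤-trans t≤1 (m≤n+m 1 (t * 0))
          each (no _)  (yes _) t t≤1 = ≤-trans t≤1 (m≤n+m 1 (t * 0))
        positive : 0 < S₂ inside
        positive = *-cancelˡ-< 2 0 (S₂ inside) (by-adding (+-mono-≤ (+-mono-≤ many (*-monoʳ-≤ 2 E≤)) (double-product s s′)) 0
          (trans (cong (λ ν → suc (2 * 0) + (2 * E + 2 * (S₂ inside + 2 * (s * s′)) + (s * s + s′ * s′)) + 0) s+s′)
            (trans (identity E (S₂ inside) s s′) (cong (λ ν → 2 * S₂ inside + (suc (ν * ν) + 2 * E + 2 * (s * s′))) s+s′))))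
          where
          identity : ∀ E I s s′ → suc (2 * 0) + (2 * E + 2 * (I + 2 * (s * s′)) + (s * s + s′ * s′)) + 0 ≡ 2 * I + (suc ((s + s′) * (s + s′)) + 2 * E + 2 * (s * s′))
          identity = solve-∀

    -- The inner edge may lie in either side, so the cut is used in both orientations.
    near-bipartite : D * (n * n) ≤ 8 * (D * f) + 22704 * (n * n)
    near-bipartite = go inner-edge
      where
      go : (∃ λ x → ∃ λ z → x ∈ V × z ∈ V × 0 < inside x z) → D * (n * n) ≤ 8 * (D * f) + 22704 * (n * n)
      go (x , z , x∈ , z∈ , pos) = side (adj? x z) (S? x) (S? z) pos
        where
        side : (p : Dec (Adj x z)) (s : Dec (S x)) (s′ : Dec (S z)) → 0 < 𝟙 p * (𝟙 s * 𝟙 s′ + 𝟙 (¬? s) * 𝟙 (¬? s′)) → D * (n * n) ≤ 8 * (D * f) + 22704 * (n * n)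
        side (yes xz) (yes s) (yes s′) _ = PQ.many-colours D-large 128≤n 16D≤n large-n rich rich′ few-missing many-edges x∈ z∈ s s′ xz
        side (yes xz) (no s) (no s′) _ = QP.many-colours D-large 128≤n 16D≤n large-n rich′ rich (subst (λ u → D * u ≤ 44 * (n * n)) U-sym few-missing)
          (subst (λ e → D * (n * n) ≤ 4 * (D * e) + 175 * (n * n)) e-sym many-edges) x∈ z∈ s s′ xz
        side (no _) _ _ ()
        side (yes _) (yes _) (no _) ()
        side (yes _) (no _) (yes _) ()

  -- Same-coloured edges

  open Constants j T R

  -- The robustness with `B₁`, `G₁` produces walks with three internal vertices in `balanced`; that
  -- with `B₂`, `G₂` makes the change of parity after padding. The degree bound feeds `class-size`.
  -- Everything is symmetric so that either end of an edge may play the role of `a`.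
  Good : Fin N → Fin N → Set
  Good a b = (a ∈ V × b ∈ V) × Adj a b × (n ≤ T * deg a × n ≤ T * deg b) ×
             (Robust B₁ G₁ a b × Robust B₁ G₁ b a) × (Robust B₂ G₂ a b × Robust B₂ G₂ b a)

  good? : ∀ a b → Dec (Good a b)
  good? a b = (a ∈? V ×-dec b ∈? V) ×-dec adj? a b ×-dec (n ℕ.≤? T * deg a ×-dec n ℕ.≤? T * deg b) ×-dec
              (robust? B₁ G₁ a b ×-dec robust? B₁ G₁ b a) ×-dec (robust? B₂ G₂ a b ×-dec robust? B₂ G₂ b a)

  Good-sym : ∀ {a b} → Good a b → Good b a
  Good-sym ((a∈ , b∈) , ab , (da , db) , (r₁ , r₁′) , (r₂ , r₂′)) =
    (b∈ , a∈) , Adj-sym ab , (db , da) , (r₁′ , r₁) , (r₂′ , r₂)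

  colour-sym : ∀ {a b} → Adj a b → colour a b ≡ colour b a
  colour-sym {a} {b} = colSym c a b

  1≤T^4 : 1 ≤ T ^ 4
  1≤T^4 = m^n>0 T {{ℕ.>-nonZero 1≤T}} 4

  T≤Q : T ≤ Q
  T≤Q = ≤-trans (m≤m^4 T) (m≤n*m (T ^ 4) 16)

  w1-diagonal : ∀ a → w 1 a a ≡ deg a
  w1-diagonal a = ∑-cong V square
    where
    square : ∀ z → α a z * α z a ≡ α a z
    square z = trans (cong (α a z *_) (α-sym z a)) (go (adj? a z))
      where
      go : (d : Dec (Adj a z)) → 𝟙 d * 𝟙 d ≡ 𝟙 d
      go (yes _) = refl
      go (no  _) = refl

  private
    large₂ : B₂ * G₂ * K < n
    large₂ = ≤-<-trans (*-monoˡ-≤ K (m≤m+n (B₂ * G₂) Q)) large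

    largeQ : Q * K < n
    largeQ = ≤-<-trans (*-monoˡ-≤ K (m≤n+m Q (B₂ * G₂))) large

  -- Walks a ⇝ d with three internal vertices are padded to 2j + 5 and shifted to b ⇝ d with 2j + 6;
  -- together with d - a - b they close to length 2j + 9.
  adjacent-edges : ∀ {a b d} → Good a b → Good a d → b ≢ d → colour a b ≡ colour a d → ¬ Dense H 3 a d
  adjacent-edges {a} {b} {d} (_ , ab , _ , _ , robust , _) (_ , ad , _) b≢d same dense =
    conflict {segs₁ = (3 + up (suc j) 1 , d) ∷ []} {segs₂ = []} (rich ∷ []) (Adj-sym ad) [] ab
      ((b≢d ∷ ≢-sym (Adj⇒≢ ab) ∷ []) ∷ (≢-sym (Adj⇒≢ ad) ∷ []) ∷ [] ∷ [])
      (trans (cong (λ l → 7 + (l + 0) + 1) (up≡ j 1)) (total j))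
      (trans (sym (colour-sym ab)) same)
    where
    rich : Rich (3 + up (suc j) 1) b d
    rich = dense⇒rich {B₂ * G₂} (2 + up (suc j) 1) large₂
             (shift {B₂} {G₂} {padded H (suc j)} (1 + up (suc j) 1) {a} {b} {d} robust ≤-refl (pads {H} (suc j) 1 {a} {d} dense))
    total : ∀ j → 7 + ((j + j + 1) + 0) + 1 ≡ suc (2 * (4 + j))
    total = solve-∀

  -- The cycle is b ⇝ d - c - · - a - b, with 2j + 4 internal vertices between b and d. In a
  -- bipartite graph a and d would lie on opposite sides, so `Dense H 3 a d` is exactly the absence
  -- of a parity obstruction.
  disjoint-edges : ∀ {a b c d} → Good a b → Good c d → a ≢ c → a ≢ d → b ≢ c → b ≢ d →
                   colour a b ≡ colour c d → Dense Q 1 a c → ¬ Dense H 3 a d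
  disjoint-edges {a} {b} {c} {d} (_ , ab , _ , _ , robust , _) (_ , cd , _) a≢c a≢d b≢c b≢d same ac dense =
    conflict {segs₁ = (3 + up j 1 , d) ∷ []} {segs₂ = (1 , a) ∷ []} (rich ∷ []) (Adj-sym cd)
      (dense⇒rich {Q} 0 largeQ (Dense-sym {Q} 1 {a} {c} ac) ∷ []) ab
      ((b≢d ∷ b≢c ∷ ≢-sym (Adj⇒≢ ab) ∷ []) ∷ (≢-sym (Adj⇒≢ cd) ∷ ≢-sym a≢d ∷ []) ∷ (≢-sym a≢c ∷ []) ∷ [] ∷ [])
      (trans (cong (λ l → 5 + (l + 0) + 3) (up≡ j 1)) (total j))
      (trans (sym (colour-sym ab)) same)
    where
    rich : Rich (3 + up j 1) b d
    rich = dense⇒rich {B₂ * G₂} (2 + up j 1) large₂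
             (shift {B₂} {G₂} {padded H j} (1 + up j 1) {a} {b} {d} robust (*-monoʳ-≤ 2 (m≤m^4 (padded H j))) (pads {H} j 1 {a} {d} dense))
    total : ∀ j → 5 + ((j + j + 1) + 0) + 3 ≡ suc (2 * (4 + j))
    total = solve-∀

  -- The hypothesis says that parity never obstructs: whenever a and c have many common neighbours
  -- and cd is good, a and d are joined by many walks of length 4.
  module _ (none : ∀ {a c d} → a ∈ V → c ∈ V → d ∈ V → Good c d → Dense Q 1 a c → Dense H 3 a d) where
    -- The hypothesis is applied with c = a: a vertex of large degree has many common neighbours
    -- with itself.
    no-adjacent : ∀ {a b d} → Good a b → Good a d → b ≢ d → colour a b ≢ colour a d
    no-adjacent {a} {b} {d} ab ad@((a∈ , d∈) , _ , (da , _) , _) b≢d same =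
      adjacent-edges ab ad b≢d same (none a∈ a∈ d∈ ad (≤-trans (≤-reflexive (*-identityʳ n))
        (≤-trans da (*-mono-≤ T≤Q (≤-reflexive (sym (w1-diagonal a)))))))

    few-common : ∀ {a b c d} → Good a b → Good c d → colour a b ≡ colour c d →
                 ¬ (a ≡ c × b ≡ d) → ¬ (a ≡ d × b ≡ c) → Q * w 1 a c < n
    few-common {a} {b} {c} {d} ab cd@((c∈ , d∈) , adj-cd , _) same ≢₁ ≢₂ = go (a Fin.≟ c) (a Fin.≟ d) (b Fin.≟ c) (b Fin.≟ d)
      where
      go : Dec (a ≡ c) → Dec (a ≡ d) → Dec (b ≡ c) → Dec (b ≡ d) → Q * w 1 a c < n
      go (yes refl) _ _ _ = contradiction same (no-adjacent ab cd λ b≡d → ≢₁ (refl , b≡d))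
      go (no _) (yes refl) _ _ = contradiction (trans same (colour-sym adj-cd)) (no-adjacent ab (Good-sym cd) λ b≡c → ≢₂ (refl , b≡c))
      go (no _) (no a≢d) (yes refl) _ = contradiction (trans (sym (colour-sym (proj₁ (proj₂ ab)))) same) (no-adjacent (Good-sym ab) cd a≢d)
      go (no a≢c) (no _) (no _) (yes refl) = contradiction (trans (sym (colour-sym (proj₁ (proj₂ ab)))) (trans same (colour-sym adj-cd)))
        (no-adjacent (Good-sym ab) (Good-sym cd) a≢c)
      go (no a≢c) (no a≢d) (no b≢c) (no b≢d) = ≰⇒> λ le → let ac = ≤-trans (≤-reflexive (*-identityʳ n)) le in
        disjoint-edges ab cd a≢c a≢d b≢c b≢d same ac (none (proj₁ (proj₁ ab)) c∈ d∈ cd ac)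

  good : Fin N → Fin N → ℕ
  good a b = 𝟙 (good? a b)

  private
    low : Fin N → ℕ
    low a = 𝟙 (T * deg a ℕ.<? n)

    bad : ℕ → ℕ → Fin N → Fin N → ℕ
    bad B G a b = α a b * 𝟙 (n ℕ.<? B * miss G a b)

    cover : ∀ {a b} → a ∈ V → b ∈ V →
            α a b ≤ good a b + (low a * α a b + low b * α a b) +
                    ((bad B₁ G₁ a b + bad B₁ G₁ b a) + (bad B₂ G₂ a b + bad B₂ G₂ b a))
    cover {a} {b} a∈ b∈ = ≤-trans
      (some-case (α a b) (good a b) (T * deg a ℕ.<? n) (T * deg b ℕ.<? n) (n ℕ.<? B₁ * miss G₁ a b) (n ℕ.<? B₁ * miss G₁ b a)
        (n ℕ.<? B₂ * miss G₂ a b) (n ℕ.<? B₂ * miss G₂ b a) (α≤1 a b)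
        λ pos p q r r′ s s′ → ≤-reflexive (sym (𝟙-yes (good? a b)
          ((a∈ , b∈) , α-positive pos , (≮⇒≥ p , ≮⇒≥ q) , (≮⇒≥ r , ≮⇒≥ r′) , (≮⇒≥ s , ≮⇒≥ s′)))))
      (≤-reflexive (cong (good a b + (low a * α a b + low b * α a b) +_)
        (cong₂ _+_ (cong (bad B₁ G₁ a b +_) (cong (_* 𝟙 (n ℕ.<? B₁ * miss G₁ b a)) (α-sym a b)))
                   (cong (bad B₂ G₂ a b +_) (cong (_* 𝟙 (n ℕ.<? B₂ * miss G₂ b a)) (α-sym a b))))))

    low-count : T * ∑ V (λ a → ∑ V λ b → low a * α a b) ≤ n * n
    low-count = begin
      T * ∑ V (λ a → ∑ V λ b → low a * α a b)    ≡⟨ cong (T *_) (∑-cong V λ a → ∑-*ˡ V (low a) (α a)) ⟩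
      T * ∑ V (λ a → low a * deg a)              ≡⟨ ∑-*ˡ V T _ ⟨
      ∑ V (λ a → T * (low a * deg a))            ≤⟨ ∑-bounded V n each ⟩
      n * n                                      ∎
      where
      open ≤-Reasoning
      each : ∀ a → T * (low a * deg a) ≤ n
      each a = go (T * deg a ℕ.<? n)
        where
        go : (l : Dec (T * deg a < n)) → T * (𝟙 l * deg a) ≤ n
        go (yes lt) = ≤-trans (≤-reflexive (cong (T *_) (*-identityˡ (deg a)))) (<⇒≤ lt)
        go (no _)   = ≤-trans (≤-reflexive (*-zeroʳ T)) z≤n

    low-countʳ : T * ∑ V (λ a → ∑ V λ b → low b * α a b) ≤ n * n
    low-countʳ = ≤-trans (≤-reflexive (cong (T *_) (trans (∑-swap V V _)
      (∑-cong V λ b → ∑-cong V λ a → cong (low b *_) (α-sym a b))))) low-count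

    -- Counting triples: if z is a neighbour of `a` and the pair `b`, `z` is thin, then `a` is
    -- itself a common neighbour of `b` and `z`, so each thin pair arises from fewer than n/G
    -- vertices `a`.
    bad-count : 0 < n → 1 ≤ T → ∀ B → T * ∑ V (λ a → ∑ V λ b → bad B (B * T) a b) ≤ n * n
    bad-count 0<n 1≤T zero = ≤-trans (≤-reflexive (trans (cong (T *_) (trans (∑-cong V λ a → trans (∑-cong V λ b →
        trans (cong (α a b *_) (𝟙-no (n ℕ.<? 0) λ ())) (*-zeroʳ (α a b))) (∑-zero V)) (∑-zero V))) (*-zeroʳ T))) z≤n
    bad-count 0<n 1≤T B@(suc _) = *-cancelˡ-≤ (B * n) {{m*n≢0 B n {{_}} {{ℕ.>-nonZero 0<n}}}} (begin
      B * n * (T * β)                                             ≡⟨ reorder₁ B n T β ⟩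
      G * (n * β)                                                 ≤⟨ *-monoʳ-≤ G step₁ ⟩
      G * (B * ∑ V λ b → ∑ V λ z → thin G b z * w 1 b z)          ≡⟨ reorder₂ G B _ ⟩
      B * (G * ∑ V λ b → ∑ V λ z → thin G b z * w 1 b z)          ≤⟨ *-monoʳ-≤ B step₂ ⟩
      B * (n * (n * n))                                           ≡⟨ reorder₃ B n ⟩
      B * n * (n * n)                                             ∎)
      where
      open ≤-Reasoning
      G = B * T
      β = ∑ V λ a → ∑ V λ b → bad B G a b
      reorder₁ : ∀ B n T β → B * n * (T * β) ≡ B * T * (n * β)
      reorder₁ = solve-∀
      reorder₂ : ∀ G B x → G * (B * x) ≡ B * (G * x)
      reorder₂ = solve-∀
      reorder₃ : ∀ B n → B * (n * (n * n)) ≡ B * n * (n * n)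
      reorder₃ = solve-∀
      each : ∀ a b → n * bad B G a b ≤ B * (α a b * miss G a b)
      each a b = go (n ℕ.<? B * miss G a b)
        where
        go : (l : Dec (n < B * miss G a b)) → n * (α a b * 𝟙 l) ≤ B * (α a b * miss G a b)
        go (yes lt) = ≤-trans (≤-reflexive (swap n (α a b))) (≤-trans (*-monoʳ-≤ (α a b) (<⇒≤ lt)) (≤-reflexive (swap′ (α a b) B _)))
          where
          swap : ∀ n α → n * (α * 1) ≡ α * n
          swap = solve-∀
          swap′ : ∀ α B m → α * (B * m) ≡ B * (α * m)
          swap′ = solve-∀
        go (no _) = ≤-trans (≤-reflexive (zeros n (α a b))) z≤n
          where
          zeros : ∀ n α → n * (α * 0) ≡ 0
          zeros = solve-∀
      step₁ : n * β ≤ B * ∑ V λ b → ∑ V λ z → thin G b z * w 1 b z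
      step₁ = begin
        n * β
          ≡⟨ trans (sym (∑-*ˡ V n _)) (∑-cong V λ a → sym (∑-*ˡ V n _)) ⟩
        ∑ V (λ a → ∑ V λ b → n * bad B G a b)
          ≤⟨ ∑-mono V (λ a → ∑-mono V λ b → each a b) ⟩
        ∑ V (λ a → ∑ V λ b → B * (α a b * miss G a b))
          ≡⟨ trans (∑-cong V λ a → ∑-*ˡ V B _) (∑-*ˡ V B _) ⟩
        B * ∑ V (λ a → ∑ V λ b → α a b * miss G a b)
          ≡⟨ cong (B *_) (∑-cong V λ a → ∑-cong V λ b → sym (∑-*ˡ V (α a b) _)) ⟩
        B * ∑ V (λ a → ∑ V λ b → ∑ V λ z → α a b * (α a z * thin G b z))
          ≡⟨ cong (B *_) (∑-swap V V _) ⟩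
        B * ∑ V (λ b → ∑ V λ a → ∑ V λ z → α a b * (α a z * thin G b z))
          ≡⟨ cong (B *_) (∑-cong V λ b → ∑-swap V V _) ⟩
        B * ∑ V (λ b → ∑ V λ z → ∑ V λ a → α a b * (α a z * thin G b z))
          ≡⟨ cong (B *_) (∑-cong V λ b → ∑-cong V λ z → trans (∑-cong V λ a → trans (cong (_* (α a z * thin G b z)) (α-sym a b))
               (rotate (α b a) (α a z) (thin G b z))) (∑-*ˡ V (thin G b z) _)) ⟩
        B * ∑ V (λ b → ∑ V λ z → thin G b z * w 1 b z) ∎
        where
        rotate : ∀ a b c → a * (b * c) ≡ c * (a * b)
        rotate = solve-∀
      thin≤ : ∀ b z → G * (thin G b z * w 1 b z) ≤ n
      thin≤ b z = go (G * w 1 b z ℕ.<? n)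
        where
        go : (l : Dec (G * w 1 b z < n)) → G * (𝟙 l * w 1 b z) ≤ n
        go (yes lt) = ≤-trans (≤-reflexive (cong (G *_) (*-identityˡ (w 1 b z)))) (<⇒≤ lt)
        go (no _)   = ≤-trans (≤-reflexive (*-zeroʳ G)) z≤n
      step₂ : G * ∑ V (λ b → ∑ V λ z → thin G b z * w 1 b z) ≤ n * (n * n)
      step₂ = ≤-trans (≤-reflexive (trans (sym (∑-*ˡ V G _)) (∑-cong V λ b → sym (∑-*ˡ V G _))))
                (∑-bounded V (n * n) λ b → ∑-bounded V n (thin≤ b))

  -- Six exceptions cost at most n²/T each: either end of low degree, and each of the two robustness
  -- conditions in either direction.
  good-count : 0 < n → 1 ≤ T → T * E ≤ T * ∑ V (λ a → ∑ V (good a)) + 6 * (n * n)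
  good-count 0<n 1≤T = begin
    T * E
      ≤⟨ *-monoʳ-≤ T (∑-mono∈ V λ a a∈ → ∑-mono∈ V λ b b∈ → cover a∈ b∈) ⟩
    T * ∑ V (λ a → ∑ V λ b → good a b + (low a * α a b + low b * α a b) +
              ((bad B₁ G₁ a b + bad B₁ G₁ b a) + (bad B₂ G₂ a b + bad B₂ G₂ b a)))
      ≡⟨ cong (T *_) (trans (split₂ _ _) (cong₂ _+_ (trans (split₂ _ _) (cong (S good +_) (split₂ _ _)))
           (trans (split₂ _ _) (cong₂ _+_ (split₂ _ _) (split₂ _ _))))) ⟩
    T * (S good + (S (λ a b → low a * α a b) + S (λ a b → low b * α a b)) +
         ((S (bad B₁ G₁) + S (λ a b → bad B₁ G₁ b a)) + (S (bad B₂ G₂) + S (λ a b → bad B₂ G₂ b a))))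
      ≡⟨ distribute T (S good) _ _ _ _ _ _ ⟩
    T * S good + (T * S (λ a b → low a * α a b) + T * S (λ a b → low b * α a b) +
         ((T * S (bad B₁ G₁) + T * S (λ a b → bad B₁ G₁ b a)) + (T * S (bad B₂ G₂) + T * S (λ a b → bad B₂ G₂ b a))))
      ≤⟨ +-monoʳ-≤ (T * S good) (+-mono-≤ (+-mono-≤ low-count low-countʳ)
           (+-mono-≤ (+-mono-≤ (bad-count 0<n 1≤T B₁) (swapped (bad B₁ G₁) (bad-count 0<n 1≤T B₁)))
                     (+-mono-≤ (bad-count 0<n 1≤T B₂) (swapped (bad B₂ G₂) (bad-count 0<n 1≤T B₂))))) ⟩
    T * S good + (n * n + n * n + ((n * n + n * n) + (n * n + n * n)))
      ≡⟨ cong (T * S good +_) (six (n * n)) ⟩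
    T * S good + 6 * (n * n) ∎
    where
    open ≤-Reasoning
    S : (Fin N → Fin N → ℕ) → ℕ
    S g = ∑ V λ a → ∑ V (g a)
    split₂ : ∀ g h → S (λ a b → g a b + h a b) ≡ S g + S h
    split₂ g h = trans (∑-cong V λ a → ∑-+ V (g a) (h a)) (∑-+ V _ _)
    swapped : ∀ g → T * S g ≤ n * n → T * S (λ a b → g b a) ≤ n * n
    swapped g le = ≤-trans (≤-reflexive (cong (T *_) (∑-swap V V _))) le
    distribute : ∀ T a b c d e f g → T * (a + (b + c) + ((d + e) + (f + g))) ≡ T * a + (T * b + T * c + ((T * d + T * e) + (T * f + T * g)))
    distribute = solve-∀
    six : ∀ a → a + a + ((a + a) + (a + a)) ≡ 6 * a
    six = solve-∀

  -- Colour classes and typical vertices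

  0<n : 0 < n
  0<n = ≤-<-trans z≤n large

  goodᵖ : Pair → ℕ
  goodᵖ (a , b) = good a b

  module Typicality
    (few : ∀ {a b c d} → Good a b → Good c d → colour a b ≡ colour c d →
           ¬ (a ≡ c × b ≡ d) → ¬ (a ≡ d × b ≡ c) → Q * w 1 a c < n) where
    few′ : ∀ {e e′} → Good (proj₁ e) (proj₂ e) → Good (proj₁ e′) (proj₂ e′) → χ e ≡ χ e′ → ¬ (e ~ e′) →
           Q * w 1 (proj₁ e) (proj₁ e′) < n
    few′ g g′ same differ = few g g′ same (differ ∘ inj₁) (differ ∘ inj₂)

    -- By Cauchy-Schwarz for the number of edges of the class at each vertex, first ends of distinct
    -- edges of a colour class have few common neighbours although their degrees are linear.
    class-size : ∀ r → ∑ P (λ e → goodᵖ e * 𝟙 (r Fin.≟ χ e)) ≤ 4 * (T * T)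
    class-size r = bound t refl
      where
      open ≤-Reasoning
      s : Pair → ℕ
      s e = goodᵖ e * 𝟙 (r Fin.≟ χ e)
      t D Y : ℕ
      t = ∑ P s
      D = ∑ P λ e → s e * deg (proj₁ e)
      Y = ∑ P λ e → ∑ P λ e′ → s e * s e′ * w 1 (proj₁ e) (proj₁ e′)
      h : Fin N → ℕ
      h x = ∑ P λ e → s e * α (proj₁ e) x
      s≤1 : ∀ e → s e ≤ 1
      s≤1 (a , b) = *-mono-≤ (𝟙≤1 (good? a b)) (𝟙≤1 (r Fin.≟ χ (a , b)))
      nt≤TD : n * t ≤ T * D
      nt≤TD = begin
        n * t                                           ≡⟨ ∑-*ˡ P n s ⟨
        ∑ P (λ e → n * s e)                             ≤⟨ ∑-mono P each ⟩
        ∑ P (λ e → T * (s e * deg (proj₁ e)))           ≡⟨ ∑-*ˡ P T _ ⟩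
        T * D                                           ∎
        where
        each : ∀ e → n * s e ≤ T * (s e * deg (proj₁ e))
        each (a , b) = go (good? a b) (𝟙 (r Fin.≟ colour a b))
          where
          reorder : ∀ T d s → T * d * s ≡ T * (s * d)
          reorder = solve-∀
          go : (g : Dec (Good a b)) → ∀ s → n * (𝟙 g * s) ≤ T * (𝟙 g * s * deg a)
          go (no _) s = ≤-trans (≤-reflexive (*-zeroʳ n)) z≤n
          go (yes (_ , _ , (da , _) , _)) s = ≤-trans (*-monoˡ-≤ (1 * s) da) (≤-reflexive (reorder T (deg a) (1 * s)))
      h-total : ∑ V h ≡ D
      h-total = trans (∑-swap V P _) (∑-cong P λ e → ∑-*ˡ V (s e) _)
      h² : ∑ V (λ x → h x * h x) ≡ Y
      h² = trans (∑-cong V λ x → sym (∑-product P P _ _)) (trans (∑-swap V P _) (∑-cong P λ e →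
             trans (∑-swap V P _) (∑-cong P λ e′ → trans (∑-cong V λ x →
               trans (cong (λ a → s e * α (proj₁ e) x * (s e′ * a)) (α-sym (proj₁ e′) x))
                     (reorder (s e) (α (proj₁ e) x) (s e′) (α x (proj₁ e′)))) (∑-*ˡ V (s e * s e′) _))))
        where
        reorder : ∀ a b c d → a * b * (c * d) ≡ a * c * (b * d)
        reorder = solve-∀
      D²≤ : D * D ≤ n * Y
      D²≤ = begin
        D * D                          ≡⟨ cong₂ _*_ h-total h-total ⟨
        ∑ V h * ∑ V h                  ≤⟨ cauchy-schwarz V h ⟩
        n * ∑ V (λ x → h x * h x)      ≡⟨ cong (n *_) h² ⟩
        n * Y                          ∎
      each : ∀ e e′ → Q * (s e * s e′ * w 1 (proj₁ e) (proj₁ e′)) ≤ n * (s e * s e′) + Q * n * (s e * 𝟙 (e ~? e′))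
      each e@(a , b) e′@(c , d) = go (good? a b) (good? c d) (r Fin.≟ colour a b) (r Fin.≟ colour c d) (e ~? e′)
        where
        zeros : ∀ Q x y → Q * (x * 0 * y) ≡ 0
        zeros = solve-∀
        identity : ∀ Q n → Q * (1 * (n * 1)) ≡ Q * n * 1
        identity = solve-∀
        go : (g : Dec (Good a b)) (g′ : Dec (Good c d)) (x : Dec (r ≡ colour a b)) (x′ : Dec (r ≡ colour c d)) (same : Dec (e ~ e′)) →
             Q * (𝟙 g * 𝟙 x * (𝟙 g′ * 𝟙 x′) * w 1 a c) ≤ n * (𝟙 g * 𝟙 x * (𝟙 g′ * 𝟙 x′)) + Q * n * (𝟙 g * 𝟙 x * 𝟙 same)
        go (no _)  _        _        _         _           = ≤-trans (≤-reflexive (*-zeroʳ Q)) z≤n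
        go (yes _) (no _)   x        _         _           = ≤-trans (≤-reflexive (zeros Q (1 * 𝟙 x) (w 1 a c))) z≤n
        go (yes _) (yes _)  (no _)   _         _           = ≤-trans (≤-reflexive (*-zeroʳ Q)) z≤n
        go (yes _) (yes _)  (yes _)  (no _)    _           = ≤-trans (≤-reflexive (*-zeroʳ Q)) z≤n
        go (yes _) (yes _)  (yes _)  (yes _)   (yes _)     = begin
          Q * (1 * w 1 a c)               ≤⟨ *-monoʳ-≤ Q (*-monoʳ-≤ 1 (w≤ 1 a c)) ⟩
          Q * (1 * (n * 1))               ≡⟨ identity Q n ⟩
          Q * n * 1                       ≤⟨ m≤n+m _ (n * 1) ⟩
          n * 1 + Q * n * 1               ∎
        go (yes g) (yes g′) (yes r≡) (yes r≡′) (no differ) = begin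
          Q * (1 * w 1 a c)               ≡⟨ cong (Q *_) (*-identityˡ _) ⟩
          Q * w 1 a c                     ≤⟨ <⇒≤ (few′ g g′ (trans (sym r≡) r≡′) differ) ⟩
          n                               ≡⟨ *-identityʳ n ⟨
          n * 1                           ≤⟨ m≤m+n (n * 1) _ ⟩
          n * 1 + Q * n * 0               ∎
      QY≤ : Q * Y ≤ n * (t * t) + Q * n * (2 * t)
      QY≤ = begin
        Q * Y
          ≡⟨ trans (sym (∑-*ˡ P Q _)) (∑-cong P λ e → sym (∑-*ˡ P Q _)) ⟩
        ∑ P (λ e → ∑ P λ e′ → Q * (s e * s e′ * w 1 (proj₁ e) (proj₁ e′)))
          ≤⟨ ∑-mono P (λ e → ∑-mono P λ e′ → each e e′) ⟩
        ∑ P (λ e → ∑ P λ e′ → n * (s e * s e′) + Q * n * (s e * 𝟙 (e ~? e′)))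
          ≡⟨ trans (∑-cong P λ e → ∑-+ P _ _) (∑-+ P _ _) ⟩
        ∑ P (λ e → ∑ P λ e′ → n * (s e * s e′)) + ∑ P (λ e → ∑ P λ e′ → Q * n * (s e * 𝟙 (e ~? e′)))
          ≡⟨ cong₂ _+_ (trans (trans (∑-cong P λ e → ∑-*ˡ P n _) (∑-*ˡ P n _)) (cong (n *_) (∑-product P P s s)))
                       (trans (∑-cong P λ e → trans (∑-*ˡ P (Q * n) _) (cong (Q * n *_) (∑-*ˡ P (s e) _))) (∑-*ˡ P (Q * n) _)) ⟩
        n * (t * t) + Q * n * ∑ P (λ e → s e * ∑ P (λ e′ → 𝟙 (e ~? e′)))
          ≤⟨ +-monoʳ-≤ (n * (t * t)) (*-monoʳ-≤ (Q * n) (≤-trans (∑-mono P λ e → *-monoʳ-≤ (s e) (copies e))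
               (≤-reflexive (trans (∑-*ʳ P 2 s) (*-comm t 2))))) ⟩
        n * (t * t) + Q * n * (2 * t) ∎
      main : n * n * (t * t * Q) ≤ n * n * (T * T * (t * t + Q * (2 * t)))
      main = begin
        n * n * (t * t * Q)                          ≡⟨ id₁ n t Q ⟩
        n * t * (n * t) * Q                          ≤⟨ *-monoˡ-≤ Q (sq-mono nt≤TD) ⟩
        T * D * (T * D) * Q                          ≡⟨ id₂ T D Q ⟩
        T * T * Q * (D * D)                          ≤⟨ *-monoʳ-≤ (T * T * Q) D²≤ ⟩
        T * T * Q * (n * Y)                          ≡⟨ id₃ T Q n Y ⟩
        T * T * n * (Q * Y)                          ≤⟨ *-monoʳ-≤ (T * T * n) QY≤ ⟩
        T * T * n * (n * (t * t) + Q * n * (2 * t))  ≡⟨ id₄ T n t Q ⟩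
        n * n * (T * T * (t * t + Q * (2 * t)))      ∎
        where
        id₁ : ∀ n t Q → n * n * (t * t * Q) ≡ n * t * (n * t) * Q
        id₁ = solve-∀
        id₂ : ∀ T D Q → T * D * (T * D) * Q ≡ T * T * Q * (D * D)
        id₂ = solve-∀
        id₃ : ∀ T Q n Y → T * T * Q * (n * Y) ≡ T * T * n * (Q * Y)
        id₃ = solve-∀
        id₄ : ∀ T n t Q → T * T * n * (n * (t * t) + Q * n * (2 * t)) ≡ n * n * (T * T * (t * t + Q * (2 * t)))
        id₄ = solve-∀
      2T²≤Q : 2 * (T * T) ≤ Q
      2T²≤Q = *-mono-≤ {2} {16} (s≤s (s≤s z≤n)) (≤-trans (≤-reflexive (cong (T *_) (sym (*-identityʳ T))))
                (^-monoʳ-≤ T {{ℕ.>-nonZero 1≤T}} {2} {4} (s≤s (s≤s z≤n))))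
      -- From t²Q ≤ T²t² + 2T²Qt, the first term on the right is at most half of the left side
      -- because 2T² ≤ Q; what remains is t ≤ 4T².
      bound : ∀ t′ → t′ ≡ t → t′ ≤ 4 * (T * T)
      bound zero _ = z≤n
      bound t′@(suc _) eq = *-cancelʳ-≤ t′ (4 * (T * T)) (t′ * Q) {{m*n≢0 t′ Q {{_}} {{Q≢0}}}}
        (by-adding (+-mono-≤ (*-monoʳ-≤ 2 cancelled) (*-monoˡ-≤ (t′ * t′) 2T²≤Q)) 0 (identity t′ Q T))
        where
        Q≢0 : ℕ.NonZero Q
        Q≢0 = ℕ.>-nonZero (*-mono-≤ {1} {16} (s≤s z≤n) 1≤T^4)
        cancelled : t′ * t′ * Q ≤ T * T * (t′ * t′ + Q * (2 * t′))
        cancelled = *-cancelˡ-≤ (n * n) {{m*n≢0 n n {{ℕ.>-nonZero 0<n}} {{ℕ.>-nonZero 0<n}}}}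
          (subst (λ t → n * n * (t * t * Q) ≤ n * n * (T * T * (t * t + Q * (2 * t)))) (sym eq) main)
        identity : ∀ t Q T → t * (t * Q) + (2 * (T * T * (t * t + Q * (2 * t))) + Q * (t * t)) + 0 ≡
                             4 * (T * T) * (t * Q) + (2 * (t * t * Q) + 2 * (T * T) * (t * t))
        identity = solve-∀

    clash : Pair → Pair → ℕ
    clash e e′ = goodᵖ e * goodᵖ e′ * (𝟙 (χ e Fin.≟ χ e′) * 𝟙 (¬? (e ~? e′)))

    -- For most v few pairs of good edges of the same colour both meet N(v): their ends have few common neighbours.
    violations : Fin N → ℕ
    violations v = ∑ P λ e → ∑ P λ e′ →
      clash e e′ * ((α v (proj₁ e) + α v (proj₂ e)) * (α v (proj₁ e′) + α v (proj₂ e′)))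

    -- A fixed edge clashes only inside its own colour class, whose size is bounded by `class-size`.
    clash-total : ∑ P (λ e → ∑ P λ e′ → clash e e′) ≤ n * n * (4 * (T * T))
    clash-total = ≤-trans (∑-bounded P (4 * (T * T)) each) (≤-reflexive (cong (_* (4 * (T * T))) length-P))
      where
      each : ∀ e → ∑ P (λ e′ → clash e e′) ≤ 4 * (T * T)
      each e = ≤-trans (∑-mono P λ e′ → shrink (goodᵖ e) (goodᵖ e′) (𝟙 (χ e Fin.≟ χ e′)) (𝟙 (¬? (e ~? e′)))
                   (𝟙≤1 (good? (proj₁ e) (proj₂ e))) (𝟙≤1 (¬? (e ~? e′)))) (class-size (χ e))
        where
        shrink : ∀ a b c d → a ≤ 1 → d ≤ 1 → a * b * (c * d) ≤ b * c
        shrink a b c d a≤1 d≤1 = ≤-trans (*-mono-≤ (*-monoˡ-≤ b a≤1) (*-monoʳ-≤ c d≤1)) (≤-reflexive (identity b c))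
          where
          identity : ∀ b c → 1 * b * (c * 1) ≡ b * c
          identity = solve-∀

    -- For one clashing pair, the vertices v whose neighbourhood meets both edges are common
    -- neighbours of two of their ends: four pairs of ends with at most n/Q common neighbours each.
    violations-total : T * T * ∑ V violations ≤ n * (n * n)
    violations-total = *-cancelˡ-≤ (16 * (T * T)) {{16T²≢0}} (begin
      16 * (T * T) * (T * T * ∑ V violations)                     ≡⟨ power T (∑ V violations) ⟩
      Q * ∑ V violations                                          ≡⟨ cong (Q *_) regroup ⟩
      Q * ∑ P (λ e → ∑ P λ e′ → clash e e′ * crosses e e′)        ≡⟨ trans (sym (∑-*ˡ P Q _)) (∑-cong P λ e → sym (∑-*ˡ P Q _)) ⟩
      ∑ P (λ e → ∑ P λ e′ → Q * (clash e e′ * crosses e e′))      ≤⟨ ∑-mono P (λ e → ∑-mono P λ e′ → each e e′) ⟩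
      ∑ P (λ e → ∑ P λ e′ → 4 * n * clash e e′)                   ≡⟨ trans (∑-cong P λ e → ∑-*ˡ P (4 * n) _) (∑-*ˡ P (4 * n) _) ⟩
      4 * n * ∑ P (λ e → ∑ P λ e′ → clash e e′)                   ≤⟨ *-monoʳ-≤ (4 * n) clash-total ⟩
      4 * n * (n * n * (4 * (T * T)))                             ≡⟨ reorder n (T * T) ⟩
      16 * (T * T) * (n * (n * n))                                ∎)
      where
      open ≤-Reasoning
      16T²≢0 : ℕ.NonZero (16 * (T * T))
      16T²≢0 = ℕ.>-nonZero (*-mono-≤ {1} {16} (s≤s z≤n) (*-mono-≤ 1≤T 1≤T))
      power : ∀ T x → 16 * (T * T) * (T * T * x) ≡ 16 * (T * (T * (T * (T * 1)))) * x
      power = solve-∀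
      reorder : ∀ n t → 4 * n * (n * n * (4 * t)) ≡ 16 * t * (n * (n * n))
      reorder = solve-∀
      crosses : Pair → Pair → ℕ
      crosses (a , b) (c , d) = (w 1 a c + w 1 a d) + (w 1 b c + w 1 b d)
      common : ∀ a c → ∑ V (λ v → α v a * α v c) ≡ w 1 a c
      common a c = ∑-cong V λ v → cong (_* α v c) (α-sym v a)
      regroup : ∑ V violations ≡ ∑ P (λ e → ∑ P λ e′ → clash e e′ * crosses e e′)
      regroup = trans (∑-swap V P _) (∑-cong P λ e → trans (∑-swap V P _) (∑-cong P λ e′ →
        trans (∑-*ˡ V (clash e e′) _) (cong (clash e e′ *_) (products e e′))))
        where
        products : ∀ e e′ → ∑ V (λ v → (α v (proj₁ e) + α v (proj₂ e)) * (α v (proj₁ e′) + α v (proj₂ e′))) ≡ crosses e e′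
        products (a , b) (c , d) = trans (∑-cong V λ v → expand (α v a) (α v b) (α v c) (α v d))
          (trans (∑-+ V _ _) (cong₂ _+_ (trans (∑-+ V _ _) (cong₂ _+_ (common a c) (common a d)))
                                        (trans (∑-+ V _ _) (cong₂ _+_ (common b c) (common b d)))))
          where
          expand : ∀ a b c d → (a + b) * (c + d) ≡ (a * c + a * d) + (b * c + b * d)
          expand = solve-∀
      each : ∀ e e′ → Q * (clash e e′ * crosses e e′) ≤ 4 * n * clash e e′
      each e@(a , b) e′@(c , d) = go (good? a b) (good? c d) (colour a b Fin.≟ colour c d) (e ~? e′)
        where
        go : ∀ (g : Dec (Good a b)) (g′ : Dec (Good c d)) (s : Dec (colour a b ≡ colour c d)) (t : Dec (e ~ e′)) →
             Q * (𝟙 g * 𝟙 g′ * (𝟙 s * 𝟙 (¬? t)) * crosses e e′) ≤ 4 * n * (𝟙 g * 𝟙 g′ * (𝟙 s * 𝟙 (¬? t)))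
        go (no _)  _       _       _       = ≤-trans (≤-reflexive (*-zeroʳ Q)) z≤n
        go (yes _) (no _)  _       _       = ≤-trans (≤-reflexive (*-zeroʳ Q)) z≤n
        go (yes _) (yes _) (no _)  _       = ≤-trans (≤-reflexive (*-zeroʳ Q)) z≤n
        go (yes _) (yes _) (yes _) (yes _) = ≤-trans (≤-reflexive (*-zeroʳ Q)) z≤n
        go (yes g) (yes g′) (yes same) (no differ) = begin
          Q * (1 * crosses e e′)
            ≡⟨ spread Q (w 1 a c) (w 1 a d) (w 1 b c) (w 1 b d) ⟩
          (Q * w 1 a c + Q * w 1 a d) + (Q * w 1 b c + Q * w 1 b d)
            ≤⟨ +-mono-≤ (+-mono-≤ (<⇒≤ (few g g′ same (differ ∘ inj₁) (differ ∘ inj₂)))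
                                  (<⇒≤ (few g (Good-sym g′) (trans same flip′) (differ ∘ inj₂) (differ ∘ inj₁))))
                        (+-mono-≤ (<⇒≤ (few (Good-sym g) g′ (trans flip same) (λ (p , q) → differ (inj₂ (q , p))) (λ (p , q) → differ (inj₁ (q , p)))))
                                  (<⇒≤ (few (Good-sym g) (Good-sym g′) (trans flip (trans same flip′)) (λ (p , q) → differ (inj₁ (q , p))) (λ (p , q) → differ (inj₂ (q , p)))))) ⟩
          (n + n) + (n + n)
            ≡⟨ four n ⟩
          4 * n * 1 ∎
          where
          flip : colour b a ≡ colour a b
          flip = sym (colour-sym (proj₁ (proj₂ g)))
          flip′ : colour c d ≡ colour d c
          flip′ = colour-sym (proj₁ (proj₂ g′))
          spread : ∀ Q a b c d → Q * (1 * ((a + b) + (c + d))) ≡ (Q * a + Q * b) + (Q * c + Q * d)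
          spread = solve-∀
          four : ∀ n → (n + n) + (n + n) ≡ 4 * n * 1
          four = solve-∀

    Typical : Fin N → Set
    Typical v = T * violations v ≤ n * n

    typical? : ∀ v → Dec (Typical v)
    typical? v = T * violations v ℕ.≤? n * n

    atypical : Fin N → ℕ
    atypical v = 𝟙 (¬? (typical? v))

    -- Markov's inequality for `violations-total`.
    atypical-count : T * ∑ V atypical ≤ n
    atypical-count = *-cancelˡ-≤ (n * n) {{m*n≢0 n n {{ℕ.>-nonZero 0<n}} {{ℕ.>-nonZero 0<n}}}} (begin
      n * n * (T * ∑ V atypical)                    ≡⟨ reorder (n * n) T _ ⟩
      T * (n * n * ∑ V atypical)                    ≡⟨ cong (T *_) (∑-*ˡ V (n * n) _) ⟨
      T * ∑ V (λ v → n * n * atypical v)            ≤⟨ *-monoʳ-≤ T (∑-mono V each) ⟩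
      T * ∑ V (λ v → T * violations v)              ≡⟨ cong (T *_) (∑-*ˡ V T _) ⟩
      T * (T * ∑ V violations)                      ≡⟨ *-assoc T T _ ⟨
      T * T * ∑ V violations                        ≤⟨ violations-total ⟩
      n * (n * n)                                   ≡⟨ *-comm n (n * n) ⟩
      n * n * n                                     ∎)
      where
      open ≤-Reasoning
      reorder : ∀ a b c → a * (b * c) ≡ b * (a * c)
      reorder = solve-∀
      each : ∀ v → n * n * atypical v ≤ T * violations v
      each v = go (typical? v)
        where
        go : (d : Dec (Typical v)) → n * n * 𝟙 (¬? d) ≤ T * violations v
        go (yes _)  = ≤-trans (≤-reflexive (*-zeroʳ (n * n))) z≤n
        go (no big) = ≤-trans (≤-reflexive (*-identityʳ (n * n))) (<⇒≤ (≰⇒> big))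

    -- Consider two good edges of one colour that both meet `I`. Their ends in `I` have few common
    -- neighbours, so by `sparse` both lie in N(v), and the pair is a violation at v. Only the edges
    -- avoiding `I` and an error remain: 6 for edges that are not good, 1 for the violations.
    loss : ∀ v → Typical v → {I : Fin N → Set} (I? : ∀ x → Dec (I x)) →
           (∀ {x y} → I x → I y → Q * w 1 x y < n → Adj v x × Adj v y) →
           T * E ≤ T * (2 * f + ∑ V (λ a → ∑ V λ b → α a b * (𝟙 (¬? (I? a)) * 𝟙 (¬? (I? b))))) + 7 * (n * n)
    loss v typical {I} I? sparse = begin
      T * E
        ≤⟨ good-count 0<n 1≤T ⟩
      T * ∑ V (λ a → ∑ V (good a)) + 6 * (n * n)
        ≤⟨ +-monoˡ-≤ _ (*-monoʳ-≤ T (≤-trans (∑-mono V λ a → ∑-mono V λ b → split a b)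
             (≤-reflexive (trans (∑-cong V λ a → ∑-+ V _ _) (∑-+ V _ _))))) ⟩
      T * (∑ V (λ a → ∑ V λ b → τ (a , b)) + O) + 6 * (n * n)
        ≡⟨ cong (λ x → T * (x + O) + 6 * (n * n)) (∑-pairs V V τ) ⟨
      T * (∑ P τ + O) + 6 * (n * n)
        ≤⟨ +-monoˡ-≤ _ (*-monoʳ-≤ T (+-monoˡ-≤ O (≤-trans (items-vs-colours τ τ≤1)
             (+-monoʳ-≤ (2 * f) (∑-mono P λ e → ∑-mono P λ e′ → violated e e′))))) ⟩
      T * (2 * f + violations v + O) + 6 * (n * n)
        ≡⟨ regroup T (2 * f) (violations v) O (n * n) ⟩
      T * (2 * f + O) + (T * violations v + 6 * (n * n))
        ≤⟨ +-monoʳ-≤ (T * (2 * f + O)) (+-monoˡ-≤ _ typical) ⟩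
      T * (2 * f + O) + 7 * (n * n) ∎
      where
      open ≤-Reasoning
      O = ∑ V (λ a → ∑ V λ b → α a b * (𝟙 (¬? (I? a)) * 𝟙 (¬? (I? b))))
      meets? : ∀ a b → Dec (I a ⊎ I b)
      meets? a b = I? a ⊎-dec I? b
      τ : Pair → ℕ
      τ (a , b) = good a b * 𝟙 (meets? a b)
      τ≤1 : ∀ e → τ e ≤ 1
      τ≤1 (a , b) = *-mono-≤ (𝟙≤1 (good? a b)) (𝟙≤1 (meets? a b))
      regroup : ∀ T f v O m → T * (f + v + O) + 6 * m ≡ T * (f + O) + (T * v + 6 * m)
      regroup = solve-∀
      split : ∀ a b → good a b ≤ τ (a , b) + α a b * (𝟙 (¬? (I? a)) * 𝟙 (¬? (I? b)))
      split a b = go (good? a b) (I? a) (I? b)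
        where
        go : ∀ (g : Dec (Good a b)) (x : Dec (I a)) (y : Dec (I b)) →
             𝟙 g ≤ 𝟙 g * 𝟙 (x ⊎-dec y) + α a b * (𝟙 (¬? x) * 𝟙 (¬? y))
        go (no _)  _       _       = z≤n
        go (yes _) (yes _) _       = m≤m+n 1 _
        go (yes _) (no _)  (yes _) = m≤m+n 1 _
        go (yes g) (no _)  (no _)  = ≤-reflexive (sym (cong (_* 1) (α-yes (proj₁ (proj₂ g)))))
      violated : ∀ e e′ → τ e * τ e′ * (𝟙 (χ e Fin.≟ χ e′) * 𝟙 (¬? (e ~? e′))) ≤
                 clash e e′ * ((α v (proj₁ e) + α v (proj₂ e)) * (α v (proj₁ e′) + α v (proj₂ e′)))
      violated e@(a , b) e′@(c , d) = go (good? a b) (good? c d) (colour a b Fin.≟ colour c d) (e ~? e′) (meets? a b) (meets? c d)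
        where
        m = (α v a + α v b) * (α v c + α v d)
        go : ∀ (g : Dec (Good a b)) (g′ : Dec (Good c d)) (s : Dec (colour a b ≡ colour c d)) (t : Dec (e ~ e′))
               (i : Dec (I a ⊎ I b)) (i′ : Dec (I c ⊎ I d)) →
             𝟙 g * 𝟙 i * (𝟙 g′ * 𝟙 i′) * (𝟙 s * 𝟙 (¬? t)) ≤ 𝟙 g * 𝟙 g′ * (𝟙 s * 𝟙 (¬? t)) * m
        go (no _)  _       _       _       _       _       = z≤n
        go (yes _) g′      s       t       (no _)  _       = z≤n
        go (yes _) (no _)  s       t       (yes _) _       = z≤n
        go (yes _) (yes _) s       t       (yes _) (no _)  = z≤n
        go (yes _) (yes _) (no _)  t       (yes _) (yes _) = z≤n
        go (yes _) (yes _) (yes _) (yes _) (yes _) (yes _) = z≤n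
        go (yes g) (yes g′) (yes same) (no differ) (yes i) (yes i′) = ≤-trans (found i i′) (≤-reflexive (sym (*-identityˡ m)))
          where
          flip : colour b a ≡ colour a b
          flip = sym (colour-sym (proj₁ (proj₂ g)))
          flip′ : colour c d ≡ colour d c
          flip′ = colour-sym (proj₁ (proj₂ g′))
          hit : ∀ {x y p q} → Adj v x × Adj v y → α v x ≤ p → α v y ≤ q → 1 ≤ p * q
          hit (vx , vy) ≤p ≤q = *-mono-≤ (≤-trans (≤-reflexive (sym (α-yes vx))) ≤p) (≤-trans (≤-reflexive (sym (α-yes vy))) ≤q)
          found : I a ⊎ I b → I c ⊎ I d → 1 ≤ m
          found (inj₁ ia) (inj₁ ic) = hit (sparse ia ic (few g g′ same (differ ∘ inj₁) (differ ∘ inj₂))) (m≤m+n (α v a) (α v b)) (m≤m+n (α v c) (α v d))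
          found (inj₁ ia) (inj₂ id) = hit (sparse ia id (few g (Good-sym g′) (trans same flip′) (differ ∘ inj₂) (differ ∘ inj₁))) (m≤m+n (α v a) (α v b)) (m≤n+m (α v d) (α v c))
          found (inj₂ ib) (inj₁ ic) = hit (sparse ib ic (few (Good-sym g) g′ (trans flip same) (λ (p , q) → differ (inj₂ (q , p))) (λ (p , q) → differ (inj₁ (q , p))))) (m≤n+m (α v b) (α v a)) (m≤m+n (α v c) (α v d))
          found (inj₂ ib) (inj₂ id) = hit (sparse ib id (few (Good-sym g) (Good-sym g′) (trans flip (trans same flip′)) (λ (p , q) → differ (inj₁ (q , p))) (λ (p , q) → differ (inj₂ (q , p))))) (m≤n+m (α v b) (α v a)) (m≤n+m (α v d) (α v c))

    some-typical : ∃ λ v → v ∈ V × Typical v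
    some-typical = go (argmax V typical? (λ _ → 0))
      where
      open ≤-Reasoning
      go : (∀ v → v ∈ V → ¬ Typical v) ⊎ (∃ λ v → v ∈ V × Typical v × (∀ u → u ∈ V → Typical u → 0 ≤ 0)) → ∃ λ v → v ∈ V × Typical v
      go (inj₂ (v , v∈ , t , _)) = v , v∈ , t
      go (inj₁ none) = contradiction too-many (<⇒≱ (m<m+n n (≤-trans 0<n (m≤m+n n 0))))
        where
        too-many : 2 * n ≤ n
        too-many = begin
          2 * n                      ≤⟨ *-mono-≤ 2≤T (≤-reflexive (sym (trans (∑-const V 1) (*-identityʳ n)))) ⟩
          T * ∑ V (λ _ → 1)          ≤⟨ *-monoʳ-≤ T (∑-mono∈ V λ v v∈ → ≤-reflexive (sym (𝟙-yes (¬? (typical? v)) (none v v∈)))) ⟩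
          T * ∑ V atypical           ≤⟨ atypical-count ⟩
          n                          ∎

    -- The vertices outside S₁ and Mid are joined to everything outside S₁ by many paths of length 2.
    -- For a typical v with the most neighbours in Mid, the edges that avoid both N(v) ∩ Mid and
    -- the vertices outside S₁ ∪ Mid number at most (|S₁| + |Mid|/2)²/2, by AM-GM.
    module _ {S₁ Mid : Fin N → Set} (S₁? : ∀ x → Dec (S₁ x)) (Mid? : ∀ x → Dec (Mid x))
      (far : ∀ {x y} → ¬ S₁ x → ¬ S₁ y → Q * w 1 x y < n → Mid x × Mid y) where
      private
        p μ : ℕ
        p = ∑ V λ x → 𝟙 (S₁? x)
        μ = ∑ V λ x → 𝟙 (Mid? x)

        reach : Fin N → ℕ
        reach v = ∑ V λ x → α v x * 𝟙 (Mid? x)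

      split-loss-at : ∀ v → Typical v → (∀ u → u ∈ V → Typical u → reach u ≤ reach v) →
                      4 * (T * E) ≤ 4 * (T * (2 * f)) + T * ((2 * p + μ) * (2 * p + μ)) + 36 * (n * n)
      split-loss-at v typical best = begin
        4 * (T * E)
          ≤⟨ *-monoʳ-≤ 4 (loss v typical I? sparse) ⟩
        4 * (T * (2 * f + O) + 7 * (n * n))
          ≡⟨ regroup T (2 * f) O (n * n) ⟩
        4 * (T * (2 * f)) + T * (4 * O) + 28 * (n * n)
          ≤⟨ +-monoˡ-≤ (28 * (n * n)) (+-monoʳ-≤ (4 * (T * (2 * f))) (*-monoʳ-≤ T 4O≤)) ⟩
        4 * (T * (2 * f)) + T * ((2 * p + μ) * (2 * p + μ) + 8 * (n * A)) + 28 * (n * n)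
          ≡⟨ regroup′ (4 * (T * (2 * f))) T ((2 * p + μ) * (2 * p + μ)) n A ⟩
        4 * (T * (2 * f)) + T * ((2 * p + μ) * (2 * p + μ)) + (8 * (n * (T * A)) + 28 * (n * n))
          ≤⟨ +-monoʳ-≤ (4 * (T * (2 * f)) + T * ((2 * p + μ) * (2 * p + μ)))
               (+-monoˡ-≤ (28 * (n * n)) (*-monoʳ-≤ 8 (*-monoʳ-≤ n atypical-count))) ⟩
        4 * (T * (2 * f)) + T * ((2 * p + μ) * (2 * p + μ)) + (8 * (n * n) + 28 * (n * n))
          ≡⟨ cong (4 * (T * (2 * f)) + T * ((2 * p + μ) * (2 * p + μ)) +_) (sym (*-distribʳ-+ (n * n) 8 28)) ⟩
        4 * (T * (2 * f)) + T * ((2 * p + μ) * (2 * p + μ)) + 36 * (n * n) ∎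
        where
        open ≤-Reasoning
        A = ∑ V atypical
        regroup : ∀ T f O m → 4 * (T * (f + O) + 7 * m) ≡ 4 * (T * f) + T * (4 * O) + 28 * m
        regroup = solve-∀
        regroup′ : ∀ F T S n A → F + T * (S + 8 * (n * A)) + 28 * (n * n) ≡ F + T * S + (8 * (n * (T * A)) + 28 * (n * n))
        regroup′ = solve-∀
        -- The complement of `I` consists of `S₁` and the part of `Mid` outside N(v).
        I : Fin N → Set
        I x = ¬ S₁ x × (¬ Mid x ⊎ Adj v x)
        I? : ∀ x → Dec (I x)
        I? x = ¬? (S₁? x) ×-dec (¬? (Mid? x) ⊎-dec adj? v x)
        sparse : ∀ {x y} → I x → I y → Q * w 1 x y < n → Adj v x × Adj v y
        sparse (x∉ , xI) (y∉ , yI) thin = resolve (proj₁ (far x∉ y∉ thin)) xI , resolve (proj₂ (far x∉ y∉ thin)) yI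
          where
          resolve : ∀ {A B : Set} → A → ¬ A ⊎ B → B
          resolve a (inj₁ ¬a) = contradiction a ¬a
          resolve a (inj₂ b)  = b
        ζ₁ ζ₂ r : Fin N → ℕ
        ζ₁ x = 𝟙 (S₁? x)
        ζ₂ x = 𝟙 (Mid? x ×-dec ¬? (adj? v x))
        r a = ∑ V λ b → α a b * ζ₂ b
        Δ M′ O : ℕ
        Δ = reach v
        M′ = ∑ V ζ₂
        O = ∑ V λ a → ∑ V λ b → α a b * (𝟙 (¬? (I? a)) * 𝟙 (¬? (I? b)))
        outside : ∀ x → 𝟙 (¬? (I? x)) ≤ ζ₁ x + ζ₂ x
        outside x = go (S₁? x) (Mid? x) (adj? v x)
          where
          go : (s : Dec (S₁ x)) (m : Dec (Mid x)) (a : Dec (Adj v x)) →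
               𝟙 (¬? (¬? s ×-dec (¬? m ⊎-dec a))) ≤ 𝟙 s + 𝟙 (m ×-dec ¬? a)
          go (yes _) _       _       = m≤m+n 1 _
          go (no _)  (no _)  _       = z≤n
          go (no _)  (yes _) (yes _) = z≤n
          go (no _)  (yes _) (no _)  = ≤-refl
        μ-split : M′ + Δ ≡ μ
        μ-split = trans (sym (∑-+ V _ _)) (∑-cong V λ x → go (Mid? x) (adj? v x))
          where
          go : ∀ {A B : Set} (m : Dec A) (a : Dec B) → 𝟙 (m ×-dec ¬? a) + 𝟙 a * 𝟙 m ≡ 𝟙 m
          go (yes _) (yes _) = refl
          go (yes _) (no _)  = refl
          go (no _)  (yes _) = refl
          go (no _)  (no _)  = refl
        r≤M′ : ∀ a → r a ≤ M′
        r≤M′ a = ∑-mono V λ b → α-drop a b _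
        -- By the choice of v no typical vertex has more neighbours in `Mid` than v. Together with
        -- `r≤M′` this gives 2r ≤ M′ + Δ, all of `Mid`; an atypical `a` is paid for with n.
        r≤Δ : ∀ a → a ∈ V → r a ≤ Δ + n * atypical a
        r≤Δ a a∈ = go (typical? a)
          where
          go : (d : Dec (Typical a)) → r a ≤ Δ + n * 𝟙 (¬? d)
          go (yes t) = ≤-trans (∑-mono V λ b → *-monoʳ-≤ (α a b) (𝟙-mono (Mid? b ×-dec ¬? (adj? v b)) (Mid? b) proj₁))
                         (≤-trans (best a a∈ t) (m≤m+n Δ _))
          go (no _)  = ≤-trans (∑-bounded V 1 λ b → *-mono-≤ (α≤1 a b) (𝟙≤1 (Mid? b ×-dec ¬? (adj? v b)))) (m≤n+m (n * 1) Δ)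
        crossing : ∑ V (λ a → ζ₁ a * (2 * r a)) ≤ p * μ + n * A
        crossing = begin
          ∑ V (λ a → ζ₁ a * (2 * r a))
            ≤⟨ ∑-mono∈ V (λ a a∈ → ≤-trans (*-monoʳ-≤ (ζ₁ a) (≤-trans (≤-reflexive (twice (r a)))
                 (≤-trans (+-mono-≤ (r≤M′ a) (r≤Δ a a∈)) (≤-reflexive (trans (sym (+-assoc M′ Δ _)) (cong (_+ n * atypical a) μ-split))))))
                 (split (ζ₁ a) μ (n * atypical a) (𝟙≤1 (S₁? a)))) ⟩
          ∑ V (λ a → ζ₁ a * μ + n * atypical a)
            ≡⟨ trans (∑-+ V _ _) (cong₂ _+_ (∑-*ʳ V μ ζ₁) (∑-*ˡ V n atypical)) ⟩
          p * μ + n * A ∎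
          where
          twice : ∀ a → 2 * a ≡ a + a
          twice = solve-∀
          split : ∀ z m s → z ≤ 1 → z * (m + s) ≤ z * m + s
          split z m s z≤1 = ≤-trans (≤-reflexive (*-distribˡ-+ z m s)) (+-monoʳ-≤ (z * m) (≤-trans (*-monoˡ-≤ s z≤1) (≤-reflexive (*-identityˡ s))))
        inner : ∑ V (λ a → ζ₂ a * r a) ≤ M′ * Δ + n * A
        inner = begin
          ∑ V (λ a → ζ₂ a * r a)
            ≤⟨ ∑-mono∈ V (λ a a∈ → ≤-trans (*-monoʳ-≤ (ζ₂ a) (r≤Δ a a∈)) (split (ζ₂ a) Δ (n * atypical a) (𝟙≤1 (Mid? a ×-dec ¬? (adj? v a))))) ⟩
          ∑ V (λ a → ζ₂ a * Δ + n * atypical a)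
            ≡⟨ trans (∑-+ V _ _) (cong₂ _+_ (∑-*ʳ V Δ ζ₂) (∑-*ˡ V n atypical)) ⟩
          M′ * Δ + n * A ∎
          where
          split : ∀ z m s → z ≤ 1 → z * (m + s) ≤ z * m + s
          split z m s z≤1 = ≤-trans (≤-reflexive (*-distribˡ-+ z m s)) (+-monoʳ-≤ (z * m) (≤-trans (*-monoˡ-≤ s z≤1) (≤-reflexive (*-identityˡ s))))
        O≤ : O ≤ p * p + (p * μ + n * A) + (M′ * Δ + n * A)
        O≤ = begin
          O
            ≤⟨ ∑-mono V (λ a → ∑-mono V λ b → *-monoʳ-≤ (α a b) (*-mono-≤ (outside a) (outside b))) ⟩
          ∑ V (λ a → ∑ V λ b → α a b * ((ζ₁ a + ζ₂ a) * (ζ₁ b + ζ₂ b)))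
            ≡⟨ ∑-cong V (λ a → ∑-cong V λ b → expand (α a b) (ζ₁ a) (ζ₂ a) (ζ₁ b) (ζ₂ b)) ⟩
          ∑ V (λ a → ∑ V λ b → α a b * (ζ₁ a * ζ₁ b) + (ζ₁ a * (α a b * ζ₂ b) + ζ₁ b * (α a b * ζ₂ a)) + ζ₂ a * (α a b * ζ₂ b))
            ≡⟨ trans (split₂ (λ a b → α a b * (ζ₁ a * ζ₁ b) + (ζ₁ a * (α a b * ζ₂ b) + ζ₁ b * (α a b * ζ₂ a))) (λ a b → ζ₂ a * (α a b * ζ₂ b)))
                 (cong (_+ S (λ a b → ζ₂ a * (α a b * ζ₂ b)))
                   (trans (split₂ (λ a b → α a b * (ζ₁ a * ζ₁ b)) (λ a b → ζ₁ a * (α a b * ζ₂ b) + ζ₁ b * (α a b * ζ₂ a)))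
                     (cong (S (λ a b → α a b * (ζ₁ a * ζ₁ b)) +_) (split₂ (λ a b → ζ₁ a * (α a b * ζ₂ b)) (λ a b → ζ₁ b * (α a b * ζ₂ a)))))) ⟩
          ∑ V (λ a → ∑ V λ b → α a b * (ζ₁ a * ζ₁ b)) +
          (∑ V (λ a → ∑ V λ b → ζ₁ a * (α a b * ζ₂ b)) + ∑ V (λ a → ∑ V λ b → ζ₁ b * (α a b * ζ₂ a))) +
          ∑ V (λ a → ∑ V λ b → ζ₂ a * (α a b * ζ₂ b))
            ≤⟨ +-mono-≤ (+-mono-≤ (≤-trans (∑-mono V λ a → ∑-mono V λ b → α-drop a b _) (≤-reflexive (∑-product V V ζ₁ ζ₁)))
                 (≤-reflexive both)) (≤-reflexive (∑-cong V λ a → ∑-*ˡ V (ζ₂ a) _)) ⟩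
          p * p + ∑ V (λ a → ζ₁ a * (2 * r a)) + ∑ V (λ a → ζ₂ a * r a)
            ≤⟨ +-mono-≤ (+-monoʳ-≤ (p * p) crossing) inner ⟩
          p * p + (p * μ + n * A) + (M′ * Δ + n * A) ∎
          where
          expand : ∀ x a b c d → x * ((a + b) * (c + d)) ≡ x * (a * c) + (a * (x * d) + c * (x * b)) + b * (x * d)
          expand = solve-∀
          S : (Fin N → Fin N → ℕ) → ℕ
          S g = ∑ V λ a → ∑ V (g a)
          split₂ : ∀ (g h : Fin N → Fin N → ℕ) → S (λ a b → g a b + h a b) ≡ S g + S h
          split₂ g h = trans (∑-cong V λ a → ∑-+ V (g a) (h a)) (∑-+ V _ _)
          both : ∑ V (λ a → ∑ V λ b → ζ₁ a * (α a b * ζ₂ b)) + ∑ V (λ a → ∑ V λ b → ζ₁ b * (α a b * ζ₂ a)) ≡ ∑ V (λ a → ζ₁ a * (2 * r a))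
          both = trans (cong₂ _+_ (∑-cong V λ a → ∑-*ˡ V (ζ₁ a) _)
                   (trans (∑-swap V V _) (∑-cong V λ b → trans (∑-*ˡ V (ζ₁ b) _) (cong (ζ₁ b *_) (∑-cong V λ a → cong (_* ζ₂ a) (α-sym a b))))))
                   (trans (sym (∑-+ V _ _)) (∑-cong V λ a → twice (ζ₁ a) (r a)))
            where
            twice : ∀ z r → z * r + z * r ≡ z * (2 * r)
            twice = solve-∀
        -- p² + pμ + M′Δ is at most (p + μ/2)² because M′ + Δ = μ.
        4O≤ : 4 * O ≤ (2 * p + μ) * (2 * p + μ) + 8 * (n * A)
        4O≤ = subst (λ μ → 4 * O ≤ (2 * p + μ) * (2 * p + μ) + 8 * (n * A)) μ-split
          (by-adding {X = 4 * O + 2 * (M′ * Δ)} (+-mono-≤ (*-monoʳ-≤ 4 (subst (λ μ → O ≤ p * p + (p * μ + n * A) + (M′ * Δ + n * A)) (sym μ-split) O≤))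
                                      (double-product M′ Δ)) 0
            (identity O p M′ Δ (n * A)))
          where
          identity : ∀ O p M Δ a →
            4 * O + (4 * (p * p + (p * (M + Δ) + a) + (M * Δ + a)) + (M * M + Δ * Δ)) + 0 ≡
            (2 * p + (M + Δ)) * (2 * p + (M + Δ)) + 8 * a + (4 * O + 2 * (M * Δ))
          identity = solve-∀

      split-loss : 4 * (T * E) ≤ 4 * (T * (2 * f)) + T * ((2 * p + μ) * (2 * p + μ)) + 36 * (n * n)
      split-loss = go (argmax V typical? reach)
        where
        go : (∀ v → v ∈ V → ¬ Typical v) ⊎ (∃ λ v → v ∈ V × Typical v × (∀ u → u ∈ V → Typical u → reach u ≤ reach v)) →
             4 * (T * E) ≤ 4 * (T * (2 * f)) + T * ((2 * p + μ) * (2 * p + μ)) + 36 * (n * n)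
        go (inj₁ none) = contradiction (proj₂ (proj₂ some-typical)) (none _ (proj₁ (proj₂ some-typical)))
        go (inj₂ (v , _ , typical , best)) = split-loss-at v typical best

    -- The extreme case in which no vertex is low and all are middle: at most n²/4 ordered edges
    -- avoid the neighbourhood of the best v, up to the error.
    small-loss : 4 * (T * E) ≤ 4 * (T * (2 * f)) + T * (n * n) + 36 * (n * n)
    small-loss = ≤-trans (split-loss nowhere everywhere (λ _ _ _ → refl , refl))
      (≤-reflexive (cong (λ s → 4 * (T * (2 * f)) + T * (s * s) + 36 * (n * n))
        (trans (cong (λ z → 2 * z + ∑ V (λ _ → 1)) (∑-zero V)) (trans (∑-const V 1) (*-identityʳ n)))))
      where
      nowhere : Fin N → Dec ⊥
      nowhere _ = no λ ()
      everywhere : Fin N → Dec (0 ≡ 0)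
      everywhere _ = yes refl

    module _ {m q δ D : ℕ} (n≡ : n ≡ m + q) (m≡ : m ≡ q + δ) (n≤Dδ : n ≤ D * δ) (D<n : D < n) (T≤n : T ≤ n)
      (edges : m * m + q * q ≤ E) where
      private
        Goal : Set
        Goal = T * E ≤ T * (2 * f + q * q) + (8 * D + 9) * (n * n)

        -- With `I` = N(v) at most q vertices lie outside `I`, so the edges that avoid it number at
        -- most q² as ordered pairs.
        dominant : ∀ v → Typical v → m ≤ deg v → Goal
        dominant v typical m≤d = begin
          T * E                                                   ≤⟨ loss v typical (adj? v) (λ va vc _ → va , vc) ⟩
          T * (2 * f + O) + 7 * (n * n)                           ≤⟨ +-mono-≤ (*-monoʳ-≤ T (+-monoʳ-≤ (2 * f) O≤))
                                                                      (*-monoˡ-≤ (n * n) (≤-trans (m≤m+n 7 (8 * D + 2)) (≤-reflexive (seven D)))) ⟩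
          T * (2 * f + q * q) + (8 * D + 9) * (n * n)             ∎
          where
          open ≤-Reasoning
          seven : ∀ D → 7 + (8 * D + 2) ≡ 8 * D + 9
          seven = solve-∀
          out : Fin N → ℕ
          out a = 𝟙 (¬? (adj? v a))
          O = ∑ V λ a → ∑ V λ b → α a b * (out a * out b)
          total : deg v + ∑ V out ≡ n
          total = trans (sym (∑-+ V _ _)) (trans (∑-cong V λ a → 𝟙-complement (adj? v a)) (trans (∑-const V 1) (*-identityʳ n)))
          out≤q : ∑ V out ≤ q
          out≤q = +-cancelˡ-≤ m _ _ (≤-trans (+-monoˡ-≤ (∑ V out) m≤d) (≤-reflexive (trans total n≡)))
          O≤ : O ≤ q * q
          O≤ = ≤-trans (∑-mono V λ a → ∑-mono V λ b → α-drop a b _)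
                 (≤-trans (≤-reflexive (∑-product V V out out)) (sq-mono out≤q))

        instance
          T≢0 : ℕ.NonZero T
          T≢0 = ℕ.>-nonZero 1≤T

        -- `g` is n/T rounded up strictly, a bound for the common neighbours of a thin pair, since
        -- `T ≤ Q`.
        g A : ℕ
        g = suc (n / T)
        A = ∑ V atypical

        Tg≤ : T * g ≤ T + n
        Tg≤ = ≤-trans (≤-reflexive (*-suc T (n / T))) (+-monoʳ-≤ T (≤-trans (≤-reflexive (*-comm T (n / T)))
                (≤-trans (m≤n+m _ (n ℕ.% T)) (≤-reflexive (sym (m≡m%n+[m/n]*n n T))))))

        thin<g : ∀ {x y} → Q * w 1 x y < n → w 1 x y < g
        thin<g {x} {y} lt = *-cancelˡ-< T _ _ (begin-strict
          T * w 1 x y               ≤⟨ *-monoˡ-≤ (w 1 x y) T≤Q ⟩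
          Q * w 1 x y               <⟨ lt ⟩
          n                         ≡⟨ m≡m%n+[m/n]*n n T ⟩
          n ℕ.% T + n / T * T       ≤⟨ +-monoˡ-≤ _ (<⇒≤ (m%n<n n T)) ⟩
          T + n / T * T             ≡⟨ *-comm (suc (n / T)) T ⟩
          T * g                     ∎)
          where open ≤-Reasoning

        h = δ / 2

        2h≤δ : 2 * h ≤ δ
        2h≤δ = ≤-trans (≤-reflexive (*-comm 2 h)) (≤-trans (m≤n+m _ (δ ℕ.% 2)) (≤-reflexive (sym (m≡m%n+[m/n]*n δ 2))))

        δ≤2h+1 : δ ≤ 2 * h + 1
        δ≤2h+1 = ≤-trans (≤-reflexive (m≡m%n+[m/n]*n δ 2)) (≤-trans (+-monoˡ-≤ _ (≤-pred (m%n<n δ 2))) (≤-reflexive (trans (+-comm 1 _) (cong (_+ 1) (*-comm h 2)))))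

        0<h : 0 < h
        0<h = positive (δ / 2) δ≤2h+1
          where
          positive : ∀ h → δ ≤ 2 * h + 1 → 0 < h
          positive zero δ≤1 = contradiction (≤-trans D<n (≤-trans n≤Dδ (≤-trans (*-monoʳ-≤ D δ≤1) (≤-reflexive (*-identityʳ D))))) (<-irrefl refl)
          positive (suc h) _ = s≤s z≤n

        module _ (i : ℕ) (i<h : i < h) where
          -- The two thresholds are coupled: vertices with few common neighbours have degree sum
          -- below n + g = m + q + g, so if one degree is at least q + i, the other is below m + g -
          -- i.
          S₁ Mid : Fin N → Set
          S₁ x = deg x < q + i
          Mid x = ¬ deg x < q + i × deg x + i < m + g

          S₁? : ∀ x → Dec (S₁ x)
          S₁? x = deg x ℕ.<? q + i

          Mid? : ∀ x → Dec (Mid x)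
          Mid? x = ¬? (deg x ℕ.<? q + i) ×-dec deg x + i ℕ.<? m + g

          lower : ∀ {x y} → Q * w 1 x y < n → ¬ S₁ y → deg x + i < m + g
          lower {x} {y} thin y∉ = +-cancelʳ-< q _ _ (begin-strict
            deg x + i + q           ≡⟨ trans (+-assoc (deg x) i q) (cong (deg x +_) (+-comm i q)) ⟩
            deg x + (q + i)         ≤⟨ +-monoʳ-≤ (deg x) (≮⇒≥ y∉) ⟩
            deg x + deg y           ≤⟨ degrees-common x y ⟩
            n + w 1 x y             <⟨ +-monoʳ-< n (thin<g {x} {y} thin) ⟩
            n + g                   ≡⟨ trans (cong (_+ g) n≡) (trans (+-assoc m q g) (trans (cong (m +_) (+-comm q g)) (sym (+-assoc m g q)))) ⟩
            m + g + q               ∎)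
            where open ≤-Reasoning

          far : ∀ {x y} → ¬ S₁ x → ¬ S₁ y → Q * w 1 x y < n → Mid x × Mid y
          far {x} {y} x∉ y∉ thin = (x∉ , lower {x} {y} thin y∉) , (y∉ , lower {y} {x} (subst (λ a → Q * a < n) (w-sym 1 x y) thin) x∉)

          -- A vertex of `S₁` passes both tests, because q + 2i stays below m for i < h; so it is
          -- counted twice, and a vertex of `Mid` once.
          size-split : 2 * ∑ V (λ x → 𝟙 (S₁? x)) + ∑ V (λ x → 𝟙 (Mid? x)) ≤
                       ∑ V (λ x → 𝟙 (deg x ℕ.<? q + i) + 𝟙 (deg x + i ℕ.<? m + g))
          size-split = ≤-trans (≤-reflexive (trans (cong (_+ ∑ V (λ x → 𝟙 (Mid? x))) (sym (∑-*ˡ V 2 _))) (sym (∑-+ V _ _)))) (∑-mono V each)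
            where
            i<′ : ∀ d → d < q + i → d + i < m + g
            i<′ d d< = begin-strict
              d + i           <⟨ +-monoˡ-< i d< ⟩
              q + i + i       ≤⟨ ≤-trans (≤-reflexive (+-assoc q i i)) (+-monoʳ-≤ q (+-mono-≤ (<⇒≤ i<h) (<⇒≤ i<h))) ⟩
              q + (h + h)     ≡⟨ cong (λ x → q + (h + x)) (sym (+-identityʳ h)) ⟩
              q + 2 * h       ≤⟨ +-monoʳ-≤ q 2h≤δ ⟩
              q + δ           ≡⟨ m≡ ⟨
              m               ≤⟨ m≤m+n m g ⟩
              m + g           ∎
              where open ≤-Reasoning
            each : ∀ x → 2 * 𝟙 (S₁? x) + 𝟙 (Mid? x) ≤ 𝟙 (deg x ℕ.<? q + i) + 𝟙 (deg x + i ℕ.<? m + g)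
            each x = go (deg x ℕ.<? q + i) (deg x + i ℕ.<? m + g)
              where
              go : ∀ (a : Dec (deg x < q + i)) (b : Dec (deg x + i < m + g)) → 2 * 𝟙 a + 𝟙 (¬? a ×-dec b) ≤ 𝟙 a + 𝟙 b
              go (yes _) (yes _) = ≤-refl
              go (yes a) (no ¬b) = contradiction (i<′ (deg x) a) ¬b
              go (no _)  (yes _) = ≤-refl
              go (no _)  (no _)  = z≤n

        count : ℕ → ℕ
        count i = ∑ V (λ x → 𝟙 (deg x ℕ.<? q + i) + 𝟙 (deg x + i ℕ.<? m + g))

        count≤2n : ∀ i → count i ≤ 2 * n
        count≤2n i = ≤-trans (∑-bounded V 2 λ x → +-mono-≤ (𝟙≤1 (deg x ℕ.<? q + i)) (𝟙≤1 (deg x + i ℕ.<? m + g))) (≤-reflexive (*-comm n 2))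

        module Spread (not-dominant : ∀ v → v ∈ V → ¬ (Typical v × m ≤ deg v)) where
          counts : ∑< h count + (m * m + q * q) ≤ n * m + n * A + n * g
          counts = begin
            ∑< h count + (m * m + q * q)
              ≤⟨ +-mono-≤ (≤-trans (≤-reflexive (∑<-swap h V _)) (∑-mono V λ x → thresholds h (deg x) (≤-trans (+-monoʳ-≤ q 2h≤δ) (≤-reflexive (sym m≡))))) edges ⟩
            ∑ V (λ x → (m ∸ deg x) + g) + E
              ≡⟨ sym (∑-+ V _ _) ⟩
            ∑ V (λ x → (m ∸ deg x) + g + deg x)
              ≤⟨ ∑-mono∈ V each ⟩
            ∑ V (λ x → m + n * atypical x + g)
              ≡⟨ trans (∑-+ V _ _) (cong₂ _+_ (trans (∑-+ V _ _) (cong₂ _+_ (∑-const V m) (∑-*ˡ V n atypical))) (∑-const V g)) ⟩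
            n * m + n * A + n * g ∎
            where
            open ≤-Reasoning
            -- No typical vertex is dominant, so its degree is below m and the truncated difference
            -- is exact; an atypical vertex is charged n.
            each : ∀ x → x ∈ V → (m ∸ deg x) + g + deg x ≤ m + n * atypical x + g
            each x x∈ = ≤-trans (≤-reflexive (swap (m ∸ deg x) g (deg x))) (+-monoˡ-≤ g (go (typical? x)))
              where
              swap : ∀ a g d → a + g + d ≡ a + d + g
              swap = solve-∀
              go : ∀ (t : Dec (Typical x)) → (m ∸ deg x) + deg x ≤ m + n * 𝟙 (¬? t)
              go (yes t) = ≤-trans (≤-reflexive (m∸n+n≡m (<⇒≤ (≰⇒> λ m≤d → not-dominant x x∈ (t , m≤d))))) (m≤m+n m _)
              go (no _)  = +-mono-≤ (m∸n≤m m (deg x)) (≤-trans (deg≤n x) (≤-reflexive (sym (*-identityʳ n))))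

          chosen : ∃ λ i → i < h × h * count i ≤ ∑< h count
          chosen = ∑<-low h count 0<h

          i₀ = proj₁ chosen
          i₀<h = proj₁ (proj₂ chosen)
          X = count i₀
          b = A + g + 1

          -- Here nm - m² - q² = qδ, so the average over h = δ/2 thresholds is 2q. The error is
          -- twice nb, where the summand 1 in `b` covers the rounding of δ/2.
          δX≤ : δ * X ≤ δ * (2 * q) + n * (2 * b)
          δX≤ = by-adding
            (+-mono-≤ (*-monoˡ-≤ X δ≤2h+1) (+-mono-≤ (*-monoʳ-≤ 2 (≤-trans (+-monoˡ-≤ (m * m + q * q) (proj₂ (proj₂ chosen))) counts)) (count≤2n i₀)))
            0 (trans (cong₂ (λ n m → δ * X + ((2 * h + 1) * X + (2 * (n * m + n * A + n * g) + 2 * n)) + 0) (trans n≡ (cong (_+ q) m≡)) m≡)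
                (trans (identity δ X h q A g) (cong₂ (λ n m → δ * (2 * q) + n * (2 * b) + (δ * X + (2 * (h * X + (m * m + q * q)) + X))) (sym (trans n≡ (cong (_+ q) m≡))) (sym m≡))))
            where
            identity : ∀ δ X h q A g →
              δ * X + ((2 * h + 1) * X + (2 * ((q + δ + q) * (q + δ) + (q + δ + q) * A + (q + δ + q) * g) + 2 * (q + δ + q))) + 0 ≡
              δ * (2 * q) + (q + δ + q) * (2 * (A + g + 1)) + (δ * X + (2 * (h * X + ((q + δ) * (q + δ) + q * q)) + X))
            identity = solve-∀

          Tb≤ : T * b ≤ 4 * n
          Tb≤ = begin
            T * (A + g + 1)             ≡⟨ distribute T A g ⟩
            T * A + T * g + T           ≤⟨ +-mono-≤ (+-mono-≤ atypical-count (≤-trans Tg≤ (+-monoˡ-≤ n T≤n))) T≤n ⟩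
            n + (n + n) + n             ≡⟨ four n ⟩
            4 * n                       ∎
            where
            open ≤-Reasoning
            distribute : ∀ T A g → T * (A + g + 1) ≡ T * A + T * g + T
            distribute = solve-∀
            four : ∀ n → n + (n + n) + n ≡ 4 * n
            four = solve-∀

          -- X exceeds 2q by at most 2Db, which is small compared with n.
          X²≤ : T * (X * X) ≤ 4 * (T * (q * q)) + 32 * (D * (n * n))
          X²≤ = go (≤-total X (2 * q))
            where
            open ≤-Reasoning
            go : X ≤ 2 * q ⊎ 2 * q ≤ X → T * (X * X) ≤ 4 * (T * (q * q)) + 32 * (D * (n * n))
            go (inj₁ X≤) = ≤-trans (*-monoʳ-≤ T (sq-mono X≤)) (≤-trans (≤-reflexive (identity T q)) (m≤m+n _ _))
              where
              identity : ∀ T q → T * (2 * q * (2 * q)) ≡ 4 * (T * (q * q))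
              identity = solve-∀
            go (inj₂ 2q≤X) = begin
              T * (X * X)                                                ≡⟨ cong (λ X → T * (X * X)) X≡ ⟩
              T * ((2 * q + r) * (2 * q + r))                            ≡⟨ id₁ T q r ⟩
              4 * (T * (q * q)) + T * r * (2 * q + (2 * q + r))          ≤⟨ +-monoʳ-≤ (4 * (T * (q * q))) (*-mono-≤ Tr≤ 4q+r≤) ⟩
              4 * (T * (q * q)) + 8 * D * n * (4 * n)                    ≡⟨ cong (4 * (T * (q * q)) +_) (id₂ D n) ⟩
              4 * (T * (q * q)) + 32 * (D * (n * n))                     ∎
              where
              r = X ∸ 2 * q
              X≡ : X ≡ 2 * q + r
              X≡ = sym (m+[n∸m]≡n 2q≤X)
              id₁ : ∀ T q r → T * ((2 * q + r) * (2 * q + r)) ≡ 4 * (T * (q * q)) + T * r * (2 * q + (2 * q + r))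
              id₁ = solve-∀
              id₂ : ∀ D n → 8 * D * n * (4 * n) ≡ 32 * (D * (n * n))
              id₂ = solve-∀
              4q+r≤ : 2 * q + (2 * q + r) ≤ 4 * n
              4q+r≤ = ≤-trans (+-mono-≤ (*-monoʳ-≤ 2 (≤-trans (m≤n+m q m) (≤-reflexive (sym n≡)))) (≤-trans (≤-reflexive (sym X≡)) (count≤2n i₀)))
                        (≤-reflexive (sym (*-distribʳ-+ n 2 2)))
              δr≤ : δ * r ≤ n * (2 * b)
              δr≤ = +-cancelˡ-≤ (δ * (2 * q)) _ _ (≤-trans (≤-reflexive (trans (sym (*-distribˡ-+ δ (2 * q) r)) (cong (δ *_) (sym X≡)))) δX≤)
              r≤ : r ≤ D * (2 * b)
              r≤ = *-cancelˡ-≤ n {{ℕ.>-nonZero 0<n}} (begin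
                n * r                   ≤⟨ *-monoˡ-≤ r n≤Dδ ⟩
                D * δ * r               ≡⟨ *-assoc D δ r ⟩
                D * (δ * r)             ≤⟨ *-monoʳ-≤ D δr≤ ⟩
                D * (n * (2 * b))       ≡⟨ swap D n (2 * b) ⟩
                n * (D * (2 * b))       ∎)
                where
                swap : ∀ a b c → a * (b * c) ≡ b * (a * c)
                swap = solve-∀
              Tr≤ : T * r ≤ 8 * D * n
              Tr≤ = begin
                T * r                   ≤⟨ *-monoʳ-≤ T r≤ ⟩
                T * (D * (2 * b))       ≡⟨ swap T D b ⟩
                2 * D * (T * b)         ≤⟨ *-monoʳ-≤ (2 * D) Tb≤ ⟩
                2 * D * (4 * n)         ≡⟨ swap′ D n ⟩
                8 * D * n               ∎
                where
                swap : ∀ T D b → T * (D * (2 * b)) ≡ 2 * D * (T * b)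
                swap = solve-∀
                swap′ : ∀ D n → 2 * D * (4 * n) ≡ 8 * D * n
                swap′ = solve-∀

          spread : Goal
          spread = *-cancelˡ-≤ 4 (begin
            4 * (T * E)
              ≤⟨ split-loss (S₁? i₀ i₀<h) (Mid? i₀ i₀<h) (λ {x} {y} → far i₀ i₀<h {x} {y}) ⟩
            4 * (T * (2 * f)) + T * (Z * Z) + 36 * (n * n)
              ≤⟨ +-monoˡ-≤ (36 * (n * n)) (+-monoʳ-≤ (4 * (T * (2 * f))) (≤-trans (*-monoʳ-≤ T (sq-mono (size-split i₀ i₀<h))) X²≤)) ⟩
            4 * (T * (2 * f)) + (4 * (T * (q * q)) + 32 * (D * (n * n))) + 36 * (n * n)
              ≡⟨ identity T (2 * f) (q * q) D (n * n) ⟩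
            4 * (T * (2 * f + q * q) + (8 * D + 9) * (n * n)) ∎)
            where
            open ≤-Reasoning
            Z = 2 * ∑ V (λ x → 𝟙 (S₁? i₀ i₀<h x)) + ∑ V (λ x → 𝟙 (Mid? i₀ i₀<h x))
            identity : ∀ T f q D n → 4 * (T * f) + (4 * (T * q) + 32 * (D * n)) + 36 * n ≡ 4 * (T * (f + q) + (8 * D + 9) * n)
            identity = solve-∀

      big-loss : Goal
      big-loss = go (argmax V (λ v → typical? v ×-dec m ℕ.≤? deg v) (λ _ → 0))
        where
        go : (∀ v → v ∈ V → ¬ (Typical v × m ≤ deg v)) ⊎ (∃ λ v → v ∈ V × (Typical v × m ≤ deg v) × (∀ u → u ∈ V → Typical u × m ≤ deg u → 0 ≤ 0)) → Goal
        go (inj₁ none) = Spread.spread none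
        go (inj₂ (v , _ , (typical , m≤d) , _)) = dominant v typical m≤d

  -- If every two vertices are joined by many walks of length 4, parity never obstructs, whatever
  -- the edges in question.
  far-from-balanced : R * R ≤ H →
    (∀ {a d} → a ∈ V → d ∈ V → ¬ (R * R * w 3 a d ≤ n * (n * n))) →
    ∀ {m q δ D} → n ≡ m + q → m ≡ q + δ → n ≤ D * δ → D < n → T ≤ n → m * m + q * q ≤ E →
    T * E ≤ T * (2 * f + q * q) + (8 * D + 9) * (n * n)
  far-from-balanced R²≤H many-walks =
    Typicality.big-loss (few-common (λ a∈ _ d∈ _ _ → dense a∈ d∈))
    where
    dense : ∀ {a d} → a ∈ V → d ∈ V → Dense H 3 a d
    dense {a} {d} a∈ d∈ = decide (dense? H 3 a d)
      where
      decide : Dec (Dense H 3 a d) → Dense H 3 a d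
      decide (yes p) = p
      decide (no ¬p) = contradiction (≤-trans (*-monoˡ-≤ (w 3 a d) R²≤H)
        (≤-trans (<⇒≤ (≰⇒> ¬p)) (≤-reflexive (cong (λ x → n * (n * x)) (*-identityʳ n))))) (many-walks a∈ d∈)

  -- If there are many walks of length 3 from a to b, one shift along the good edge bd yields walks
  -- of length 4 from a to d. If there are few, then a and b are `Twins` with κ = `Q`, and the graph
  -- is nearly bipartite; the value of R is 2κD, as that record demands.
  balanced : ∀ {D q} → R ≡ 2 * (16 * T ^ 4 * D) → 64 * 2816 ≤ D → 128 ≤ n → 16 * D ≤ n →
    ladder 64 (suc j) * K < n → (∀ x → x ∈ V → q ≤ deg x) → D * n ≤ 2 * (D * q) + n → n * n < 2 * E →
    ¬ (D * (n * n) ≤ 8 * (D * f) + 22704 * (n * n)) →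
    4 * (T * E) ≤ 4 * (T * (2 * f)) + T * (n * n) + 36 * (n * n)
  balanced {D} {q} R≡ D-large 128≤n 16D≤n ladder-large min Dn≤ many not-bipartite =
    Typicality.small-loss (few-common dense)
    where
    dense : ∀ {a b d} → a ∈ V → b ∈ V → d ∈ V → Good b d → Dense Q 1 a b → Dense H 3 a d
    dense {a} {b} {d} a∈ b∈ d∈ good-bd ab = by-cases (dense? R 2 a b)
      where
      by-cases : Dec (Dense R 2 a b) → Dense H 3 a d
      by-cases (yes p) = Dense-sym {H} 3 {d} {a} (shift {B₁} {G₁} {R} 1 {b} {d} {a} (proj₁ (proj₁ (proj₂ (proj₂ (proj₂ good-bd))))) ≤-refl (Dense-sym {R} 2 {a} {b} p))
      by-cases (no ¬p) = contradiction (near-bipartite record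
        { D-large = D-large ; 128≤n = 128≤n ; 16D≤n = 16D≤n ; large-n = ladder-large ; min = min ; Dn≤ = Dn≤ ; many = many
        ; a∈ = a∈ ; b∈ = b∈ ; 1≤κ = ≤-trans 1≤T T≤Q ; common = ≤-trans (≤-reflexive (sym (*-identityʳ n))) ab
        ; few = ≤-trans (≤-reflexive (cong (_* w 2 a b) (sym R≡))) (≤-trans (<⇒≤ (≰⇒> ¬p)) (≤-reflexive (cong (n *_) (*-identityʳ n)))) }) not-bipartite

-- Deletion of low degrees and choice of the parameters

degree : ∀ {N} → Graph N → List (Fin N) → Fin N → ℕ
degree Γ V = Walks.deg Γ V

degreeSum : ∀ {N} → Graph N → List (Fin N) → ℕ
degreeSum Γ V = ∑ V (degree Γ V)

unique-remove : ∀ {X : Set} (xs : List X) {x ys} → Unique (xs ++ x ∷ ys) → Unique (xs ++ ys)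
unique-remove []        (_ ∷ u)  = u
unique-remove (z ∷ xs) {x} {ys} (z∉ ∷ u) = skip xs z∉ ∷ unique-remove xs u
  where
  skip : ∀ xs → All (z ≢_) (xs ++ x ∷ ys) → All (z ≢_) (xs ++ ys)
  skip []       (_ ∷ ps) = ps
  skip (w ∷ ws) (p ∷ ps) = p ∷ skip ws ps

-- Deleting vertices of degree below q lowers q by one each time; m² + q² drops by at least the number of lost edges.
reduce : ∀ {N} (Γ : Graph N) m s q V → Unique V → length V ≡ m + q → m * m + q * q + s ≤ degreeSum Γ V →
         ∃ λ V′ → ∃ λ q′ → Unique V′ × length V′ ≡ m + q′ × q′ ≤ q × m * m + q′ * q′ + s ≤ degreeSum Γ V′ ×
                           (∀ x → x ∈ V′ → q′ ≤ degree Γ V′ x)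
reduce Γ m s zero    V u len edges = V , 0 , u , len , ≤-refl , edges , λ _ _ → z≤n
reduce {N} Γ m s (suc q) V u len edges = go (argmax V (λ x → degree Γ V x ℕ.<? suc q) (λ _ → 0))
  where
  Result : Set
  Result = ∃ λ V′ → ∃ λ q′ → Unique V′ × length V′ ≡ m + q′ × q′ ≤ suc q × m * m + q′ * q′ + s ≤ degreeSum Γ V′ ×
                             (∀ x → x ∈ V′ → q′ ≤ degree Γ V′ x)
  open Walks Γ V using (α; α-sym; adj?)
  delete : ∀ xs {x ys} → V ≡ xs ++ x ∷ ys → degree Γ V x < suc q → Result
  delete xs {x} {ys} refl (s≤s d≤q) =
    let V″ , q″ , u″ , len″ , q″≤ , edges″ , min″ = reduce Γ m s q V′ (unique-remove xs u) len′ edges′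
    in V″ , q″ , u″ , len″ , m≤n⇒m≤1+n q″≤ , edges″ , min″
    where
    V′ = xs ++ ys
    len′ : length V′ ≡ m + q
    len′ = suc-injective (trans (trans (cong suc (length-++ xs)) (trans (sym (+-suc (length xs) (length ys))) (sym (length-++ xs)))) (trans len (+-suc m q)))
    ∑-remove : ∀ (g : Fin N → ℕ) → ∑ (xs ++ x ∷ ys) g ≡ g x + ∑ V′ g
    ∑-remove g = trans (∑-++ xs (x ∷ ys) g) (trans (swap (∑ xs g) (g x) (∑ ys g)) (cong (g x +_) (sym (∑-++ xs ys g))))
      where
      swap : ∀ a b c → a + (b + c) ≡ b + (a + c)
      swap = solve-∀
    sum-split : degreeSum Γ V ≤ degreeSum Γ V′ + 2 * q
    sum-split = begin
      degreeSum Γ V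
        ≡⟨ ∑-remove _ ⟩
      degree Γ V x + ∑ V′ (λ a → ∑ (xs ++ x ∷ ys) (α a))
        ≡⟨ cong (degree Γ V x +_) (trans (∑-cong V′ λ a → ∑-remove (α a)) (∑-+ V′ _ _)) ⟩
      degree Γ V x + (∑ V′ (λ a → α a x) + degreeSum Γ V′)
        ≤⟨ +-mono-≤ d≤q (+-monoˡ-≤ (degreeSum Γ V′) (≤-trans (≤-trans (m≤n+m _ (α x x)) (≤-reflexive
             (trans (cong (α x x +_) (∑-cong V′ λ a → α-sym a x)) (sym (∑-remove (α x)))))) d≤q)) ⟩
      q + (q + degreeSum Γ V′)
        ≡⟨ swap q (degreeSum Γ V′) ⟩
      degreeSum Γ V′ + 2 * q ∎
      where
      open ≤-Reasoning
      swap : ∀ q d → q + (q + d) ≡ d + 2 * q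
      swap = solve-∀
    edges′ : m * m + q * q + s ≤ degreeSum Γ V′
    edges′ = by-adding (≤-trans edges sum-split) 1 (identity (m * m) q s (degreeSum Γ V′))
      where
      identity : ∀ m q s d → m + q * q + s + (d + 2 * q) + 1 ≡ d + (m + suc q * suc q + s)
      identity = solve-∀
  go : (∀ x → x ∈ V → ¬ degree Γ V x < suc q) ⊎ (∃ λ x → x ∈ V × degree Γ V x < suc q × (∀ y → y ∈ V → degree Γ V y < suc q → 0 ≤ 0)) → Result
  go (inj₁ none) = V , suc q , u , len , ≤-refl , edges , λ x x∈ → ≮⇒≥ (none x x∈)
  go (inj₂ (x , x∈ , low , _)) with xs , ys , eq ← ∈-∃++ x∈ = delete xs eq low

module BigParameters (D : ℕ) where
  T t : ℕ
  -- `big-loss` is applied with `2 * D`, where its error is (16D + 9)n²/T; this value makes it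
  -- n²/(2D).
  T = 2 * D * (16 * D + 9)
  -- Few walks of length 4 would give t · hδ ≤ 4n² ≤ 32D² · hδ; one more than 32D² makes this a
  -- contradiction.
  t = 32 * (D * D) + 1

-- The summand `8 * D` keeps the rounding of n/(4D) harmless, and the factor 4 covers the deleted
-- vertices, as at least a quarter survives.
big-bound : ℕ → ℕ → ℕ
big-bound j D = 8 * D + 4 * suc (Constants.threshold j T t + T + 2 * D)
  where open BigParameters D

-- Moving h = n/(4D) from m to q lowers m² + q² by at least hδ. This surplus of edges survives
-- `reduce` and contradicts `few-walks⇒few-edges`, so many walks of length 4 join any two remaining
-- vertices. The price is m² - m₁² ≤ 2hm, which is at most n²/(2D).
big : ∀ j D → 1 ≤ D → ∀ {N f} {Γ : Graph N} (c : Coloring Γ f) →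
  (∀ v → CycleCopy Γ (4 + j) v → Rainbow c (4 + j) v) → ∀ V → Unique V → big-bound j D ≤ length V →
  ∀ {m q δ} → length V ≡ m + q → m ≡ q + δ → length V ≤ D * δ → m * m + q * q ≤ degreeSum Γ V →
  D * (m * m) ≤ D * (2 * f) + length V * length V
big j D 1≤D {N} {f} {Γ} c rainbow V unique-V large {m} {q} {δ} n≡ m≡ n≤Dδ edges =
  conclude (reduce Γ m₁ (h * δ) q₁ V unique-V (trans n≡ shifted) edges₁)
  where
  open BigParameters D
  open ≤-Reasoning
  n₀ = length V
  instance
    4D≢0 : ℕ.NonZero (4 * D)
    4D≢0 = ℕ.>-nonZero (≤-trans 1≤D (m≤n*m D 4))
    D≢0 : ℕ.NonZero D
    D≢0 = ℕ.>-nonZero 1≤D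
  h ρ m₁ q₁ : ℕ
  h = n₀ / (4 * D)
  ρ = δ ∸ 4 * h
  -- This is m - h without subtraction, since m = q + 4h + ρ.
  m₁ = q + 3 * h + ρ
  q₁ = q + h
  4Dh≤n : 4 * D * h ≤ n₀
  4Dh≤n = ≤-trans (≤-reflexive (*-comm (4 * D) h)) (≤-trans (m≤n+m _ (n₀ ℕ.% (4 * D))) (≤-reflexive (sym (m≡m%n+[m/n]*n n₀ (4 * D)))))
  n≤8Dh : n₀ ≤ 8 * D * h
  n≤8Dh = by-adding {X = 2 * n₀ + 8 * D} (+-mono-≤ (*-monoʳ-≤ 2 (begin
      n₀                                    ≡⟨ m≡m%n+[m/n]*n n₀ (4 * D) ⟩
      n₀ ℕ.% (4 * D) + h * (4 * D)          ≤⟨ +-monoˡ-≤ (h * (4 * D)) (<⇒≤ (m%n<n n₀ (4 * D))) ⟩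
      4 * D + h * (4 * D)                   ∎)) (≤-trans (m≤m+n _ _) large)) 0 (identity n₀ D h)
    where
    identity : ∀ n D h → n + (2 * (4 * D + h * (4 * D)) + n) + 0 ≡ 8 * D * h + (2 * n + 8 * D)
    identity = solve-∀
  4h≤δ : 4 * h ≤ δ
  4h≤δ = *-cancelˡ-≤ D (≤-trans (≤-reflexive (reorder D h)) (≤-trans 4Dh≤n n≤Dδ))
    where
    reorder : ∀ D h → D * (4 * h) ≡ 4 * D * h
    reorder = solve-∀
  δ≡ : δ ≡ 4 * h + ρ
  δ≡ = sym (m+[n∸m]≡n 4h≤δ)
  shifted : m + q ≡ m₁ + q₁
  shifted = trans (cong (_+ q) (trans m≡ (cong (q +_) δ≡))) (identity q h ρ)
    where
    identity : ∀ q h ρ → q + (4 * h + ρ) + q ≡ q + 3 * h + ρ + (q + h)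
    identity = solve-∀
  -- The drop is 2hδ - 2h², and δ ≥ 4h leaves hδ with room to spare.
  edges₁ : m₁ * m₁ + q₁ * q₁ + h * δ ≤ degreeSum Γ V
  edges₁ = ≤-trans (≤-slack (2 * (h * h) + h * ρ) (trans (cong (λ δ → m₁ * m₁ + q₁ * q₁ + h * δ + (2 * (h * h) + h * ρ)) δ≡)
             (trans (identity q h ρ) (cong (λ m → m * m + q * q) (sym (trans m≡ (cong (q +_) δ≡))))))) edges
    where
    identity : ∀ q h ρ → (q + 3 * h + ρ) * (q + 3 * h + ρ) + (q + h) * (q + h) + h * (4 * h + ρ) + (2 * (h * h) + h * ρ) ≡
                         (q + (4 * h + ρ)) * (q + (4 * h + ρ)) + q * q
    identity = solve-∀
  0<n₀ : 0 < n₀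
  0<n₀ = ≤-trans (≤-trans 1≤D (≤-trans (m≤n*m D 8) (m≤m+n _ _))) large

  module Reduced {V′ q′} (unique-V′ : Unique V′) (len : length V′ ≡ m₁ + q′) (q′≤q₁ : q′ ≤ q₁)
    (edges′ : m₁ * m₁ + q′ * q′ + h * δ ≤ degreeSum Γ V′) (min : ∀ x → x ∈ V′ → q′ ≤ degree Γ V′ x) where
    open Constants j T t using (threshold; H)

    n : ℕ
    n = length V′

    σ δ′ : ℕ
    σ = q₁ ∸ q′
    δ′ = σ + (2 * h + ρ)

    m₁≡ : m₁ ≡ q′ + δ′
    m₁≡ = trans (identity q h ρ) (trans (cong (_+ (2 * h + ρ)) (sym (m+[n∸m]≡n q′≤q₁))) (+-assoc q′ σ (2 * h + ρ)))
      where
      identity : ∀ q h ρ → q + 3 * h + ρ ≡ q + h + (2 * h + ρ)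
      identity = solve-∀

    n≤n₀ : n ≤ n₀
    n≤n₀ = ≤-trans (≤-reflexive len) (≤-trans (+-monoʳ-≤ m₁ q′≤q₁) (≤-reflexive (sym (trans n≡ shifted))))

    n≤2Dδ′ : n ≤ 2 * D * δ′
    n≤2Dδ′ = ≤-trans n≤n₀ (≤-trans n≤Dδ (≤-slack (2 * D * σ + D * ρ) (trans (cong (λ δ → D * δ + (2 * D * σ + D * ρ)) δ≡) (identity D h ρ σ))))
      where
      identity : ∀ D h ρ σ → D * (4 * h + ρ) + (2 * D * σ + D * ρ) ≡ 2 * D * (σ + (2 * h + ρ))
      identity = solve-∀

    n₀≤4n : n₀ ≤ 4 * n
    n₀≤4n = ≤-trans (≤-slack (2 * q + 8 * h + 3 * ρ + 4 * q′) (trans (cong (_+ (2 * q + 8 * h + 3 * ρ + 4 * q′)) (trans n≡ shifted)) (identity q h ρ q′)))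
              (≤-reflexive (cong (4 *_) (sym len)))
      where
      identity : ∀ q h ρ q′ → q + 3 * h + ρ + (q + h) + (2 * q + 8 * h + 3 * ρ + 4 * q′) ≡ 4 * (q + 3 * h + ρ + q′)
      identity = solve-∀

    large′ : suc (threshold + T + 2 * D) ≤ n
    large′ = *-cancelˡ-≤ 4 (≤-trans (≤-trans (m≤n+m _ (8 * D)) large) n₀≤4n)

    0<n : 0 < n
    0<n = ≤-trans (s≤s z≤n) large′

    1≤T : 1 ≤ T
    1≤T = *-mono-≤ {1} {2 * D} (≤-trans 1≤D (m≤n*m D 2)) (≤-trans (m≤n+m 1 (16 * D + 8)) (≤-reflexive (+-assoc (16 * D) 8 1)))

    2≤T : 2 ≤ T
    2≤T = *-mono-≤ {2} {2 * D} (*-monoʳ-≤ 2 1≤D) (≤-trans (m≤n+m 1 (16 * D + 8)) (≤-reflexive (+-assoc (16 * D) 8 1)))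

    t²≤H : t * t ≤ H
    t²≤H = *-mono-≤ (m≤n*m t 2) (≤-trans (m≤n*m t 2) (m≤m*n (2 * t) T {{ℕ.>-nonZero 1≤T}}))

    -- With degrees at least q′, few walks would force the degree sum down to m₁² + q′² + 4n²/t,
    -- which is less than the surplus hδ allows.
    many-walks : ∀ {a d} → a ∈ V′ → d ∈ V′ → ¬ (t * t * Walks.w Γ V′ 3 a d ≤ n * (n * n))
    many-walks {a} {d} a∈ d∈ few = contradiction (*-cancelʳ-≤ t (32 * (D * D)) (h * δ) {{hδ≢0}} (≤-trans thδ≤ 4n²≤)) (<⇒≱ (m<m+n (32 * (D * D)) (s≤s z≤n)))
      where
      thδ≤ : t * (h * δ) ≤ 4 * (n * n)
      thδ≤ = by-adding (≤-trans (*-monoʳ-≤ t (+-monoˡ-≤ (2 * (n * q′)) edges′))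
               (Structure.few-walks⇒few-edges Γ V′ unique-V′ {q′} {t} {a} {d} 0<n (min a a∈) (min d d∈) few)) 0
               (trans (cong (λ n → t * (h * δ) + (t * (n * n + 2 * (q′ * q′)) + 4 * (n * n)) + 0) len)
                 (trans (identity t m₁ q′ (h * δ)) (cong (λ n → 4 * (n * n) + t * (m₁ * m₁ + q′ * q′ + h * δ + 2 * (n * q′))) (sym len))))
        where
        identity : ∀ t m q s → t * s + (t * ((m + q) * (m + q) + 2 * (q * q)) + 4 * ((m + q) * (m + q))) + 0 ≡
                   4 * ((m + q) * (m + q)) + t * (m * m + q * q + s + 2 * ((m + q) * q))
        identity = solve-∀
      n²≤ : n₀ * n₀ ≤ 8 * (D * D) * (h * δ)
      n²≤ = ≤-trans (*-mono-≤ n≤8Dh n≤Dδ) (≤-reflexive (identity D h δ))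
        where
        identity : ∀ D h δ → 8 * D * h * (D * δ) ≡ 8 * (D * D) * (h * δ)
        identity = solve-∀
      4n²≤ : 4 * (n * n) ≤ 32 * (D * D) * (h * δ)
      4n²≤ = ≤-trans (*-monoʳ-≤ 4 (≤-trans (sq-mono n≤n₀) n²≤)) (≤-reflexive (identity (D * D) (h * δ)))
        where
        identity : ∀ d x → 4 * (8 * d * x) ≡ 32 * d * x
        identity = solve-∀
      hδ≢0 : ℕ.NonZero (h * δ)
      hδ≢0 = positive (h * δ) n²≤
        where
        positive : ∀ x → n₀ * n₀ ≤ 8 * (D * D) * x → ℕ.NonZero x
        positive zero le = contradiction (≤-trans (*-mono-≤ 0<n₀ 0<n₀) (≤-trans le (≤-reflexive (*-zeroʳ (8 * (D * D)))))) λ ()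
        positive (suc x) _ = _

    bound : T * degreeSum Γ V′ ≤ T * (2 * f + q′ * q′) + (8 * (2 * D) + 9) * (n * n)
    bound = SameColour.far-from-balanced
      (record { c = c ; j = j ; rainbow = rainbow ; V = V′ ; unique-V = unique-V′ ; T = T ; R = t ; 2≤T = 2≤T
              ; large = ≤-<-trans (m≤m+n threshold (T + 2 * D)) (≤-trans (≤-reflexive (cong suc (sym (+-assoc threshold T (2 * D))))) large′) })
      t²≤H many-walks
      len m₁≡ n≤2Dδ′ (≤-trans (s≤s (m≤n+m (2 * D) (threshold + T))) large′)
      (≤-trans (≤-trans (m≤n+m T threshold) (m≤m+n _ (2 * D))) (<⇒≤ large′))
      (≤-trans (m≤m+n _ (h * δ)) edges′)

    final : D * (m * m) ≤ D * (2 * f) + n₀ * n₀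
    final = *-cancelˡ-≤ 2 (begin
      2 * (D * (m * m))
        ≤⟨ by-adding (+-mono-≤ 2Dm₁²≤ (≤-trans (*-monoˡ-≤ m 4Dh≤n) (*-monoʳ-≤ n₀ m≤n₀))) (2 * D * (h * h))
             (trans (cong (λ m → 2 * (D * (m * m)) + (2 * (D * (2 * f)) + n₀ * n₀ + n₀ * n₀) + 2 * D * (h * h)) m≡m₁+h)
               (trans (identity D m₁ h (2 * f) (n₀ * n₀)) (cong (λ m → 2 * (D * (2 * f)) + n₀ * n₀ + n₀ * n₀ + (2 * (D * (m₁ * m₁)) + 4 * D * h * m)) (sym m≡m₁+h)))) ⟩
      2 * (D * (2 * f)) + n₀ * n₀ + n₀ * n₀
        ≡⟨ halves (D * (2 * f)) (n₀ * n₀) ⟩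
      2 * (D * (2 * f) + n₀ * n₀) ∎)
      where
      m≤n₀ : m ≤ n₀
      m≤n₀ = ≤-trans (m≤m+n m q) (≤-reflexive (sym n≡))
      m≡m₁+h : m ≡ m₁ + h
      m≡m₁+h = trans m≡ (trans (cong (q +_) δ≡) (move q h ρ))
        where
        move : ∀ q h ρ → q + (4 * h + ρ) ≡ q + 3 * h + ρ + h
        move = solve-∀
      identity : ∀ D m h f n → 2 * (D * ((m + h) * (m + h))) + (2 * (D * f) + n + n) + 2 * D * (h * h) ≡
                 2 * (D * f) + n + n + (2 * (D * (m * m)) + 4 * D * h * (m + h))
      identity = solve-∀
      halves : ∀ a b → 2 * a + b + b ≡ 2 * (a + b)
      halves = solve-∀
      2Dm₁²≤ : 2 * (D * (m₁ * m₁)) ≤ 2 * (D * (2 * f)) + n₀ * n₀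
      2Dm₁²≤ = ≤-trans (*-cancelˡ-≤ (16 * D + 9) {{ℕ.>-nonZero (≤-trans (m≤n+m 1 (16 * D + 8)) (≤-reflexive (+-assoc (16 * D) 8 1)))}}
                 (by-adding (≤-trans (*-monoʳ-≤ T (≤-trans (m≤m+n _ (h * δ)) edges′)) bound) 0 (scale D (m₁ * m₁) (q′ * q′) (2 * f) (n * n))))
                 (+-monoʳ-≤ _ (sq-mono n≤n₀))
        where
        scale : ∀ D m q f n → (16 * D + 9) * (2 * (D * m)) + (2 * D * (16 * D + 9) * (f + q) + (8 * (2 * D) + 9) * n) + 0 ≡
                (16 * D + 9) * (2 * (D * f) + n) + 2 * D * (16 * D + 9) * (m + q)
        scale = solve-∀

  conclude : (∃ λ V′ → ∃ λ q′ → Unique V′ × length V′ ≡ m₁ + q′ × q′ ≤ q₁ × m₁ * m₁ + q′ * q′ + h * δ ≤ degreeSum Γ V′ ×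
                           (∀ x → x ∈ V′ → q′ ≤ degree Γ V′ x)) → D * (m * m) ≤ D * (2 * f) + n₀ * n₀
  conclude (V′ , q′ , unique-V′ , len , q′≤q₁ , edges′ , min) = Reduced.final unique-V′ len q′≤q₁ edges′ min

-- 180224 is 64 · 2816, the smallest density constant allowed in `Twins`. T = 36D turns the error
-- 36n² of `small-loss` into n²/D, and R is the threshold 2κD with κ = 16T⁴. The values are opaque;
-- later only the relations listed here are used.
module SmallParameters (j D : ℕ) where
  abstract
    D′ T R ladder-bound : ℕ
    D′ = 180224 * D
    T  = 36 * D
    R  = 2 * (16 * T ^ 4 * D′)
    ladder-bound = ladder 64 (suc j)

    D≤D′ : D ≤ D′
    D≤D′ = m≤n*m D 180224

    D′-large : 1 ≤ D → 64 * 2816 ≤ D′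
    D′-large 1≤D = *-monoʳ-≤ 180224 {1} {D} 1≤D

    T≡ : T ≡ 36 * D
    T≡ = refl

    R≡ : R ≡ 2 * (16 * T ^ 4 * D′)
    R≡ = refl

    ladder≤ : ladder 64 (suc j) ≤ ladder-bound
    ladder≤ = ≤-refl

    unscale : ∀ {x f y} → D′ * x ≤ 8 * (D′ * f) + 22704 * y → D * x ≤ 8 * (D * f) + y
    unscale {x} {f} {y} le = *-cancelˡ-≤ {D * x} {8 * (D * f) + y} 180224 (≤-trans (≤-trans (≤-reflexive (sym (*-assoc 180224 D x))) le)
      (≤-trans (+-monoʳ-≤ (8 * (180224 * D * f)) (*-monoˡ-≤ y (m≤m+n 22704 157520))) (≤-reflexive (rearrange 180224 D f y))))
      where
      rearrange : ∀ k D f m → 8 * (k * D * f) + k * m ≡ k * (8 * (D * f) + m)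
      rearrange = solve-∀

terminal-bound : ℕ → ℕ → ℕ
terminal-bound j D = suc (Constants.threshold j T R + ladder-bound * (M₀ * (M₀ + M₀)) + 128 + 16 * D′)
  where
  open SmallParameters j D
  M₀ = suc (2 * (4 + j))

-- The case split is on the bound wanted: if it holds in the nearly bipartite form, nothing is left
-- to prove, and if it fails, twins are impossible and `balanced` applies. There 2E > n² turns the
-- loss of n²/4 into at least n²/8 colours up to the error.
terminal : ∀ j D → 1 ≤ D → ∀ {N f} {Γ : Graph N} (c : Coloring Γ f) →
  (∀ v → CycleCopy Γ (4 + j) v → Rainbow c (4 + j) v) → ∀ V → Unique V → terminal-bound j D ≤ length V →
  ∀ {q} → (∀ x → x ∈ V → q ≤ degree Γ V x) → SmallParameters.D′ j D * length V ≤ 2 * (SmallParameters.D′ j D * q) + length V →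
  length V * length V < 2 * degreeSum Γ V →
  D * (length V * length V) ≤ 8 * (D * f) + length V * length V
terminal j D 1≤D {N} {f} {Γ} c rainbow V unique-V bound {q} min D′n≤ many = decide (D′ * (n * n) ℕ.≤? 8 * (D′ * f) + 22704 * (n * n))
  where
  open SmallParameters j D
  open Constants j T R using (threshold)
  n E K M₀ : ℕ
  n = length V
  E = degreeSum Γ V
  M₀ = suc (2 * (4 + j))
  K = M₀ * (M₀ + M₀)
  Goal : Set
  Goal = D * (n * n) ≤ 8 * (D * f) + n * n
  2≤T : 2 ≤ T
  2≤T = ≤-trans (*-mono-≤ {2} {36} (s≤s (s≤s z≤n)) 1≤D) (≤-reflexive (sym T≡))
  ladder-large : ladder 64 (suc j) * K < n
  ladder-large = ≤-<-trans (*-monoˡ-≤ K ladder≤) (≤-trans (s≤s (≤-trans (m≤n+m (ladder-bound * K) threshold) (≤-trans (m≤m+n _ 128) (m≤m+n _ (16 * D′))))) bound)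
  threshold-large : threshold < n
  threshold-large = ≤-trans (s≤s (≤-trans (m≤m+n threshold (ladder-bound * K)) (≤-trans (m≤m+n _ 128) (m≤m+n _ (16 * D′))))) bound
  128≤n : 128 ≤ n
  128≤n = ≤-trans (≤-trans (≤-trans (m≤n+m 128 (threshold + ladder-bound * K)) (m≤m+n _ (16 * D′))) (n≤1+n _)) bound
  16D′≤n : 16 * D′ ≤ n
  16D′≤n = ≤-trans (≤-trans (m≤n+m (16 * D′) (threshold + ladder-bound * K + 128)) (n≤1+n _)) bound
  decide : Dec (D′ * (n * n) ≤ 8 * (D′ * f) + 22704 * (n * n)) → Goal
  decide (yes le) = unscale le
  decide (no not-bipartite) = *-cancelˡ-≤ {D * (n * n)} {8 * (D * f) + n * n} 36 (by-adding
      (+-mono-≤ (subst (λ T → 4 * (T * E) ≤ 4 * (T * (2 * f)) + T * (n * n) + 36 * (n * n)) T≡ few-repetitions) (*-monoʳ-≤ (2 * (36 * D)) (<⇒≤ many)))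
      0 (identity D (n * n) E f))
    where
    few-repetitions : 4 * (T * E) ≤ 4 * (T * (2 * f)) + T * (n * n) + 36 * (n * n)
    few-repetitions = SameColour.balanced
      (record { c = c ; j = j ; rainbow = rainbow ; V = V ; unique-V = unique-V ; T = T ; R = R ; 2≤T = 2≤T ; large = threshold-large })
      R≡ (D′-large 1≤D) 128≤n 16D′≤n
      ladder-large min D′n≤ many not-bipartite
    identity : ∀ D m E f → 36 * (D * m) + (4 * (36 * D * (2 * f)) + 36 * D * m + 36 * m + 2 * (36 * D) * (2 * E)) + 0 ≡
               36 * (8 * (D * f) + m) + (4 * (36 * D * E) + 2 * (36 * D) * m)
    identity = solve-∀

small-bound : ℕ → ℕ → ℕ
small-bound j D = 2 * (big-bound j (SmallParameters.D′ j D) + terminal-bound j D)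

-- After deletion either the sizes m and q′ have drifted apart by n/D′, and `big` applies with the
-- same m, or all degrees are almost n/2. As m is at least half of the original order, both cases
-- give about n²/8 colours.
small : ∀ j D → 1 ≤ D → ∀ {N f} {Γ : Graph N} (c : Coloring Γ f) →
  (∀ v → CycleCopy Γ (4 + j) v → Rainbow c (4 + j) v) → ∀ V → Unique V → small-bound j D ≤ length V →
  ∀ {m q δ} → length V ≡ m + q → m ≡ q + δ → δ ≤ 1 → m * m + q * q + 1 ≤ degreeSum Γ V →
  D * (length V * length V) ≤ 8 * (D * f) + 4 * (length V * length V)
small j D 1≤D {N} {f} {Γ} c rainbow V unique-V bound {m} {q} {δ} n≡ m≡ δ≤1 edges = conclude (reduce Γ m 1 q V unique-V n≡ edges)
  where
  open SmallParameters j D using (D′; D≤D′; unscale)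
  n₀ = length V
  1≤D′ : 1 ≤ D′
  1≤D′ = ≤-trans 1≤D D≤D′
  n₀≤2m : n₀ ≤ 2 * m
  n₀≤2m = ≤-slack δ (trans (cong (_+ δ) (trans n≡ (cong (_+ q) m≡))) (trans (identity q δ) (cong (2 *_) (sym m≡))))
    where
    identity : ∀ q δ → q + δ + q + δ ≡ 2 * (q + δ)
    identity = solve-∀
  module Reduced {V′ q′} (unique-V′ : Unique V′) (len : length V′ ≡ m + q′) (q′≤q : q′ ≤ q)
    (edges′ : m * m + q′ * q′ + 1 ≤ degreeSum Γ V′) (min : ∀ x → x ∈ V′ → q′ ≤ degree Γ V′ x) where
    n = length V′
    ε : ℕ
    ε = m ∸ q′
    m≡′ : m ≡ q′ + ε
    m≡′ = sym (m+[n∸m]≡n (≤-trans q′≤q (≤-trans (m≤m+n q δ) (≤-reflexive (sym m≡)))))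
    n≤n₀ : n ≤ n₀
    n≤n₀ = ≤-trans (≤-reflexive len) (≤-trans (+-monoʳ-≤ m q′≤q) (≤-reflexive (sym n≡)))
    large : big-bound j D′ + terminal-bound j D ≤ n
    large = *-cancelˡ-≤ 2 (≤-trans bound (≤-trans n₀≤2m (*-monoʳ-≤ 2 (≤-trans (m≤m+n m q′) (≤-reflexive (sym len))))))
    final : D * (n₀ * n₀) ≤ 8 * (D * f) + 4 * (n₀ * n₀)
    final = go (n ℕ.≤? D′ * ε)
      where
      open ≤-Reasoning
      unbalanced : n ≤ D′ * ε → D′ * (n₀ * n₀) ≤ 8 * (D′ * f) + 22704 * (4 * (n₀ * n₀))
      unbalanced le = begin
        D′ * (n₀ * n₀)                                      ≤⟨ *-monoʳ-≤ D′ (sq-mono n₀≤2m) ⟩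
        D′ * (2 * m * (2 * m))                              ≡⟨ four D′ m ⟩
        4 * (D′ * (m * m))                                  ≤⟨ *-monoʳ-≤ 4 (big j D′ 1≤D′ c rainbow V′ unique-V′ (≤-trans (m≤m+n _ _) large) len m≡′ le (≤-trans (m≤m+n _ 1) edges′)) ⟩
        4 * (D′ * (2 * f) + n * n)                          ≡⟨ distribute D′ f (n * n) ⟩
        8 * (D′ * f) + 4 * (n * n)                          ≤⟨ +-monoʳ-≤ (8 * (D′ * f)) (≤-trans (*-monoʳ-≤ 4 (sq-mono n≤n₀)) (m≤n*m (4 * (n₀ * n₀)) 22704)) ⟩
        8 * (D′ * f) + 22704 * (4 * (n₀ * n₀))              ∎
        where
        four : ∀ D m → D * (2 * m * (2 * m)) ≡ 4 * (D * (m * m))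
        four = solve-∀
        distribute : ∀ D f x → 4 * (D * (2 * f) + x) ≡ 8 * (D * f) + 4 * x
        distribute = solve-∀
      module Balanced (D′ε≤n : D′ * ε ≤ n) where
        Dε≤ : D * ε ≤ n
        Dε≤ = ≤-trans (*-monoˡ-≤ ε D≤D′) D′ε≤n
        ε≤n : ε ≤ n
        ε≤n = ≤-trans (m∸n≤m m q′) (≤-trans (m≤m+n m q′) (≤-reflexive (sym len)))
        n₀≤n+ε : n₀ ≤ n + ε
        n₀≤n+ε = ≤-trans n₀≤2m (≤-reflexive (trans (cong (m +_) (trans (+-identityʳ m) m≡′)) (trans (sym (+-assoc m q′ ε)) (cong (_+ ε) (sym len)))))
        D′n≤ : D′ * n ≤ 2 * (D′ * q′) + n
        D′n≤ = by-adding D′ε≤n 0 (trans (cong (λ ν → D′ * ν + n + 0) (trans len (cong (_+ q′) m≡′))) (split D′ q′ ε n))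
          where
          split : ∀ D q ε n → D * (q + ε + q) + n + 0 ≡ 2 * (D * q) + n + D * ε
          split = solve-∀
        -- The surplus 1, carried through all deletions, gives 2(m² + q′² + 1) > (m + q′)²: strictly
        -- more edges than a bipartite graph can have.
        many : n * n < 2 * degreeSum Γ V′
        many = by-adding (*-monoʳ-≤ 2 edges′) (suc (ε * ε)) (trans (cong₂ (λ ν μ → suc (ν * ν) + 2 * degreeSum Γ V′ + suc (ε * ε)) (trans len (cong (_+ q′) m≡′)) m≡′)
            (trans (identity q′ ε (degreeSum Γ V′)) (cong (λ μ → 2 * degreeSum Γ V′ + 2 * (μ * μ + q′ * q′ + 1)) (sym m≡′))))
          where
          identity : ∀ q ε e → suc ((q + ε + q) * (q + ε + q)) + 2 * e + suc (ε * ε) ≡ 2 * e + 2 * ((q + ε) * (q + ε) + q * q + 1)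
          identity = solve-∀
        balanced : D * (n₀ * n₀) ≤ 8 * (D * f) + 4 * (n₀ * n₀)
        balanced = begin
          D * (n₀ * n₀)                                       ≤⟨ *-monoʳ-≤ D (sq-mono n₀≤n+ε) ⟩
          D * ((n + ε) * (n + ε))                             ≤⟨ by-adding (+-mono-≤ (*-monoʳ-≤ (2 * n) Dε≤) (*-mono-≤ Dε≤ ε≤n)) 0 (identity D n ε) ⟩
          D * (n * n) + 3 * (n * n)                           ≤⟨ +-monoˡ-≤ (3 * (n * n)) (terminal j D 1≤D c rainbow V′ unique-V′ (≤-trans (m≤n+m _ _) large) min D′n≤ many) ⟩
          8 * (D * f) + n * n + 3 * (n * n)                   ≡⟨ +-assoc (8 * (D * f)) (n * n) (3 * (n * n)) ⟩
          8 * (D * f) + 4 * (n * n)                           ≤⟨ +-monoʳ-≤ (8 * (D * f)) (*-monoʳ-≤ 4 (sq-mono n≤n₀)) ⟩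
          8 * (D * f) + 4 * (n₀ * n₀)                         ∎
          where
          identity : ∀ D n ε → D * ((n + ε) * (n + ε)) + (2 * n * n + n * n) + 0 ≡ D * (n * n) + 3 * (n * n) + (2 * n * (D * ε) + D * ε * ε)
          identity = solve-∀
      go : Dec (n ≤ D′ * ε) → D * (n₀ * n₀) ≤ 8 * (D * f) + 4 * (n₀ * n₀)
      go (yes le) = unscale (unbalanced le)
      go (no gt)  = Balanced.balanced (<⇒≤ (≰⇒> gt))
  conclude : (∃ λ V′ → ∃ λ q′ → Unique V′ × length V′ ≡ m + q′ × q′ ≤ q × m * m + q′ * q′ + 1 ≤ degreeSum Γ V′ ×
                           (∀ x → x ∈ V′ → q′ ≤ degree Γ V′ x)) → D * (n₀ * n₀) ≤ 8 * (D * f) + 4 * (n₀ * n₀)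
  conclude (V′ , q′ , unique-V′ , len , q′≤q , edges′ , min) = Reduced.final unique-V′ len q′≤q edges′ min

lower-bound : ℕ → ℕ → ℕ
lower-bound j D = big-bound j D + small-bound j D

-- If δ < n/D, then m² differs from n²/4 by O(n²/D), so m and q may be replaced by the two halves of
-- n; this only lowers m² + q², and the surplus 1 is kept.
few-colours-impossible : ∀ j D → 1 ≤ D → ∀ {N f} {Γ : Graph N} (c : Coloring Γ f) →
  (∀ v → CycleCopy Γ (4 + j) v → Rainbow c (4 + j) v) → ∀ V → Unique V → lower-bound j D ≤ length V →
  ∀ {m q δ} → length V ≡ m + q → m ≡ q + δ → m * m + q * q + 1 ≤ degreeSum Γ V →
  D * (m * m) ≤ D * (2 * f) + 2 * (length V * length V)
few-colours-impossible j D 1≤D {N} {f} {Γ} c rainbow V unique-V bound {m} {q} {δ} n≡ m≡ edges = go (n ℕ.≤? D * δ)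
  where
  open ≤-Reasoning
  n h δ′ : ℕ
  n = length V
  h = δ / 2
  δ′ = δ ℕ.% 2
  δ≡ : δ ≡ δ′ + h * 2
  δ≡ = m≡m%n+[m/n]*n δ 2
  m≡′ : m ≡ q + (δ′ + h * 2)
  m≡′ = trans m≡ (cong (q +_) δ≡)
  balanced-total : n ≡ q + h + δ′ + (q + h)
  balanced-total = trans n≡ (trans (cong (_+ q) m≡′) (identity q h δ′))
    where
    identity : ∀ q h d → q + (d + h * 2) + q ≡ q + h + d + (q + h)
    identity = solve-∀
  balanced-edges : (q + h + δ′) * (q + h + δ′) + (q + h) * (q + h) + 1 ≤ degreeSum Γ V
  balanced-edges = ≤-trans (≤-slack (2 * (h * h) + 2 * (h * δ′)) (trans (identity q h δ′) (cong (λ m → m * m + q * q + 1) (sym m≡′)))) edges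
    where
    identity : ∀ q h d → (q + h + d) * (q + h + d) + (q + h) * (q + h) + 1 + (2 * (h * h) + 2 * (h * d)) ≡ (q + (d + h * 2)) * (q + (d + h * 2)) + q * q + 1
    identity = solve-∀
  go : Dec (n ≤ D * δ) → D * (m * m) ≤ D * (2 * f) + 2 * (n * n)
  go (yes le) = ≤-trans (big j D 1≤D c rainbow V unique-V (≤-trans (m≤m+n _ _) bound) n≡ m≡ le (≤-trans (m≤m+n _ 1) edges))
    (+-monoʳ-≤ (D * (2 * f)) (m≤n*m (n * n) 2))
  go (no gt) = *-cancelˡ-≤ 4 (by-adding (+-mono-≤ balanced (+-mono-≤ (*-monoʳ-≤ (2 * n) Dδ≤n) (*-mono-≤ Dδ≤n δ≤n))) (n * n)
      (trans (cong (λ m → 4 * (D * (m * m)) + (8 * (D * f) + 4 * (n * n) + (2 * n * n + n * n)) + n * n) m≡)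
        (identity D f q δ n (trans n≡ (cong (_+ q) m≡)))))
    where
    Dδ≤n : D * δ ≤ n
    Dδ≤n = <⇒≤ (≰⇒> gt)
    δ≤n : δ ≤ n
    δ≤n = ≤-trans (m≤n+m δ q) (≤-trans (≤-reflexive (sym m≡)) (≤-trans (m≤m+n m q) (≤-reflexive (sym n≡))))
    balanced : D * (n * n) ≤ 8 * (D * f) + 4 * (n * n)
    balanced = small j D 1≤D c rainbow V unique-V (≤-trans (m≤n+m _ (big-bound j D)) bound) {q + h + δ′} {q + h} {δ′} balanced-total refl (≤-pred (m%n<n δ 2)) balanced-edges
    identity : ∀ D f q δ n → n ≡ q + δ + q → 4 * (D * ((q + δ) * (q + δ))) + (8 * (D * f) + 4 * (n * n) + (2 * n * n + n * n)) + n * n ≡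
               4 * (D * (2 * f) + 2 * (n * n)) + (D * (n * n) + (2 * n * (D * δ) + D * δ * δ))
    identity D f q δ n refl = ring D f q δ
      where
      ring : ∀ D f q δ → 4 * (D * ((q + δ) * (q + δ))) + (8 * (D * f) + 4 * ((q + δ + q) * (q + δ + q)) + (2 * (q + δ + q) * (q + δ + q) + (q + δ + q) * (q + δ + q))) + (q + δ + q) * (q + δ + q) ≡
             4 * (D * (2 * f) + 2 * ((q + δ + q) * (q + δ + q))) + (D * ((q + δ + q) * (q + δ + q)) + (2 * (q + δ + q) * (D * δ) + D * δ * δ))
      ring = solve-∀

-- The two-clique construction

∑≡sum : ∀ {X : Set} (xs : List X) (f : X → ℕ) → ∑ xs f ≡ sum (map f xs)
∑≡sum []       f = refl
∑≡sum (x ∷ xs) f = cong (f x +_) (∑≡sum xs f)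

degreeSum≡ : ∀ {n} (Γ : Graph n) → degreeSum Γ (allFin n) ≡ 2 * edgeCount Γ
degreeSum≡ {n} Γ = begin
  ∑ V (λ i → ∑ V (α i))                             ≡⟨ ∑-cong V (λ i → trans (∑-cong V (oriented i)) (∑-+ V (β i) (λ j → β j i))) ⟩
  ∑ V (λ i → ∑ V (β i) + ∑ V (λ j → β j i))         ≡⟨ ∑-+ V _ _ ⟩
  ∑ V (λ i → ∑ V (β i)) + ∑ V (λ i → ∑ V λ j → β j i) ≡⟨ cong (∑ V (λ i → ∑ V (β i)) +_) (∑-swap V V (λ i j → β j i)) ⟩
  ∑ V (λ i → ∑ V (β i)) + ∑ V (λ i → ∑ V (β i))     ≡⟨ cong₂ _+_ counted (trans counted (sym (+-identityʳ _))) ⟩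
  2 * edgeCount Γ                                   ∎
  where
  open ≡-Reasoning
  V = allFin n
  open Walks Γ V using (α; α-sym; adj?; Adj-sym)
  β : Fin n → Fin n → ℕ
  β i j = if (toℕ i <ᵇ toℕ j) ∧ adj Γ i j then 1 else 0
  counted : ∑ V (λ i → ∑ V (β i)) ≡ edgeCount Γ
  counted = trans (∑-cong V λ i → ∑≡sum V (β i)) (∑≡sum V _)
  indicator : ∀ b → 𝟙 (b Bool.≟ true) ≡ (if b then 1 else 0)
  indicator true  = refl
  indicator false = refl
  <ᵇ-true : ∀ {a b} → a < b → (a <ᵇ b) ≡ true
  <ᵇ-true {a} {b} a<b with a <ᵇ b | <⇒<ᵇ a<b
  ... | true | _ = refl
  <ᵇ-false : ∀ {a b} → ¬ a < b → (a <ᵇ b) ≡ false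
  <ᵇ-false {a} {b} a≮b with a <ᵇ b in eq
  ... | false = refl
  ... | true  = contradiction (<ᵇ⇒< a b (subst Data.Bool.T (sym eq) _)) a≮b
  oriented : ∀ i j → α i j ≡ β i j + β j i
  oriented i j with <-cmp (toℕ i) (toℕ j)
  ... | tri< lt _ gt rewrite <ᵇ-true lt | <ᵇ-false gt = trans (indicator (adj Γ i j)) (sym (+-identityʳ _))
  ... | tri> lt _ gt rewrite <ᵇ-true gt | <ᵇ-false lt = trans (α-sym i j) (indicator (adj Γ j i))
  ... | tri≈ lt eq gt rewrite <ᵇ-false lt | <ᵇ-false gt =
    𝟙-no (adj? i j) λ ij → Walks.Adj⇒≢ Γ V ij (Fin.toℕ-injective eq)

triangle : ℕ → ℕ
triangle zero    = 0
triangle (suc a) = triangle a + a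

triangle-mono : ∀ {a b} → a ≤ b → triangle a ≤ triangle b
triangle-mono {zero}          z≤n       = z≤n
triangle-mono {suc a} {suc b} (s≤s a≤b) = +-mono-≤ (triangle-mono a≤b) a≤b

2*triangle : ∀ a → 2 * triangle a + a ≡ a * a
2*triangle zero    = refl
2*triangle (suc a) = trans (identity (triangle a) a) (trans (cong (_+ (2 * a + 1)) (2*triangle a)) (square a))
  where
  identity : ∀ t a → 2 * (t + a) + suc a ≡ 2 * t + a + (2 * a + 1)
  identity = solve-∀
  square : ∀ a → a * a + (2 * a + 1) ≡ suc a * suc a
  square = solve-∀

-- The colexicographic rank: for p < q it is C(q,2) + p, which maps the pairs below a injectively
-- into C(a,2) numbers. On the diagonal codes may collide, hence the conditions `p ≢ q`.
pair-code : ℕ → ℕ → ℕ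
pair-code p q = triangle (p ⊔ q) + (p ⊓ q)

pair-code-comm : ∀ p q → pair-code p q ≡ pair-code q p
pair-code-comm p q = cong₂ (λ m l → triangle m + l) (⊔-comm p q) (⊓-comm p q)

ordered-code : ∀ {p q} → p < q → pair-code p q ≡ triangle q + p
ordered-code p<q = cong₂ (λ m l → triangle m + l) (m≤n⇒m⊔n≡n (<⇒≤ p<q)) (m≤n⇒m⊓n≡m (<⇒≤ p<q))

ordered-code-< : ∀ {p q a} → p < q → q < a → triangle q + p < triangle a
ordered-code-< {p} {q} p<q q<a = ≤-trans (+-monoʳ-< (triangle q) p<q) (triangle-mono q<a)

ordered-code-injective : ∀ {p q p′ q′} → p < q → p′ < q′ → triangle q + p ≡ triangle q′ + p′ → p ≡ p′ × q ≡ q′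
ordered-code-injective {p} {q} {p′} {q′} p<q p′<q′ eq with <-cmp q q′
... | tri< q<q′ _ _ = contradiction eq (<⇒≢ (≤-trans (ordered-code-< p<q q<q′) (m≤m+n _ p′)))
... | tri> _ _ q′<q = contradiction (sym eq) (<⇒≢ (≤-trans (ordered-code-< p′<q′ q′<q) (m≤m+n _ p)))
... | tri≈ _ refl _ = +-cancelˡ-≡ (triangle q) p p′ eq , refl

pair-code-< : ∀ {p q a} → p ≢ q → p < a → q < a → pair-code p q < triangle a
pair-code-< {p} {q} {a} p≢q p<a q<a with <-cmp p q
... | tri< p<q _ _ = subst (_< triangle a) (sym (ordered-code p<q)) (ordered-code-< p<q q<a)
... | tri≈ _ p≡q _ = contradiction p≡q p≢q
... | tri> _ _ q<p = subst (_< triangle a) (sym (trans (pair-code-comm p q) (ordered-code q<p))) (ordered-code-< q<p p<a)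

pair-code-injective : ∀ {p q p′ q′} → p ≢ q → p′ ≢ q′ → pair-code p q ≡ pair-code p′ q′ →
                      (p ≡ p′ × q ≡ q′) ⊎ (p ≡ q′ × q ≡ p′)
pair-code-injective {p} {q} {p′} {q′} p≢q p′≢q′ eq with <-cmp p q | <-cmp p′ q′
... | tri≈ _ p≡q _ | _               = contradiction p≡q p≢q
... | tri< _ _ _   | tri≈ _ p′≡q′ _  = contradiction p′≡q′ p′≢q′
... | tri> _ _ _   | tri≈ _ p′≡q′ _  = contradiction p′≡q′ p′≢q′
... | tri< p<q _ _ | tri< p′<q′ _ _  = inj₁ (ordered-code-injective p<q p′<q′ (trans (sym (ordered-code p<q)) (trans eq (ordered-code p′<q′))))
... | tri< p<q _ _ | tri> _ _ q′<p′  = inj₂ (ordered-code-injective p<q q′<p′ (trans (sym (ordered-code p<q)) (trans eq (trans (pair-code-comm p′ q′) (ordered-code q′<p′)))))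
... | tri> _ _ q<p | tri< p′<q′ _ _  = inj₂ (let x , y = ordered-code-injective q<p p′<q′ (trans (sym (ordered-code q<p)) (trans (pair-code-comm q p) (trans eq (ordered-code p′<q′)))) in y , x)
... | tri> _ _ q<p | tri> _ _ q′<p′  = inj₁ (let x , y = ordered-code-injective q<p q′<p′ (trans (sym (ordered-code q<p)) (trans (pair-code-comm q p) (trans eq (trans (pair-code-comm p′ q′) (ordered-code q′<p′))))) in y , x)

-- This needs a cycle of length at least 3; it excludes that two cycle edges are the same pair of
-- vertices traversed in opposite directions.
next-next-≢ : ∀ {m} → 2 ≤ m → (i : Fin (suc m)) → next (next i) ≢ i
next-next-≢ {m} 2≤m i eq with toℕ-next i | toℕ-next (next i)
... | inj₁ (_ , e₁) | inj₁ (_ , e₂) = contradiction (trans (sym (cong toℕ eq)) (trans e₂ (cong suc e₁))) (<⇒≢ (m≤n⇒m≤1+n ≤-refl))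
... | inj₁ (_ , e₁) | inj₂ (l , e₂) = contradiction (trans (sym l) (trans e₁ (cong suc (trans (sym (cong toℕ eq)) e₂)))) (≢-sym (<⇒≢ 2≤m))
... | inj₂ (l , e₁) | inj₁ (_ , e₂) = contradiction (trans (sym l) (trans (sym (cong toℕ eq)) (trans e₂ (cong suc e₁)))) (≢-sym (<⇒≢ 2≤m))
... | inj₂ (l , e₁) | inj₂ (l′ , _) = contradiction (trans (sym e₁) l′) (<⇒≢ (≤-trans (s≤s z≤n) 2≤m))

count-below : ∀ {n} a → a ≤ n → ∑ (allFin n) (λ i → 𝟙 (toℕ i ℕ.<? a)) ≡ a
count-below {zero}  zero    z≤n = refl
count-below {suc n} zero    z≤n = trans (∑-cong (allFin (suc n)) λ i → 𝟙-no (toℕ i ℕ.<? 0) λ ()) (∑-zero (allFin (suc n)))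
count-below {suc n} (suc a) (s≤s a≤n) = cong suc (trans (cong (λ is → ∑ is (λ i → 𝟙 (toℕ i ℕ.<? suc a))) (sym (map-tabulate (λ (i : Fin n) → i) (Fin.suc {n}))))
  (trans (∑-map Fin.suc (allFin n) (λ i → 𝟙 (toℕ i ℕ.<? suc a))) (trans (∑-cong (allFin n) λ i →
    ≤-antisym (𝟙-mono (suc (toℕ i) ℕ.<? suc a) (toℕ i ℕ.<? a) ≤-pred) (𝟙-mono (toℕ i ℕ.<? a) (suc (toℕ i) ℕ.<? suc a) s≤s)) (count-below a a≤n))))

module TwoCliques {n a b : ℕ} (n≡ : n ≡ a + b) (b≤a : b ≤ a) (2≤a : 2 ≤ a) where

  First : Fin n → Set
  First i = toℕ i < a

  first? : ∀ i → Dec (First i)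
  first? i = toℕ i ℕ.<? a

  Together : Fin n → Fin n → Set
  Together i j = (First i × First j) ⊎ (¬ First i × ¬ First j)

  together? : ∀ i j → Dec (Together i j)
  together? i j = (first? i ×-dec first? j) ⊎-dec (¬? (first? i) ×-dec ¬? (first? j))

  joined? : ∀ i j → Dec (i ≢ j × Together i j)
  joined? i j = ¬? (i Fin.≟ j) ×-dec together? i j

  together-sym : ∀ {i j} → Together i j → Together j i
  together-sym (inj₁ (x , y)) = inj₁ (y , x)
  together-sym (inj₂ (x , y)) = inj₂ (y , x)

  does-true : ∀ {P : Set} (d : Dec P) → does d ≡ true → P
  does-true (yes p) _ = p

  does-sym : ∀ {P Q : Set} (d : Dec P) (e : Dec Q) → (P → Q) → (Q → P) → does d ≡ does e
  does-sym (yes p) e P→Q Q→P = sym (dec-true e (P→Q p))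
  does-sym (no ¬p) e P→Q Q→P = sym (dec-false e (¬p ∘ Q→P))

  cliques : Graph n
  cliques = record
    { adj   = λ i j → does (joined? i j)
    ; sym   = λ i j → does-sym (joined? i j) (joined? j i) (λ (x , t) → ≢-sym x , together-sym t) (λ (x , t) → ≢-sym x , together-sym t)
    ; irref = λ i → dec-false (joined? i i) λ (i≢i , _) → i≢i refl
    }

  -- Numbering both cliques from 0 is what lets the smaller one reuse the colours of the larger.
  position : Fin n → ℕ
  position i with first? i
  ... | yes _ = toℕ i
  ... | no  _ = toℕ i ∸ a

  position< : ∀ i → position i < a
  position< i with first? i
  ... | yes i<a = i<a
  ... | no  i≮a = ≤-trans (+-cancelˡ-< a _ b (≤-trans (s≤s (≤-reflexive (m+[n∸m]≡n (≮⇒≥ i≮a)))) (≤-trans (Fin.toℕ<n i) (≤-reflexive n≡)))) b≤a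

  position-injective : ∀ {i j} → Together i j → position i ≡ position j → i ≡ j
  position-injective {i} {j} t eq with first? i | first? j
  position-injective t eq | yes _ | yes _ = Fin.toℕ-injective eq
  position-injective {i} {j} t eq | no i≮a | no j≮a = Fin.toℕ-injective (∸-cancelʳ-≡ (≮⇒≥ i≮a) (≮⇒≥ j≮a) eq)
  position-injective (inj₁ (_ , y)) eq | yes _ | no ¬y = contradiction y ¬y
  position-injective (inj₂ (¬x , _)) eq | yes x | no _ = contradiction x ¬x
  position-injective (inj₁ (x , _)) eq | no ¬x | yes _ = contradiction x ¬x
  position-injective (inj₂ (_ , ¬y)) eq | no _ | yes y = contradiction y ¬y

  instance
    colours≢0 : ℕ.NonZero (triangle a)
    colours≢0 = ℕ.>-nonZero (triangle-mono 2≤a)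

  colouring : Coloring cliques (triangle a)
  colouring = record
    -- The reduction only lands the code in `Fin`; on edges the code is already below `triangle a`,
    -- as `toℕ-col` shows.
    { col    = λ i j → pair-code (position i) (position j) mod triangle a
    ; colSym = λ i j _ → cong (_mod triangle a) (pair-code-comm (position i) (position j))
    }

  toℕ-col : ∀ {i j} → i ≢ j → Together i j → toℕ (col colouring i j) ≡ pair-code (position i) (position j)
  toℕ-col {i} {j} i≢j t = trans (Fin.toℕ-fromℕ< _) (m<n⇒m%n≡m (pair-code-< (i≢j ∘ position-injective t) (position< i) (position< j)))

  together-trans : ∀ {i j l} → Together i j → Together j l → Together i l
  together-trans (inj₁ (x , y)) (inj₁ (_ , z)) = inj₁ (x , z)
  together-trans (inj₂ (x , y)) (inj₂ (_ , z)) = inj₂ (x , z)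
  together-trans (inj₁ (_ , y)) (inj₂ (¬y , _)) = contradiction y ¬y
  together-trans (inj₂ (_ , ¬y)) (inj₁ (y , _)) = contradiction y ¬y

  -- A cycle stays inside one of the two cliques.
  rainbow : ∀ k → 1 ≤ k → ∀ v → CycleCopy cliques k v → Rainbow colouring k v
  rainbow k 1≤k v (injective , edges) {i} {j} same = conclude (pair-code-injective (distinct i) (distinct j)
      (trans (sym (toℕ-col (proj₁ (edge i)) (proj₂ (edge i)))) (trans (cong toℕ same) (toℕ-col (proj₁ (edge j)) (proj₂ (edge j))))))
    where
    edge : ∀ i → v i ≢ v (next i) × Together (v i) (v (next i))
    edge i = does-true (joined? (v i) (v (next i))) (edges i)
    distinct : ∀ i → position (v i) ≢ position (v (next i))
    distinct i eq = proj₁ (edge i) (position-injective (proj₂ (edge i)) eq)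
    from-start : ∀ l (l< : l < suc (2 * k)) → Together (v Fin.zero) (v (Fin.fromℕ< l<))
    from-start zero    l< = reflexive (first? (v Fin.zero))
      where
      reflexive : ∀ {x} → Dec (First x) → Together x x
      reflexive (yes p) = inj₁ (p , p)
      reflexive (no ¬p) = inj₂ (¬p , ¬p)
    from-start (suc l) l< = together-trans (from-start l l<′) (subst (λ z → Together (v i₀) (v z)) next≡ (proj₂ (edge i₀)))
      where
      l<′ : l < suc (2 * k)
      l<′ = <-trans ≤-refl l<
      i₀ = Fin.fromℕ< l<′
      next≡ : next i₀ ≡ Fin.fromℕ< l<
      next≡ with toℕ-next i₀
      ... | inj₁ (_ , eq) = Fin.toℕ-injective (trans eq (trans (cong suc (Fin.toℕ-fromℕ< l<′)) (sym (Fin.toℕ-fromℕ< l<))))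
      ... | inj₂ (eq , _) = contradiction (trans (sym (Fin.toℕ-fromℕ< l<′)) eq) (<⇒≢ (≤-pred l<))
    all-together : ∀ i j → Together (v i) (v j)
    all-together i j = together-trans (together-sym (start i)) (start j)
      where
      start : ∀ i → Together (v Fin.zero) (v i)
      start i = subst (λ z → Together (v Fin.zero) (v z)) (Fin.fromℕ<-toℕ i (Fin.toℕ<n i)) (from-start (toℕ i) (Fin.toℕ<n i))
    same-vertex : ∀ {i j} → position (v i) ≡ position (v j) → i ≡ j
    same-vertex {i} {j} eq = injective (position-injective (all-together i j) eq)
    conclude : (position (v i) ≡ position (v j) × position (v (next i)) ≡ position (v (next j))) ⊎
               (position (v i) ≡ position (v (next j)) × position (v (next i)) ≡ position (v j)) → i ≡ j
    conclude (inj₁ (eq , _)) = same-vertex eq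
    conclude (inj₂ (eq , eq′)) = contradiction (trans (cong next (sym (same-vertex eq))) (same-vertex eq′))
      (next-next-≢ (*-monoʳ-≤ 2 1≤k) j)

  -- Adding one loop per vertex completes each clique to a full square of ordered pairs.
  edge-total : degreeSum cliques (allFin n) + n ≡ a * a + b * b
  edge-total = begin
    ∑ V (λ i → ∑ V (α i)) + n
      ≡⟨ cong (∑ V (λ i → ∑ V (α i)) +_) (trans (sym length-V) (sym (trans (∑-const V 1) (*-identityʳ (length V))))) ⟩
    ∑ V (λ i → ∑ V (α i)) + ∑ V (λ _ → 1)
      ≡⟨ ∑-+ V _ _ ⟨
    ∑ V (λ i → ∑ V (α i) + 1)
      ≡⟨ ∑-cong V (λ i → trans (cong (∑ V (α i) +_) (sym (self i))) (trans (sym (∑-+ V (α i) _)) (∑-cong V (together-count i)))) ⟩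
    ∑ V (λ i → ∑ V λ j → φ i * φ j + ψ i * ψ j)
      ≡⟨ trans (∑-cong V λ i → ∑-+ V (λ j → φ i * φ j) (λ j → ψ i * ψ j)) (∑-+ V _ _) ⟩
    ∑ V (λ i → ∑ V λ j → φ i * φ j) + ∑ V (λ i → ∑ V λ j → ψ i * ψ j)
      ≡⟨ cong₂ _+_ (trans (∑-product V V φ φ) (cong₂ _*_ ∑φ ∑φ)) (trans (∑-product V V ψ ψ) (cong₂ _*_ ∑ψ ∑ψ)) ⟩
    a * a + b * b ∎
    where
    open ≡-Reasoning
    V = allFin n
    open Walks cliques V using (α; adj?)
    φ ψ : Fin n → ℕ
    φ i = 𝟙 (first? i)
    ψ i = 𝟙 (¬? (first? i))
    length-V : length V ≡ n
    length-V = length-tabulate (λ (i : Fin n) → i)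
    ∑φ : ∑ V φ ≡ a
    ∑φ = count-below a (≤-trans (m≤m+n a b) (≤-reflexive (sym n≡)))
    ∑ψ : ∑ V ψ ≡ b
    ∑ψ = +-cancelˡ-≡ a (∑ V ψ) b (trans (cong (_+ ∑ V ψ) (sym ∑φ)) (trans (sym (∑-+ V φ ψ)) (trans (∑-cong V λ i → 𝟙-complement (first? i))
           (trans (∑-const V 1) (trans (*-identityʳ (length V)) (trans length-V n≡))))))
    self : ∀ i → ∑ V (λ j → 𝟙 (j Fin.≟ i) * 1) ≡ 1
    self i = ≤-antisym (∑-point Fin._≟_ (allFin⁺ n) i (λ _ → 1))
      (≤-trans (≤-reflexive (sym (trans (*-identityʳ _) (𝟙-yes (i Fin.≟ i) refl)))) (term≤∑ (∈-allFin i) (λ j → 𝟙 (j Fin.≟ i) * 1)))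
    adjacent : ∀ i j → α i j ≡ 𝟙 (joined? i j)
    adjacent i j = ≤-antisym (𝟙-mono (adj? i j) (joined? i j) (does-true (joined? i j))) (𝟙-mono (joined? i j) (adj? i j) (dec-true (joined? i j)))
    together-count : ∀ i j → α i j + 𝟙 (j Fin.≟ i) * 1 ≡ φ i * φ j + ψ i * ψ j
    together-count i j = trans (cong (_+ 𝟙 (j Fin.≟ i) * 1) (adjacent i j)) (go (i Fin.≟ j) (j Fin.≟ i) (first? i) (first? j) refl refl)
      where
      go : ∀ (d : Dec (i ≡ j)) (d′ : Dec (j ≡ i)) (x : Dec (First i)) (y : Dec (First j)) → first? i ≡ x → first? j ≡ y →
           𝟙 (¬? d ×-dec ((x ×-dec y) ⊎-dec (¬? x ×-dec ¬? y))) + 𝟙 d′ * 1 ≡ 𝟙 x * 𝟙 y + 𝟙 (¬? x) * 𝟙 (¬? y)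
      go (yes refl) (no ¬p) _ _ _ _ = contradiction refl ¬p
      go (no ¬p) (yes refl) _ _ _ _ = contradiction refl ¬p
      go (yes refl) (yes _) (yes _) (yes _) _ _ = refl
      go (yes refl) (yes _) (no _) (no _) _ _ = refl
      go (yes refl) (yes _) (yes x) (no ¬y) _ _ = contradiction x ¬y
      go (yes refl) (yes _) (no ¬x) (yes y) _ _ = contradiction y ¬x
      go (no _) (no _) (yes _) (yes _) _ _ = refl
      go (no _) (no _) (yes _) (no _) _ _ = refl
      go (no _) (no _) (no _) (yes _) _ _ = refl
      go (no _) (no _) (no _) (no _) _ _ = refl

  two-cliques : ∀ k → 1 ≤ k → ∀ {e} → 2 * e + n ≤ a * a + b * b → Achievable n e k (triangle a)
  two-cliques k 1≤k {e} enough = cliques ,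
    *-cancelˡ-≤ 2 (+-cancelʳ-≤ n (2 * e) (2 * edgeCount cliques) (≤-trans enough (≤-reflexive (trans (sym edge-total) (cong (_+ n) (degreeSum≡ cliques)))))) ,
    colouring , rainbow k 1≤k

-- Finds a point where `P` stops holding, or the right end of the range. No monotonicity is
-- required: any such crossing determines the clique sizes well enough.
search : ∀ {P : ℕ → Set} (P? : ∀ b → Dec (P b)) B → P 0 → ∃ λ b → b ≤ B × P b × (b ≡ B ⊎ ¬ P (suc b))
search P? zero    p₀ = 0 , z≤n , p₀ , inj₁ refl
search P? (suc B) p₀ with P? (suc B) | search P? B p₀
... | yes p | _                            = suc B , ≤-refl , p , inj₁ refl
... | no ¬p | b , b≤B , p , inj₁ refl      = b , m≤n⇒m≤1+n b≤B , p , inj₂ ¬p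
... | no _  | b , b≤B , p , inj₂ ¬p        = b , m≤n⇒m≤1+n b≤B , p , inj₂ ¬p

C2≡triangle : ∀ n → n C 2 ≡ triangle n
C2≡triangle zero    = refl
C2≡triangle (suc n) = trans (sym (nCk+nC[k+1]≡[n+1]C[k+1] n 1)) (trans (cong₂ _+_ (nC1≡n n) (C2≡triangle n)) (+-comm n (triangle n)))

halves : ∀ {n b} → b ≤ n / 2 → ∃ λ d → n ≡ b + d + b × n ∸ b ≡ b + d
halves {n} {b} b≤ = d , n≡ , trans (cong (_∸ b) n≡) (m+n∸n≡m (b + d) b)
  where
  d = n ∸ (b + b)
  2b≤n : b + b ≤ n
  2b≤n = ≤-trans (≤-trans (+-mono-≤ b≤ b≤) (≤-reflexive (double (n / 2)))) (≤-trans (m≤n+m _ (n ℕ.% 2)) (≤-reflexive (sym (m≡m%n+[m/n]*n n 2))))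
    where
    double : ∀ h → h + h ≡ h * 2
    double = solve-∀
  n≡ : n ≡ b + d + b
  n≡ = trans (sym (m+[n∸m]≡n 2b≤n)) (identity b d)
    where
    identity : ∀ b d → b + b + d ≡ b + d + b
    identity = solve-∀

-- The sizes determined by n and e

module Extremal (n e : ℕ) (n²/4<e : suc ((n * n) / 4) ≤ e) (e≤ : e ≤ n C 2) where

  2e+n≤n² : 2 * e + n ≤ n * n
  2e+n≤n² = ≤-trans (+-monoˡ-≤ n (*-monoʳ-≤ 2 (≤-trans e≤ (≤-reflexive (C2≡triangle n))))) (≤-reflexive (2*triangle n))

  δ : ℕ
  δ = n ℕ.% 2

  -- The squares of the two halves add up to twice the floor of n²/4, plus the parity of n, while 2e
  -- is at least twice that floor plus 2.
  balanced : (n ∸ n / 2) * (n ∸ n / 2) + (n / 2) * (n / 2) + 1 ≤ 2 * e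
  balanced = subst (λ a → a * a + B * B + 1 ≤ 2 * e) (sym a≡) (begin
    (B + δ) * (B + δ) + B * B + 1           ≡⟨ identity B δ ⟩
    2 * (B * B + B * δ) + (δ * δ + 1)       ≤⟨ +-monoʳ-≤ (2 * (B * B + B * δ)) (+-monoˡ-≤ 1 (sq-mono {δ} {1} δ≤1)) ⟩
    2 * (B * B + B * δ) + 2                 ≡⟨ double-suc (B * B + B * δ) ⟩
    2 * suc (B * B + B * δ)                 ≤⟨ *-monoʳ-≤ 2 (≤-trans (s≤s quarter) n²/4<e) ⟩
    2 * e                                   ∎)
    where
    open ≤-Reasoning
    B = n / 2
    δ≤1 : δ ≤ 1
    δ≤1 = ≤-pred (m%n<n n 2)
    n≡ : n ≡ B + δ + B
    n≡ = trans (m≡m%n+[m/n]*n n 2) (rearrange B δ)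
      where
      rearrange : ∀ B δ → δ + B * 2 ≡ B + δ + B
      rearrange = solve-∀
    a≡ : n ∸ B ≡ B + δ
    a≡ = trans (cong (_∸ B) n≡) (m+n∸n≡m (B + δ) B)
    identity : ∀ B δ → (B + δ) * (B + δ) + B * B + 1 ≡ 2 * (B * B + B * δ) + (δ * δ + 1)
    identity = solve-∀
    double-suc : ∀ x → 2 * x + 2 ≡ 2 * suc x
    double-suc = solve-∀
    quarter : B * B + B * δ ≤ (n * n) / 4
    quarter = ≤-trans (≤-reflexive (sym (m*n/n≡m (B * B + B * δ) 4)))
      (/-monoˡ-≤ 4 (≤-slack (δ * δ) (trans (square B δ) (cong₂ _*_ (sym n≡) (sym n≡)))))
      where
      square : ∀ B δ → (B * B + B * δ) * 4 + δ * δ ≡ (B + δ + B) * (B + δ + B)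
      square = solve-∀

  module Estimates (D : ℕ) (4D≤n : 4 * D ≤ n) (2D²≤n : 2 * (D * D) ≤ n) (4≤n : 4 ≤ n) where
    -- Y/4D bounds n√t/2 from above, and the colour count shows that Y/4D is at most f - e/2 + n²/D.
    lower-estimate : ∀ j → 1 ≤ D → lower-bound j (4 * D) ≤ n → ∀ {f} → Achievable n e (4 + j) f →
                     ∃ λ Y → Y + 2 * (D * e) ≤ 4 * (D * f) + 4 * (n * n) × 4 * (D * D * (n * n) * e) ≤ Y * Y + D * D * (n * n) * (n * n)
    lower-estimate j 1≤D large {f} (Γ , e≤Γ , c , rainbow) = conclude (search Q? (n / 2) start)
      where
      -- The negated inequality: it holds at b = 0, where e is too small, and fails at n/2 by
      -- `balanced`. At a crossing, q = b + 1 satisfies the hypothesis of the lower bound, while b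
      -- bounds 2e from above.
      Q : ℕ → Set
      Q b = ¬ ((n ∸ b) * (n ∸ b) + b * b + 1 ≤ 2 * e)
      Q? : ∀ b → Dec (Q b)
      Q? b = ¬? ((n ∸ b) * (n ∸ b) + b * b + 1 ℕ.≤? 2 * e)
      start : Q 0
      start le = contradiction (≤-trans le (≤-trans (m≤m+n (2 * e) n) 2e+n≤n²)) (<⇒≱ (≤-reflexive (identity n)))
        where
        identity : ∀ n → suc (n * n) ≡ n * n + 0 + 1
        identity = solve-∀
      Result : Set
      Result = ∃ λ Y → Y + 2 * (D * e) ≤ 4 * (D * f) + 4 * (n * n) × 4 * (D * D * (n * n) * e) ≤ Y * Y + D * D * (n * n) * (n * n)
      D≤n : D ≤ n
      D≤n = ≤-trans (m≤n*m D 4) 4D≤n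
      module At (b d : ℕ) (n≡ : n ≡ suc b + d + suc b) (M≡ : n ∸ suc b ≡ suc b + d) (maximal : Q b) (holds : ¬ Q (suc b)) where
        q M : ℕ
        q = suc b
        M = q + d
        holds′ : M * M + q * q + 1 ≤ 2 * e
        holds′ = subst (λ M → M * M + q * q + 1 ≤ 2 * e) M≡ (stable (_ ℕ.≤? _) holds)
          where
          stable : ∀ {P : Set} → Dec P → ¬ ¬ P → P
          stable (yes p) _   = p
          stable (no ¬p) ¬¬p = contradiction ¬p ¬¬p
        M² : M * M ≡ n * d + q * q
        M² = trans (identity q d) (cong (λ n → n * d + q * q) (sym n≡))
          where
          identity : ∀ q d → (q + d) * (q + d) ≡ (q + d + q) * d + q * q
          identity = solve-∀
        upper : 2 * e ≤ n * d + q * q + q * q + 2 * d + 2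
        upper = ≤-pred (≤-trans (≰⇒> maximal) (≤-reflexive (trans (cong (λ a → a * a + b * b + 1) (trans (cong (_∸ b) n≡) above))
                  (trans (identity b d) (cong (λ n → suc (n * d + q * q + q * q + 2 * d + 2)) (sym n≡))))))
          where
          above : (suc b + d + suc b) ∸ b ≡ suc b + d + 1
          above = trans (cong (_∸ b) (trans (cong (suc b + d +_) (+-comm 1 b)) (trans (cong (suc b + d +_) (+-comm b 1)) (sym (+-assoc (suc b + d) 1 b))))) (m+n∸n≡m (suc b + d + 1) b)
          identity : ∀ b d → (suc b + d + 1) * (suc b + d + 1) + b * b + 1 ≡ suc ((suc b + d + suc b) * d + suc b * suc b + suc b * suc b + 2 * d + 2)
          identity = solve-∀
        colours : 4 * D * (n * d + q * q) ≤ 4 * D * (2 * f) + 2 * (n * n)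
        colours = subst₂ (λ x ν → 4 * D * x ≤ 4 * D * (2 * f) + 2 * (ν * ν)) M² length-V
          (few-colours-impossible j (4 * D) (≤-trans 1≤D (m≤n*m D 4)) c rainbow (allFin n) (allFin⁺ n)
            (≤-trans large (≤-reflexive (sym length-V))) {M} {q} {d} (trans length-V n≡) refl
            (≤-trans holds′ (≤-trans (*-monoʳ-≤ 2 e≤Γ) (≤-reflexive (sym (degreeSum≡ Γ))))))
          where
          length-V : length (allFin n) ≡ n
          length-V = length-tabulate (λ (i : Fin n) → i)
        d≤n : d ≤ n
        d≤n = ≤-trans (≤-trans (m≤n+m d q) (m≤m+n (q + d) q)) (≤-reflexive (sym n≡))
        -- With d = M - q one has d² = 2(M² + q²) - n², close to 4e - n² = 4t, so nd/4 approximates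
        -- n√t/2. The extra 2n² absorbs the rounding to integers.
        Y : ℕ
        Y = D * (n * d) + 2 * (n * n)
        first-bound : Y + 2 * (D * e) ≤ 4 * (D * f) + 4 * (n * n)
        first-bound = *-cancelˡ-≤ 2 (by-adding
          (+-mono-≤ (+-mono-≤ colours (*-monoʳ-≤ (2 * D) upper)) (+-mono-≤ (*-monoʳ-≤ (4 * D) d≤n) (+-mono-≤ (*-monoʳ-≤ n 4D≤n) (≤-trans 4D≤n (m≤m*n n n {{ℕ.>-nonZero (≤-trans (s≤s z≤n) 4≤n)}})))))
          0 (identity D n d e f q))
          where
          identity : ∀ D n d e f q →
            2 * (D * (n * d) + 2 * (n * n) + 2 * (D * e)) + (4 * D * (2 * f) + 2 * (n * n) + 2 * D * (n * d + q * q + q * q + 2 * d + 2) + (4 * D * n + (n * n + n * n))) + 0 ≡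
            2 * (4 * (D * f) + 4 * (n * n)) + (4 * D * (n * d + q * q) + 2 * D * (2 * e) + (4 * D * d + (n * (4 * D) + 4 * D)))
          identity = solve-∀
        second-bound : 4 * (D * D * (n * n) * e) ≤ Y * Y + D * D * (n * n) * (n * n)
        second-bound = by-adding
          (+-mono-≤ (*-monoʳ-≤ (D * D * (n * n)) upper′) (+-mono-≤ (*-monoʳ-≤ (4 * (D * n * n * d)) D≤n) (*-monoʳ-≤ (4 * (n * n)) (*-mono-≤ D≤n D≤n))))
          0 (identity D n d e)
          where
          upper′ : 4 * e ≤ n * n + d * d + 4 * d + 4
          upper′ = ≤-trans (≤-reflexive (*-assoc 2 2 e)) (≤-trans (*-monoʳ-≤ 2 upper) (≤-reflexive (trans (cong (λ n → 2 * (n * d + q * q + q * q + 2 * d + 2)) n≡)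
                     (trans (square q d) (cong (λ n → n * n + d * d + 4 * d + 4) (sym n≡))))))
            where
            square : ∀ q d → 2 * ((q + d + q) * d + q * q + q * q + 2 * d + 2) ≡ (q + d + q) * (q + d + q) + d * d + 4 * d + 4
            square = solve-∀
          identity : ∀ D n d e →
            4 * (D * D * (n * n) * e) + (D * D * (n * n) * (n * n + d * d + 4 * d + 4) + (4 * (D * n * n * d) * n + 4 * (n * n) * (n * n))) + 0 ≡
            (D * (n * d) + 2 * (n * n)) * (D * (n * d) + 2 * (n * n)) + D * D * (n * n) * (n * n) +
            (D * D * (n * n) * (4 * e) + (4 * (D * n * n * d) * D + 4 * (n * n) * (D * D)))
          identity = solve-∀
      conclude : (∃ λ b → b ≤ n / 2 × Q b × (b ≡ n / 2 ⊎ ¬ Q (suc b))) → Result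
      conclude (b , _ , ¬p , inj₁ refl) = contradiction balanced ¬p
      conclude (b , b≤ , ¬p , inj₂ p) =
        let d , n≡ , M≡ = halves (≤∧≢⇒< b≤ λ { refl → ¬p balanced }) in At.Y b d n≡ M≡ ¬p p , At.first-bound b d n≡ M≡ ¬p p , At.second-bound b d n≡ M≡ ¬p p

    upper-estimate : ∀ k → 1 ≤ k → ∀ {f} → (∀ f′ → Achievable n e k f′ → f ≤ f′) →
                     ∃ λ Y → 4 * (D * f) ≤ 2 * (D * e) + Y + 4 * (n * n) × (Y ≡ 0 ⊎ Y * Y + D * D * (n * n) * (n * n) ≤ 4 * (D * D * (n * n) * e))
    upper-estimate k 1≤k {f} minimal = conclude (search P? (n / 2) (≤-trans 2e+n≤n² (m≤m+n (n * n) 0)))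
      where
      -- Cliques of sizes n - b and b contain at least e edges; a smaller first clique means fewer
      -- colours, so b is pushed up to a crossing.
      P : ℕ → Set
      P b = 2 * e + n ≤ (n ∸ b) * (n ∸ b) + b * b
      P? : ∀ b → Dec (P b)
      P? b = 2 * e + n ℕ.≤? (n ∸ b) * (n ∸ b) + b * b
      Result : Set
      Result = ∃ λ Y → 4 * (D * f) ≤ 2 * (D * e) + Y + 4 * (n * n) × (Y ≡ 0 ⊎ Y * Y + D * D * (n * n) * (n * n) ≤ 4 * (D * D * (n * n) * e))
      D≤n : D ≤ n
      D≤n = ≤-trans (m≤n*m D 4) 4D≤n
      finish : ∀ b d → n ≡ b + d + b → n ∸ b ≡ b + d → P b → (b + d) * (b + d) + b * b ≤ 2 * e + 3 * n → Result
      finish b d n≡ a≡ p small = by-cases (D * (n * d) ℕ.≤? 2 * (n * n))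
        where
        open ≤-Reasoning
        a = b + d
        2≤a : 2 ≤ a
        2≤a = *-cancelˡ-≤ 2 (≤-trans 4≤n (≤-trans (≤-slack d (cong (_+ d) n≡)) (≤-reflexive (identity b d))))
          where
          identity : ∀ b d → b + d + b + d ≡ 2 * (b + d)
          identity = solve-∀
        f≤ : f ≤ triangle a
        f≤ = minimal (triangle a) (TwoCliques.two-cliques n≡ (m≤m+n b d) 2≤a k 1≤k (subst (λ a → 2 * e + n ≤ a * a + b * b) a≡ p))
        -- Four times C(a,2) is at most 2a² = (a² + b²) + (a² - b²), where a² - b² = nd.
        4f≤ : 4 * f ≤ n * d + 2 * e + 3 * n
        4f≤ = by-adding (+-mono-≤ (≤-trans (*-monoʳ-≤ 4 f≤) (≤-slack (2 * a) (sym (trans (cong (2 *_) (sym (2*triangle a))) (expand (triangle a) a))))) small)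
          0 (identity f b d e n n≡)
          where
          expand : ∀ t a → 2 * (2 * t + a) ≡ 4 * t + 2 * a
          expand = solve-∀
          identity : ∀ f b d e n → n ≡ b + d + b → 4 * f + (2 * ((b + d) * (b + d)) + (2 * e + 3 * n)) + 0 ≡ n * d + 2 * e + 3 * n + (4 * f + ((b + d) * (b + d) + b * b))
          identity f b d e n refl = ring f b d e
            where
            ring : ∀ f b d e → 4 * f + (2 * ((b + d) * (b + d)) + (2 * e + 3 * (b + d + b))) + 0 ≡ (b + d + b) * d + 2 * e + 3 * (b + d + b) + (4 * f + ((b + d) * (b + d) + b * b))
            ring = solve-∀
        4Df≤ : 4 * (D * f) ≤ 2 * (D * e) + D * (n * d) + 2 * (n * n)
        4Df≤ = by-adding (+-mono-≤ (*-monoʳ-≤ D 4f≤) (*-monoʳ-≤ n 4D≤n)) (n * n + D * n) (identity D f n d e)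
          where
          identity : ∀ D f n d e → 4 * (D * f) + (D * (n * d + 2 * e + 3 * n) + n * n) + (n * n + D * n) ≡ 2 * (D * e) + D * (n * d) + 2 * (n * n) + (D * (4 * f) + n * (4 * D))
          identity = solve-∀
        by-cases : Dec (D * (n * d) ≤ 2 * (n * n)) → Result
        by-cases (yes le) = 0 , by-adding (+-mono-≤ 4Df≤ le) 0 (identity D f e n (D * (n * d))) , inj₁ refl
          where
          identity : ∀ D f e n x → 4 * (D * f) + (2 * (D * e) + x + 2 * (n * n) + 2 * (n * n)) + 0 ≡ 2 * (D * e) + 0 + 4 * (n * n) + (4 * (D * f) + x)
          identity = solve-∀
        by-cases (no gt) = Y , ≤-trans 4Df≤ (≤-reflexive (trans (cong (λ x → 2 * (D * e) + x + 2 * (n * n)) (sym Y≡)) (identity D e Y n))) , inj₂ squares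
          where
          Y : ℕ
          Y = D * (n * d) ∸ 2 * (n * n)
          Y≡ : Y + 2 * (n * n) ≡ D * (n * d)
          Y≡ = m∸n+n≡m (<⇒≤ (≰⇒> gt))
          identity : ∀ D e Y n → 2 * (D * e) + (Y + 2 * (n * n)) + 2 * (n * n) ≡ 2 * (D * e) + Y + 4 * (n * n)
          identity = solve-∀
          4e+6n≥ : n * n + d * d ≤ 4 * e + 6 * n
          4e+6n≥ = ≤-trans (≤-reflexive (trans (cong (λ n → n * n + d * d) n≡) (square b d))) (≤-trans (*-monoʳ-≤ 2 small) (≤-reflexive (double e n)))
            where
            square : ∀ b d → (b + d + b) * (b + d + b) + d * d ≡ 2 * ((b + d) * (b + d) + b * b)
            square = solve-∀
            double : ∀ e n → 2 * (2 * e + 3 * n) ≡ 4 * e + 6 * n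
            double = solve-∀
          squares : Y * Y + D * D * (n * n) * (n * n) ≤ 4 * (D * D * (n * n) * e)
          squares = by-adding (+-mono-≤ (+-mono-≤ (*-monoʳ-≤ (D * D * (n * n)) 4e+6n≥) (≤-reflexive (cong (λ x → x * x) Y≡))) (*-monoʳ-≤ (3 * (n * n * n)) 2D²≤n))
            (4 * (Y * (n * n)) + n * n * n * n) (ring D n d e Y)
            where
            ring : ∀ D n d e Y →
              Y * Y + D * D * (n * n) * (n * n) + (D * D * (n * n) * (4 * e + 6 * n) + D * (n * d) * (D * (n * d)) + 3 * (n * n * n) * n) + (4 * (Y * (n * n)) + n * n * n * n) ≡
              4 * (D * D * (n * n) * e) + (D * D * (n * n) * (n * n + d * d) + (Y + 2 * (n * n)) * (Y + 2 * (n * n)) + 3 * (n * n * n) * (2 * (D * D)))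
            ring = solve-∀
      conclude : (∃ λ b → b ≤ n / 2 × P b × (b ≡ n / 2 ⊎ ¬ P (suc b))) → Result
      conclude (b , b≤ , p , inj₁ refl) = let d , n≡ , a≡ = halves b≤ in
        finish b d n≡ a≡ p (≤-trans (m≤m+n _ 1) (≤-trans (subst (λ a → a * a + b * b + 1 ≤ 2 * e) a≡ balanced) (m≤m+n (2 * e) (3 * n))))
      conclude (b , b≤ , p , inj₂ ¬p) = let d , n≡ , a≡ = halves b≤ in finish b d n≡ a≡ p (next-fails b d n≡ ¬p)
        where
        -- Moving one vertex changes a² + b² by less than 2n, so failure at b + 1 bounds the sum at
        -- b from above. For d = 0 the step crosses the middle and the sizes become b + 1 and b - 1.
        next-fails : ∀ b d → n ≡ b + d + b → ¬ P (suc b) → (b + d) * (b + d) + b * b ≤ 2 * e + 3 * n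
        next-fails zero zero n≡ _ = contradiction 4≤n (subst (λ n → ¬ 4 ≤ n) (sym n≡) λ ())
        next-fails (suc b) zero n≡ ¬p = by-adding (≰⇒> ¬p′) (2 * n + 3) (identity e n b)
          where
          shorter : n ∸ suc (suc b) ≡ b
          shorter = trans (cong (_∸ suc (suc b)) n≡) (trans (cong (_∸ suc (suc b)) (rearrange b)) (m+n∸n≡m b (suc (suc b))))
            where
            rearrange : ∀ b → suc b + 0 + suc b ≡ b + suc (suc b)
            rearrange = solve-∀
          ¬p′ : ¬ (2 * e + n ≤ b * b + suc (suc b) * suc (suc b))
          ¬p′ = subst (λ a → ¬ (2 * e + n ≤ a * a + suc (suc b) * suc (suc b))) shorter ¬p
          identity : ∀ e n b → (suc b + 0) * (suc b + 0) + suc b * suc b + (2 * e + n) + (2 * n + 3) ≡ 2 * e + 3 * n + suc (b * b + suc (suc b) * suc (suc b))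
          identity = solve-∀
        next-fails b (suc d) n≡ ¬p = by-adding (+-mono-≤ (≰⇒> ¬p′) (*-monoʳ-≤ 2 d≤n)) 1 (identity e n b d)
          where
          shorter : n ∸ suc b ≡ b + d
          shorter = trans (cong (_∸ suc b) n≡) (trans (cong (_∸ suc b) (rearrange b d)) (m+n∸n≡m (b + d) (suc b)))
            where
            rearrange : ∀ b d → b + suc d + b ≡ b + d + suc b
            rearrange = solve-∀
          d≤n : d ≤ n
          d≤n = ≤-trans (≤-slack (b + b + 1) (rearrange b d)) (≤-reflexive (sym n≡))
            where
            rearrange : ∀ b d → d + (b + b + 1) ≡ b + suc d + b
            rearrange = solve-∀
          ¬p′ : ¬ (2 * e + n ≤ (b + d) * (b + d) + suc b * suc b)
          ¬p′ = subst (λ a → ¬ (2 * e + n ≤ a * a + suc b * suc b)) shorter ¬p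
          identity : ∀ e n b d → (b + suc d) * (b + suc d) + b * b + (2 * e + n + 2 * n) + 1 ≡ 2 * e + 3 * n + (suc ((b + d) * (b + d) + suc b * suc b) + 2 * d)
          identity = solve-∀

-- Transfer to the rationals

⟦⟧ᵘ : ∀ a → ℚ.toℚᵘ ⟦ a ⟧ ℚᵘ.≃ mkℚᵘ (ℤ.+ a) 0
⟦⟧ᵘ a = ℚ.toℚᵘ-fromℚᵘ (mkℚᵘ (ℤ.+ a) 0)

⟦⟧-+ : ∀ a b → ⟦ a + b ⟧ ≡ ⟦ a ⟧ ℚ.+ ⟦ b ⟧
⟦⟧-+ a b = ℚ.toℚᵘ-injective (ℚᵘ.≃-trans (⟦⟧ᵘ (a + b)) (ℚᵘ.≃-trans sums
  (ℚᵘ.≃-trans (ℚᵘ.+-cong (ℚᵘ.≃-sym (⟦⟧ᵘ a)) (ℚᵘ.≃-sym (⟦⟧ᵘ b))) (ℚᵘ.≃-sym (ℚ.toℚᵘ-homo-+ ⟦ a ⟧ ⟦ b ⟧)))))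
  where
  sums : mkℚᵘ (ℤ.+ (a + b)) 0 ℚᵘ.≃ mkℚᵘ (ℤ.+ a) 0 ℚᵘ.+ mkℚᵘ (ℤ.+ b) 0
  sums = *≡* (cong (ℤ._* ℤ.+ 1) (trans (ℤ.pos-+ a b) (cong₂ ℤ._+_ (sym (ℤ.*-identityʳ (ℤ.+ a))) (sym (ℤ.*-identityʳ (ℤ.+ b))))))

⟦⟧-* : ∀ a b → ⟦ a * b ⟧ ≡ ⟦ a ⟧ ℚ.* ⟦ b ⟧
⟦⟧-* a b = ℚ.toℚᵘ-injective (ℚᵘ.≃-trans (⟦⟧ᵘ (a * b)) (ℚᵘ.≃-trans products
  (ℚᵘ.≃-trans (ℚᵘ.*-cong (ℚᵘ.≃-sym (⟦⟧ᵘ a)) (ℚᵘ.≃-sym (⟦⟧ᵘ b))) (ℚᵘ.≃-sym (ℚ.toℚᵘ-homo-* ⟦ a ⟧ ⟦ b ⟧)))))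
  where
  products : mkℚᵘ (ℤ.+ (a * b)) 0 ℚᵘ.≃ mkℚᵘ (ℤ.+ a) 0 ℚᵘ.* mkℚᵘ (ℤ.+ b) 0
  products = *≡* (cong (ℤ._* ℤ.+ 1) (ℤ.pos-* a b))

⟦⟧-mono : ∀ {a b} → a ≤ b → ⟦ a ⟧ ℚ.≤ ⟦ b ⟧
⟦⟧-mono {a} {b} a≤b = ℚ.toℚᵘ-cancel-≤ (ℚᵘ.≤-respˡ-≃ (ℚᵘ.≃-sym (⟦⟧ᵘ a)) (ℚᵘ.≤-respʳ-≃ (ℚᵘ.≃-sym (⟦⟧ᵘ b))
  (*≤* (ℤ.*-monoʳ-≤-nonNeg (ℤ.+ 1) (ℤ.+≤+ a≤b)))))

⟦⟧-nonNeg : ∀ a → ℚ.NonNegative ⟦ a ⟧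
⟦⟧-nonNeg a = ℚ.nonNegative (⟦⟧-mono {0} {a} z≤n)

⟦⟧-positive : ∀ {a} → 1 ≤ a → ℚ.Positive ⟦ a ⟧
⟦⟧-positive {a} 1≤a = ℚ.positive (ℚ.<-≤-trans (ℚ.positive⁻¹ 1ℚ) (⟦⟧-mono 1≤a))

ℚ-by-adding : ∀ {a b X Y} → X ℚ.≤ Y → a ℚ.+ Y ≡ b ℚ.+ X → a ℚ.≤ b
ℚ-by-adding {a} {b} {X} {Y} X≤Y eq = begin
  a                        ≡⟨ cancel a Y ⟩
  a ℚ.+ Y ℚ.- Y            ≡⟨ cong (ℚ._- Y) eq ⟩
  b ℚ.+ X ℚ.- Y            ≤⟨ ℚ.+-monoˡ-≤ (ℚ.- Y) (ℚ.+-monoʳ-≤ b X≤Y) ⟩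
  b ℚ.+ Y ℚ.- Y            ≡⟨ cancel b Y ⟨
  b                        ∎
  where
  open ℚ.≤-Reasoning
  open +-*-Solver using (solve; con; _:+_; _:*_; _:-_; _:=_)
  cancel : ∀ a Y → a ≡ a ℚ.+ Y ℚ.- Y
  cancel = solve 2 (λ a Y → a := a :+ Y :- Y) refl

sq-mono-ℚ : ∀ {a b} → 0ℚ ℚ.≤ a → a ℚ.≤ b → a ℚ.* a ℚ.≤ b ℚ.* b
sq-mono-ℚ {a} {b} 0≤a a≤b = ℚ.≤-trans (ℚ.*-monoˡ-≤-nonNeg a {{ℚ.nonNegative 0≤a}} a≤b)
                              (ℚ.*-monoʳ-≤-nonNeg b {{ℚ.nonNegative (ℚ.≤-trans 0≤a a≤b)}} a≤b)

reciprocal-bound : ∀ ε → 0ℚ ℚ.< ε → ∃ λ D → 1 ≤ D × 1ℚ ℚ.≤ ε ℚ.* ⟦ D ⟧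
reciprocal-bound (mkℚ (ℤ.+ zero) d _)      0<ε with () ← ℤ.Positive.pos (ℚ.positive 0<ε)
reciprocal-bound (mkℚ ℤ.-[1+ p ] d _)    0<ε with () ← ℤ.Positive.pos (ℚ.positive 0<ε)
-- The denominator serves as `D`: the numerator of a positive rational is at least 1.
reciprocal-bound ε@(mkℚ (ℤ.+ suc p) d _) 0<ε = suc d , s≤s z≤n ,
  ℚ.toℚᵘ-cancel-≤ (ℚᵘ.≤-respʳ-≃ (ℚᵘ.≃-sym (ℚᵘ.≃-trans (ℚ.toℚᵘ-homo-* ε ⟦ suc d ⟧) (ℚᵘ.*-congˡ {ℚ.toℚᵘ ε} (⟦⟧ᵘ (suc d)))))
    (*≤* (ℤ.+≤+ (s≤s (≤-slack (p * suc d) (identity p d))))))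
  where
  identity : ∀ p d → d * 1 + 0 + p * suc d ≡ (d + p * suc d) * 1
  identity = solve-∀

module Comparison (D n e f : ℕ) (ε : ℚ) (1≤D : 1 ≤ D) (1≤εD : 1ℚ ℚ.≤ ε ℚ.* ⟦ D ⟧) where

  N t c x K : ℚ
  N = ⟦ n ⟧
  t = ⟦ e ⟧ ℚ.- (N ℚ.* N) ℚ.* (½ ℚ.* ½)
  c = N ℚ.* ½
  x = ⟦ f ⟧ ℚ.- ⟦ e ⟧ ℚ.* ½
  K = ⟦ 4 ⟧ ℚ.* ⟦ D ⟧

  open +-*-Solver using (solve; con; _:+_; _:*_; _:-_; _:=_)

  private
    instance
      K-positive : ℚ.Positive K
      K-positive = ℚ.pos*pos⇒pos ⟦ 4 ⟧ ⟦ D ⟧ {{⟦⟧-positive 1≤D}}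

      N²-nonNeg : ℚ.NonNegative (⟦ 4 ⟧ ℚ.* (N ℚ.* N))
      N²-nonNeg = ℚ.nonNeg*nonNeg⇒nonNeg ⟦ 4 ⟧ (N ℚ.* N) {{ℚ.nonNeg*nonNeg⇒nonNeg N {{⟦⟧-nonNeg n}} N {{⟦⟧-nonNeg n}}}}

    -- This is n²/D ≤ εn² after multiplication by 4D; it converts the natural-number error into the
    -- rational one.
    margin : ⟦ 4 ⟧ ℚ.* (N ℚ.* N) ℚ.≤ ⟦ 4 ⟧ ℚ.* (N ℚ.* N) ℚ.* (ε ℚ.* ⟦ D ⟧)
    margin = subst (ℚ._≤ ⟦ 4 ⟧ ℚ.* (N ℚ.* N) ℚ.* (ε ℚ.* ⟦ D ⟧)) (ℚ.*-identityʳ (⟦ 4 ⟧ ℚ.* (N ℚ.* N)))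
               (ℚ.*-monoˡ-≤-nonNeg (⟦ 4 ⟧ ℚ.* (N ℚ.* N)) 1≤εD)

    -- Multiplying c√t by K = 4D squares to 16D² · (n²/4)(e - n²/4) = 4D²n²e - D²n⁴. The subtracted
    -- term is moved to the other side so that both remain images of natural numbers.
    radical : K ℚ.* K ℚ.* (c ℚ.* c ℚ.* t) ℚ.+ ⟦ D * D * (n * n) * (n * n) ⟧ ≡ ⟦ 4 * (D * D * (n * n) * e) ⟧
    radical = trans (cong (K ℚ.* K ℚ.* (c ℚ.* c ℚ.* t) ℚ.+_) eq₁) (trans (identity ⟦ D ⟧ N ⟦ e ⟧) (sym eq₂))
      where
      D²N² : ⟦ D * D * (n * n) ⟧ ≡ ⟦ D ⟧ ℚ.* ⟦ D ⟧ ℚ.* (N ℚ.* N)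
      D²N² = trans (⟦⟧-* (D * D) (n * n)) (cong₂ ℚ._*_ (⟦⟧-* D D) (⟦⟧-* n n))
      eq₁ : ⟦ D * D * (n * n) * (n * n) ⟧ ≡ ⟦ D ⟧ ℚ.* ⟦ D ⟧ ℚ.* (N ℚ.* N) ℚ.* (N ℚ.* N)
      eq₁ = trans (⟦⟧-* (D * D * (n * n)) (n * n)) (cong₂ ℚ._*_ D²N² (⟦⟧-* n n))
      eq₂ : ⟦ 4 * (D * D * (n * n) * e) ⟧ ≡ ⟦ 4 ⟧ ℚ.* (⟦ D ⟧ ℚ.* ⟦ D ⟧ ℚ.* (N ℚ.* N) ℚ.* ⟦ e ⟧)
      eq₂ = trans (⟦⟧-* 4 (D * D * (n * n) * e)) (cong (⟦ 4 ⟧ ℚ.*_) (trans (⟦⟧-* (D * D * (n * n)) e) (cong (ℚ._* ⟦ e ⟧) D²N²)))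
      identity : ∀ D N e → ⟦ 4 ⟧ ℚ.* D ℚ.* (⟦ 4 ⟧ ℚ.* D) ℚ.* (N ℚ.* ½ ℚ.* (N ℚ.* ½) ℚ.* (e ℚ.- (N ℚ.* N) ℚ.* (½ ℚ.* ½))) ℚ.+ D ℚ.* D ℚ.* (N ℚ.* N) ℚ.* (N ℚ.* N) ≡
                 ⟦ 4 ⟧ ℚ.* (D ℚ.* D ℚ.* (N ℚ.* N) ℚ.* e)
      identity = solve 3 (λ D N e →
        con ⟦ 4 ⟧ :* D :* (con ⟦ 4 ⟧ :* D) :* (N :* con ½ :* (N :* con ½) :* (e :- (N :* N) :* (con ½ :* con ½))) :+ D :* D :* (N :* N) :* (N :* N) :=
        con ⟦ 4 ⟧ :* (D :* D :* (N :* N) :* e)) refl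

    4Df : ⟦ 4 * (D * f) ⟧ ≡ ⟦ 4 ⟧ ℚ.* (⟦ D ⟧ ℚ.* ⟦ f ⟧)
    4Df = trans (⟦⟧-* 4 (D * f)) (cong (⟦ 4 ⟧ ℚ.*_) (⟦⟧-* D f))

    2De : ⟦ 2 * (D * e) ⟧ ≡ ⟦ 2 ⟧ ℚ.* (⟦ D ⟧ ℚ.* ⟦ e ⟧)
    2De = trans (⟦⟧-* 2 (D * e)) (cong (⟦ 2 ⟧ ℚ.*_) (⟦⟧-* D e))

    4n² : ⟦ 4 * (n * n) ⟧ ≡ ⟦ 4 ⟧ ℚ.* (N ℚ.* N)
    4n² = trans (⟦⟧-* 4 (n * n)) (cong (⟦ 4 ⟧ ℚ.*_) (⟦⟧-* n n))

    nonpositive : ∀ {z} → K ℚ.* z ℚ.≤ 0ℚ → z ℚ.≤ 0ℚ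
    nonpositive le = ℚ.*-cancelˡ-≤-pos K (ℚ.≤-trans le (ℚ.≤-reflexive (sym (ℚ.*-zeroʳ K))))

    nonnegative : ∀ {z} → 0ℚ ℚ.≤ K ℚ.* z → 0ℚ ℚ.≤ z
    nonnegative le = ℚ.*-cancelˡ-≤-pos K (ℚ.≤-trans (ℚ.≤-reflexive (ℚ.*-zeroʳ K)) le)

    scaled-square : ∀ z → K ℚ.* z ℚ.* (K ℚ.* z) ≡ K ℚ.* K ℚ.* (z ℚ.* z)
    scaled-square = λ z → identity K z
      where
      identity : ∀ K z → K ℚ.* z ℚ.* (K ℚ.* z) ≡ K ℚ.* K ℚ.* (z ℚ.* z)
      identity = solve 2 (λ K z → K :* z :* (K :* z) := K :* K :* (z :* z)) refl

    cancel-K² : ∀ {u v} → K ℚ.* K ℚ.* u ℚ.≤ K ℚ.* K ℚ.* v → u ℚ.≤ v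
    cancel-K² = ℚ.*-cancelˡ-≤-pos (K ℚ.* K) {{ℚ.pos*pos⇒pos K K}}

  root-below : ∀ Y → Y + 2 * (D * e) ≤ 4 * (D * f) + 4 * (n * n) → 4 * (D * D * (n * n) * e) ≤ Y * Y + D * D * (n * n) * (n * n) →
               [ c √ t ]≤ (x ℚ.+ ε ℚ.* (N ℚ.* N))
  root-below Y first second = nonnegative (ℚ.≤-trans (⟦⟧-mono {0} {Y} z≤n) Y≤) , cancel-K² (begin
    K ℚ.* K ℚ.* (c ℚ.* c ℚ.* t)      ≤⟨ ℚ-by-adding (⟦⟧-mono second) (trans (cong (K ℚ.* K ℚ.* (c ℚ.* c ℚ.* t) ℚ.+_) split) (swap {K ℚ.* K ℚ.* (c ℚ.* c ℚ.* t)} radical)) ⟩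
    ⟦ Y ⟧ ℚ.* ⟦ Y ⟧                  ≤⟨ sq-mono-ℚ (⟦⟧-mono {0} {Y} z≤n) Y≤ ⟩
    K ℚ.* z ℚ.* (K ℚ.* z)            ≡⟨ scaled-square z ⟩
    K ℚ.* K ℚ.* (z ℚ.* z)            ∎)
    where
    open ℚ.≤-Reasoning
    z = x ℚ.+ ε ℚ.* (N ℚ.* N)
    s = ⟦ D * D * (n * n) * (n * n) ⟧
    split : ⟦ Y * Y + D * D * (n * n) * (n * n) ⟧ ≡ ⟦ Y ⟧ ℚ.* ⟦ Y ⟧ ℚ.+ s
    split = trans (⟦⟧-+ (Y * Y) _) (cong (ℚ._+ s) (⟦⟧-* Y Y))
    swap : ∀ {u r} → u ℚ.+ s ≡ r → u ℚ.+ (⟦ Y ⟧ ℚ.* ⟦ Y ⟧ ℚ.+ s) ≡ ⟦ Y ⟧ ℚ.* ⟦ Y ⟧ ℚ.+ r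
    swap {u} refl = identity u (⟦ Y ⟧ ℚ.* ⟦ Y ⟧) s
      where
      identity : ∀ u y s → u ℚ.+ (y ℚ.+ s) ≡ y ℚ.+ (u ℚ.+ s)
      identity = solve 3 (λ u y s → u :+ (y :+ s) := y :+ (u :+ s)) refl
    Y≤ : ⟦ Y ⟧ ℚ.≤ K ℚ.* z
    Y≤ = ℚ-by-adding (ℚ.+-mono-≤ (⟦⟧-mono first) margin)
      (trans (cong (λ r → ⟦ Y ⟧ ℚ.+ (r ℚ.+ M ℚ.* (ε ℚ.* ⟦ D ⟧))) (trans (⟦⟧-+ (4 * (D * f)) (4 * (n * n))) (cong₂ ℚ._+_ 4Df 4n²)))
        (trans (identity ⟦ Y ⟧ ⟦ D ⟧ ⟦ f ⟧ ⟦ e ⟧ N ε)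
          (cong (λ r → K ℚ.* z ℚ.+ (r ℚ.+ M)) (sym (trans (⟦⟧-+ Y (2 * (D * e))) (cong (⟦ Y ⟧ ℚ.+_) 2De))))))
      where
      M = ⟦ 4 ⟧ ℚ.* (N ℚ.* N)
      identity : ∀ Y D f e N ε → Y ℚ.+ (⟦ 4 ⟧ ℚ.* (D ℚ.* f) ℚ.+ ⟦ 4 ⟧ ℚ.* (N ℚ.* N) ℚ.+ ⟦ 4 ⟧ ℚ.* (N ℚ.* N) ℚ.* (ε ℚ.* D)) ≡
                 ⟦ 4 ⟧ ℚ.* D ℚ.* (f ℚ.- e ℚ.* ½ ℚ.+ ε ℚ.* (N ℚ.* N)) ℚ.+ (Y ℚ.+ ⟦ 2 ⟧ ℚ.* (D ℚ.* e) ℚ.+ ⟦ 4 ⟧ ℚ.* (N ℚ.* N))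
      identity = solve 6 (λ Y D f e N ε → Y :+ (con ⟦ 4 ⟧ :* (D :* f) :+ con ⟦ 4 ⟧ :* (N :* N) :+ con ⟦ 4 ⟧ :* (N :* N) :* (ε :* D)) :=
                 con ⟦ 4 ⟧ :* D :* (f :- e :* con ½ :+ ε :* (N :* N)) :+ (Y :+ con ⟦ 2 ⟧ :* (D :* e) :+ con ⟦ 4 ⟧ :* (N :* N))) refl

  root-above : ∀ Y → 4 * (D * f) ≤ 2 * (D * e) + Y + 4 * (n * n) → Y ≡ 0 ⊎ Y * Y + D * D * (n * n) * (n * n) ≤ 4 * (D * D * (n * n) * e) →
               (x ℚ.- ε ℚ.* (N ℚ.* N)) ≤[ c √ t ]
  root-above Y first second = cases second (ℚ.≤-total z 0ℚ)
    where
    open ℚ.≤-Reasoning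
    z = x ℚ.- ε ℚ.* (N ℚ.* N)
    s = ⟦ D * D * (n * n) * (n * n) ⟧
    ≤Y : K ℚ.* z ℚ.≤ ⟦ Y ⟧
    ≤Y = ℚ-by-adding (ℚ.+-mono-≤ (⟦⟧-mono first) margin)
      (trans (cong (λ r → K ℚ.* z ℚ.+ (r ℚ.+ M ℚ.* (ε ℚ.* ⟦ D ⟧))) (trans (⟦⟧-+ (2 * (D * e) + Y) (4 * (n * n))) (cong₂ ℚ._+_ (trans (⟦⟧-+ (2 * (D * e)) Y) (cong (ℚ._+ ⟦ Y ⟧) 2De)) 4n²)))
        (trans (identity ⟦ Y ⟧ ⟦ D ⟧ ⟦ f ⟧ ⟦ e ⟧ N ε) (cong (λ r → ⟦ Y ⟧ ℚ.+ (r ℚ.+ M)) (sym 4Df))))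
      where
      M = ⟦ 4 ⟧ ℚ.* (N ℚ.* N)
      identity : ∀ Y D f e N ε → ⟦ 4 ⟧ ℚ.* D ℚ.* (f ℚ.- e ℚ.* ½ ℚ.- ε ℚ.* (N ℚ.* N)) ℚ.+ (⟦ 2 ⟧ ℚ.* (D ℚ.* e) ℚ.+ Y ℚ.+ ⟦ 4 ⟧ ℚ.* (N ℚ.* N) ℚ.+ ⟦ 4 ⟧ ℚ.* (N ℚ.* N) ℚ.* (ε ℚ.* D)) ≡
                 Y ℚ.+ (⟦ 4 ⟧ ℚ.* (D ℚ.* f) ℚ.+ ⟦ 4 ⟧ ℚ.* (N ℚ.* N))
      identity = solve 6 (λ Y D f e N ε → con ⟦ 4 ⟧ :* D :* (f :- e :* con ½ :- ε :* (N :* N)) :+ (con ⟦ 2 ⟧ :* (D :* e) :+ Y :+ con ⟦ 4 ⟧ :* (N :* N) :+ con ⟦ 4 ⟧ :* (N :* N) :* (ε :* D)) :=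
                 Y :+ (con ⟦ 4 ⟧ :* (D :* f) :+ con ⟦ 4 ⟧ :* (N :* N))) refl
    cases : Y ≡ 0 ⊎ Y * Y + D * D * (n * n) * (n * n) ≤ 4 * (D * D * (n * n) * e) → z ℚ.≤ 0ℚ ⊎ 0ℚ ℚ.≤ z → z ≤[ c √ t ]
    cases _           (inj₁ z≤0) = inj₁ z≤0
    -- When `Y` is 0, the left side is nonpositive, which is the first alternative in the comparison
    -- with a root.
    cases (inj₁ refl) (inj₂ _)   = inj₁ (nonpositive ≤Y)
    cases (inj₂ le)   (inj₂ 0≤z) = inj₂ (cancel-K² (begin
      K ℚ.* K ℚ.* (z ℚ.* z)          ≡⟨ scaled-square z ⟨
      K ℚ.* z ℚ.* (K ℚ.* z)          ≤⟨ sq-mono-ℚ (ℚ.≤-trans (ℚ.≤-reflexive (sym (ℚ.*-zeroʳ K))) (ℚ.*-monoˡ-≤-nonNeg K {{ℚ.pos⇒nonNeg K}} 0≤z)) ≤Y ⟩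
      ⟦ Y ⟧ ℚ.* ⟦ Y ⟧                ≤⟨ ℚ-by-adding (⟦⟧-mono le) (trans (cong (⟦ Y ⟧ ℚ.* ⟦ Y ⟧ ℚ.+_) (sym radical))
                                          (trans (rotate (⟦ Y ⟧ ℚ.* ⟦ Y ⟧) (K ℚ.* K ℚ.* (c ℚ.* c ℚ.* t)) s) (cong (K ℚ.* K ℚ.* (c ℚ.* c ℚ.* t) ℚ.+_) (sym split)))) ⟩
      K ℚ.* K ℚ.* (c ℚ.* c ℚ.* t)    ∎))
      where
      split : ⟦ Y * Y + D * D * (n * n) * (n * n) ⟧ ≡ ⟦ Y ⟧ ℚ.* ⟦ Y ⟧ ℚ.+ s
      split = trans (⟦⟧-+ (Y * Y) _) (cong (ℚ._+ s) (⟦⟧-* Y Y))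
      rotate : ∀ y u s → y ℚ.+ (u ℚ.+ s) ≡ u ℚ.+ (y ℚ.+ s)
      rotate = solve 3 (λ y u s → y :+ (u :+ s) := u :+ (y :+ s)) refl

theorem1p2 : ∀ (k : ℕ) → 4 ≤ k →
  ∀ (ε : ℚ) → 0ℚ ℚ.< ε →
  Σ ℕ λ n₀ → ∀ (n e : ℕ) → n₀ ≤ n →
    ℕ.suc ((n ℕ.* n) / 4) ≤ e → e ≤ n C 2 →
    ∀ (m : ℕ) → IsMaxAntiRamsey n e k m →
      let N = ⟦ n ⟧
          t = ⟦ e ⟧ ℚ.- (N ℚ.* N) ℚ.* (½ ℚ.* ½)
          c = N ℚ.* ½
          x = ⟦ m ⟧ ℚ.- ⟦ e ⟧ ℚ.* ½
      in ((x ℚ.- ε ℚ.* (N ℚ.* N)) ≤[ c √ t ]) × ([ c √ t ]≤ (x ℚ.+ ε ℚ.* (N ℚ.* N)))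
theorem1p2 k 4≤k ε 0<ε with m≤n⇒∃[o]m+o≡n 4≤k | reciprocal-bound ε 0<ε
... | j , refl | D , 1≤D , 1≤εD = bound , proof
  where
  bound : ℕ
  -- The lower bound is used with precision 4D. The terms `4 * D` and `2 * (D * D)` make rounding
  -- errors of order n and n³ small, and 4 gives the larger clique at least two vertices.
  bound = lower-bound j (4 * D) + (4 * D + 2 * (D * D) + 4)
  proof : ∀ (n e : ℕ) → bound ≤ n → suc ((n * n) / 4) ≤ e → e ≤ n C 2 → ∀ m → IsMaxAntiRamsey n e (4 + j) m → _ × _
  proof n e large n²/4<e e≤ m (achievable , minimal) =
    let Y , first , second = upper-estimate (4 + j) (s≤s z≤n) minimal
        Y′ , first′ , second′ = lower-estimate j 1≤D (≤-trans (m≤m+n _ _) large) achievable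
    in root-above Y first second , root-below Y′ first′ second′
    where
    open Comparison D n e m ε 1≤D 1≤εD
    rest : 4 * D + 2 * (D * D) + 4 ≤ n
    rest = ≤-trans (m≤n+m _ (lower-bound j (4 * D))) large
    open Extremal.Estimates n e n²/4<e e≤ D (≤-trans (≤-trans (m≤m+n (4 * D) (2 * (D * D))) (m≤m+n _ 4)) rest)
      (≤-trans (≤-trans (m≤n+m (2 * (D * D)) (4 * D)) (m≤m+n _ 4)) rest) (≤-trans (m≤n+m 4 (4 * D + 2 * (D * D))) rest)
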